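{- Let $n,k,d$ be integers with $1\le k\le n-1$ and $d\ge 2$, and let $\mathcal{T}_d^{(n,k)}$ be the class of trees with boundary having $n$ vertices, exactly $k$ of them interior, such that every interior vertex has degree at least $d$. A tree $G\in\mathcal{T}_d^{(n,k)}$ has the Faber-Krahn property in $\mathcal{T}_d^{(n,k)}$ if and only if $G$ is an SLO$^\ast$-tree in which one interior vertex has degree $d^\circ=d+\sum_{v\in V_0}(d_v-d)$ and all other interior vertices have degree $d$ (here $d_v$ denotes the degree of $v$ in $G$; note $\sum_{v\in V_0}d_v=n+k-2$ for every tree in the class). Such a $G$ is uniquely determined up to isomorphism.
   Context: A tree with boundary is a finite tree $G=(V,E)$ whose vertex set is partitioned into the set $\partial V$ of boundary vertices, which are exactly the vertices of degree $1$, and the set $V_0$ of interior vertices, which are exactly the vertices of degree at least $2$; both sets are nonempty. The Dirichlet operator $\Delta_0$ is the principal submatrix of the graph Laplacian $D-A$ of $G$ (degrees taken in $G$) indexed by $V_0$; $\lambda(G)$ is its smallest eigenvalue. $G$ has the Faber-Krahn property in a class $\mathcal{C}\ni G$ if $\lambda(G)\le\lambda(H)$ for all $H\in\mathcal{C}$. For a tree with a chosen root $v_0$, the height of $v$ is $h(v)=\mathrm{dist}(v,v_0)$; if $v,w$ are adjacent and $h(w)=h(v)+1$, then $v$ is the parent of $w$ and $w$ a child of $v$. A total order $\prec$ on $V$ is spiral-like (SLO) for root $v_0$ if for all vertices: (S1) $v\prec w$ implies $h(v)\le h(w)$; (S2) if $v_1\prec v_2$ then every child of $v_1$ precedes every child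 of $v_2$; (S3) if $v\prec w$ and $v\in\partial V$ then $w\in\partial V$. It is an SLO$^\ast$-ordering if additionally (S4) for interior vertices $v\prec w$ implies $d_v\le d_w$. An SLO$^\ast$-tree is a tree with boundary admitting an SLO$^\ast$-ordering for some root. -}

module Defs where

open import Data.Bool.Base using (Bool; true; false; if_then_else_)
open import Data.Fin.Base using (Fin)
import Data.Fin.Properties as Fin
open import Data.Fin.Permutation using (Permutation; _⟨$⟩ʳ_)
open import Data.Fin.Subset using (Subset) renaming (∣_∣ to card)
open import Data.Integer.Base as ℤ using (ℤ; +_)
open import Data.List.Base using (List; _∷_; _∷ʳ_; length; map; mapMaybe; foldr; sum; allFin)
open import Data.List.Relation.Unary.Linked using (Linked)
open import Data.List.Relation.Unary.Unique.Propositional using (Unique)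
open import Data.Maybe.Base as Maybe using ()
open import Data.Nat.Base as ℕ using (ℕ; suc)
import Data.Nat.Properties as ℕ
open import Data.Product.Base using (Σ; ∃; ∃-syntax; _×_; _,_; proj₁)
open import Data.Rational.Base as ℚ using (ℚ; 0ℚ; 1ℚ; ½; ∣_∣)
import Data.Rational.Properties as ℚ
open import Data.Rational.Solver using (module +-*-Solver)
open import Data.Sum.Base using (_⊎_)
open import Data.Vec.Base using (tabulate)
open import Level using (0ℓ)
open import Relation.Binary.Core using (Rel)
open import Relation.Binary.PropositionalEquality using (_≡_; _≢_; refl; sym; trans; cong; cong₂; subst)
open import Relation.Binary.Structures using (IsStrictTotalOrder)
open import Relation.Nullary.Decidable using (Dec; ⌊_⌋; dec⇒maybe)
open import Relation.Nullary.Negation using (¬_)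
open import Relation.Unary using (Pred)

-- Real numbers: Cauchy sequences of rationals, with the setoid equality
-- _≈_ in place of the quotient.

IsCauchy : (ℕ → ℚ) → Set
IsCauchy s = ∀ ε → 0ℚ ℚ.< ε →
  ∃[ N ] (∀ m n → N ℕ.≤ m → N ℕ.≤ n → ∣ s m ℚ.- s n ∣ ℚ.< ε)

record ℝ : Set where
  constructor mkℝ
  field
    seq    : ℕ → ℚ
    cauchy : IsCauchy seq

open ℝ public

infix 4 _≈_ _≤ᵣ_

_≈_ : Rel ℝ 0ℓ
x ≈ y = ∀ ε → 0ℚ ℚ.< ε →
  ∃[ N ] (∀ n → N ℕ.≤ n → ∣ seq x n ℚ.- seq y n ∣ ℚ.< ε)

_≤ᵣ_ : Rel ℝ 0ℓ
x ≤ᵣ y = ∀ ε → 0ℚ ℚ.< ε →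
  ∃[ N ] (∀ n → N ℕ.≤ n → seq x n ℚ.< seq y n ℚ.+ ε)

private
  half-pos : ∀ {ε} → 0ℚ ℚ.< ε → 0ℚ ℚ.< ε ℚ.* ½
  half-pos {ε} 0<ε =
    subst (ℚ._< ε ℚ.* ½) (ℚ.*-zeroˡ ½) (ℚ.*-monoˡ-<-pos ½ 0<ε)

  half+half : ∀ ε → ε ℚ.* ½ ℚ.+ ε ℚ.* ½ ≡ ε
  half+half ε = trans (sym (ℚ.*-distribˡ-+ ε ½ ½)) (ℚ.*-identityʳ ε)

  const-cauchy : ∀ q → IsCauchy (λ _ → q)
  const-cauchy q ε 0<ε =
    0 , λ _ _ _ _ → subst (λ r → ∣ r ∣ ℚ.< ε) (sym (ℚ.+-inverseʳ q)) 0<ε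

  +-cauchy : ∀ {s t} → IsCauchy s → IsCauchy t → IsCauchy (λ n → s n ℚ.+ t n)
  +-cauchy {s} {t} cs ct ε 0<ε =
    let (N₁ , h₁) = cs (ε ℚ.* ½) (half-pos 0<ε)
        (N₂ , h₂) = ct (ε ℚ.* ½) (half-pos 0<ε)
    in N₁ ℕ.⊔ N₂ , λ m n N≤m N≤n →
      let open ℚ.≤-Reasoning in begin-strict
        ∣ s m ℚ.+ t m ℚ.- (s n ℚ.+ t n) ∣
          ≡⟨ cong ∣_∣ (regroup (s m) (t m) (s n) (t n)) ⟩
        ∣ (s m ℚ.- s n) ℚ.+ (t m ℚ.- t n) ∣
          ≤⟨ ℚ.∣p+q∣≤∣p∣+∣q∣ (s m ℚ.- s n) (t m ℚ.- t n) ⟩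
        ∣ s m ℚ.- s n ∣ ℚ.+ ∣ t m ℚ.- t n ∣
          <⟨ ℚ.+-mono-<
               (h₁ m n (ℕ.m⊔n≤o⇒m≤o N₁ N₂ N≤m) (ℕ.m⊔n≤o⇒m≤o N₁ N₂ N≤n))
               (h₂ m n (ℕ.m⊔n≤o⇒n≤o N₁ N₂ N≤m) (ℕ.m⊔n≤o⇒n≤o N₁ N₂ N≤n)) ⟩
        ε ℚ.* ½ ℚ.+ ε ℚ.* ½
          ≡⟨ half+half ε ⟩
        ε ∎
    where
    open +-*-Solver
    regroup : ∀ a b c d → a ℚ.+ b ℚ.- (c ℚ.+ d) ≡ (a ℚ.- c) ℚ.+ (b ℚ.- d)
    regroup = solve 4 (λ a b c d → a :+ b :- (c :+ d) := (a :- c) :+ (b :- d)) refl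

  bounded : ∀ {s} → IsCauchy s →
    ∃[ B ] (0ℚ ℚ.< B × ∃[ N ] (∀ n → N ℕ.≤ n → ∣ s n ∣ ℚ.< B))
  bounded {s} cs =
    let (N , h) = cs 1ℚ (ℚ.positive⁻¹ 1ℚ)
        open ℚ.≤-Reasoning
    in ∣ s N ∣ ℚ.+ 1ℚ
     , ℚ.+-mono-≤-< (ℚ.0≤∣p∣ (s N)) (ℚ.positive⁻¹ 1ℚ)
     , N , λ n N≤n → begin-strict
         ∣ s n ∣                            ≡⟨ cong ∣_∣ (regroup (s n) (s N)) ⟩
         ∣ s N ℚ.+ (s n ℚ.- s N) ∣          ≤⟨ ℚ.∣p+q∣≤∣p∣+∣q∣ (s N) (s n ℚ.- s N) ⟩
         ∣ s N ∣ ℚ.+ ∣ s n ℚ.- s N ∣        <⟨ ℚ.+-monoʳ-< ∣ s N ∣ (h n N N≤n ℕ.≤-refl) ⟩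
         ∣ s N ∣ ℚ.+ 1ℚ                     ∎
    where
    open +-*-Solver
    regroup : ∀ a b → a ≡ b ℚ.+ (a ℚ.- b)
    regroup = solve 2 (λ a b → a := b :+ (a :- b)) refl

  split : ∀ B ε → 0ℚ ℚ.< B → 0ℚ ℚ.< ε → ∃[ δ ] (0ℚ ℚ.< δ × B ℚ.* δ ≡ ε)
  split B ε 0<B 0<ε = ε ℚ.* B⁻¹ , 0<δ , eq
    where
    instance
      B-pos : ℚ.Positive B
      B-pos = ℚ.positive 0<B
      B≢0 : ℚ.NonZero B
      B≢0 = ℚ.pos⇒nonZero B
    B⁻¹ : ℚ
    B⁻¹ = ℚ.1/ B
    instance
      B⁻¹-pos : ℚ.Positive B⁻¹
      B⁻¹-pos = ℚ.1/pos⇒pos B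
    0<δ : 0ℚ ℚ.< ε ℚ.* B⁻¹
    0<δ = subst (ℚ._< ε ℚ.* B⁻¹) (ℚ.*-zeroˡ B⁻¹) (ℚ.*-monoˡ-<-pos B⁻¹ 0<ε)
    open +-*-Solver
    swap : ∀ a b c → a ℚ.* (b ℚ.* c) ≡ b ℚ.* (a ℚ.* c)
    swap = solve 3 (λ a b c → a :* (b :* c) := b :* (a :* c)) refl
    eq : B ℚ.* (ε ℚ.* B⁻¹) ≡ ε
    eq = trans (swap B ε B⁻¹)
        (trans (cong (ε ℚ.*_) (ℚ.*-inverseʳ B)) (ℚ.*-identityʳ ε))

  *-bound : ∀ {p q B δ} → ∣ p ∣ ℚ.< B → 0ℚ ℚ.< B → ∣ q ∣ ℚ.< δ →
    ∣ p ℚ.* q ∣ ℚ.< B ℚ.* δ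
  *-bound {p} {q} {B} {δ} p<B 0<B q<δ = begin-strict
    ∣ p ℚ.* q ∣        ≡⟨ ℚ.∣p*q∣≡∣p∣*∣q∣ p q ⟩
    ∣ p ∣ ℚ.* ∣ q ∣    ≤⟨ ℚ.*-monoʳ-≤-nonNeg ∣ q ∣ (ℚ.<⇒≤ p<B) ⟩
    B ℚ.* ∣ q ∣        <⟨ ℚ.*-monoʳ-<-pos B q<δ ⟩
    B ℚ.* δ            ∎
    where
    open ℚ.≤-Reasoning
    instance
      _ : ℚ.Positive B
      _ = ℚ.positive 0<B
      _ : ℚ.NonNegative ∣ q ∣
      _ = ℚ.nonNegative (ℚ.0≤∣p∣ q)

  *-cauchy : ∀ {s t} → IsCauchy s → IsCauchy t → IsCauchy (λ n → s n ℚ.* t n)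
  *-cauchy {s} {t} cs ct ε 0<ε =
    let (B₁ , 0<B₁ , M₁ , b₁) = bounded cs
        (B₂ , 0<B₂ , M₂ , b₂) = bounded ct
        (δ₁ , 0<δ₁ , e₁) = split B₁ (ε ℚ.* ½) 0<B₁ (half-pos 0<ε)
        (δ₂ , 0<δ₂ , e₂) = split B₂ (ε ℚ.* ½) 0<B₂ (half-pos 0<ε)
        (N₁ , h₁) = ct δ₁ 0<δ₁
        (N₂ , h₂) = cs δ₂ 0<δ₂
        M = M₁ ℕ.⊔ M₂
        N = N₁ ℕ.⊔ N₂
        open ℚ.≤-Reasoning
    in M ℕ.⊔ N , λ m n K≤m K≤n →
      let M≤m = ℕ.m⊔n≤o⇒m≤o M N K≤m
          N≤m = ℕ.m⊔n≤o⇒n≤o M N K≤m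
          M≤n = ℕ.m⊔n≤o⇒m≤o M N K≤n
          N≤n = ℕ.m⊔n≤o⇒n≤o M N K≤n
      in begin-strict
        ∣ s m ℚ.* t m ℚ.- s n ℚ.* t n ∣
          ≡⟨ cong ∣_∣ (regroup (s m) (t m) (s n) (t n)) ⟩
        ∣ s m ℚ.* (t m ℚ.- t n) ℚ.+ t n ℚ.* (s m ℚ.- s n) ∣
          ≤⟨ ℚ.∣p+q∣≤∣p∣+∣q∣ (s m ℚ.* (t m ℚ.- t n)) (t n ℚ.* (s m ℚ.- s n)) ⟩
        ∣ s m ℚ.* (t m ℚ.- t n) ∣ ℚ.+ ∣ t n ℚ.* (s m ℚ.- s n) ∣
          <⟨ ℚ.+-mono-<
               (*-bound {s m} {t m ℚ.- t n} (b₁ m (ℕ.m⊔n≤o⇒m≤o M₁ M₂ M≤m)) 0<B₁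
                 (h₁ m n (ℕ.m⊔n≤o⇒m≤o N₁ N₂ N≤m) (ℕ.m⊔n≤o⇒m≤o N₁ N₂ N≤n)))
               (*-bound {t n} {s m ℚ.- s n} (b₂ n (ℕ.m⊔n≤o⇒n≤o M₁ M₂ M≤n)) 0<B₂
                 (h₂ m n (ℕ.m⊔n≤o⇒n≤o N₁ N₂ N≤m) (ℕ.m⊔n≤o⇒n≤o N₁ N₂ N≤n))) ⟩
        B₁ ℚ.* δ₁ ℚ.+ B₂ ℚ.* δ₂
          ≡⟨ cong₂ ℚ._+_ e₁ e₂ ⟩
        ε ℚ.* ½ ℚ.+ ε ℚ.* ½
          ≡⟨ half+half ε ⟩
        ε ∎
    where
    open +-*-Solver
    regroup : ∀ a b c d →
      a ℚ.* b ℚ.- c ℚ.* d ≡ a ℚ.* (b ℚ.- d) ℚ.+ d ℚ.* (a ℚ.- c)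
    regroup = solve 4 (λ a b c d →
      a :* b :- c :* d := a :* (b :- d) :+ d :* (a :- c)) refl

infixl 6 _+ᵣ_
infixl 7 _*ᵣ_

_+ᵣ_ : ℝ → ℝ → ℝ
x +ᵣ y = mkℝ (λ n → seq x n ℚ.+ seq y n) (+-cauchy {seq x} {seq y} (cauchy x) (cauchy y))

_*ᵣ_ : ℝ → ℝ → ℝ
x *ᵣ y = mkℝ (λ n → seq x n ℚ.* seq y n) (*-cauchy {seq x} {seq y} (cauchy x) (cauchy y))

fromℚ : ℚ → ℝ
fromℚ q = mkℝ (λ _ → q) (const-cauchy q)

fromℤ : ℤ → ℝ
fromℤ i = fromℚ (i ℚ./ 1)

0ᵣ : ℝ
0ᵣ = fromℚ 0ℚ

record Graph (n : ℕ) : Set where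
  field
    adj       : Fin n → Fin n → Bool
    symmetric : ∀ u v → adj u v ≡ adj v u
    loopless  : ∀ v → adj v v ≡ false

open Graph public

module _ {n : ℕ} (G : Graph n) where

  Adj : Rel (Fin n) 0ℓ
  Adj u v = adj G u v ≡ true

  neighbours : Fin n → Subset n
  neighbours v = tabulate (adj G v)

  degree : Fin n → ℕ
  degree v = card (neighbours v)

  data Walk (u : Fin n) : Fin n → ℕ → Set where
    stay : Walk u u 0
    step : ∀ {v w ℓ} → Walk u v ℓ → Adj v w → Walk u w (suc ℓ)

  Connected : Set
  Connected = ∀ u v → ∃[ ℓ ] Walk u v ℓ

  -- u ∷ vs is the cycle u, v₁, …, vₘ, back to u, with m ≥ 2.
  IsCycle : Fin n → List (Fin n) → Set
  IsCycle u vs =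
    2 ℕ.≤ length vs × Unique (u ∷ vs) × Linked Adj (u ∷ (vs ∷ʳ u))

  Acyclic : Set
  Acyclic = ∀ u vs → ¬ IsCycle u vs

  IsTree : Set
  IsTree = Connected × Acyclic

  IsDist : Fin n → Fin n → ℕ → Set
  IsDist u v ℓ = Walk u v ℓ × (∀ m → Walk u v m → ℓ ℕ.≤ m)

  Boundary : Pred (Fin n) 0ℓ
  Boundary v = degree v ≡ 1

  Interior : Pred (Fin n) 0ℓ
  Interior v = 2 ℕ.≤ degree v

  interior? : ∀ v → Dec (Interior v)
  interior? v = 2 ℕ.≤? degree v

  record IsTreeWithBoundary : Set where
    field
      tree              : IsTree
      boundary⊎interior : ∀ v → Boundary v ⊎ Interior v
      ∂V-nonempty       : ∃ Boundary
      V₀-nonempty       : ∃ Interior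

  V₀ : Set
  V₀ = Σ (Fin n) Interior

  interiors : List V₀
  interiors = mapMaybe (λ v → Maybe.map (v ,_) (dec⇒maybe (interior? v))) (allFin n)

  laplacian : Fin n → Fin n → ℤ
  laplacian u v =
    (if ⌊ u Fin.≟ v ⌋ then + degree u else + 0)
      ℤ.- (if adj G u v then + 1 else + 0)

  Δ₀ : V₀ → V₀ → ℤ
  Δ₀ (u , _) (v , _) = laplacian u v

  applyΔ₀ : (V₀ → ℝ) → (V₀ → ℝ)
  applyΔ₀ f u = foldr _+ᵣ_ 0ᵣ (map (λ v → fromℤ (Δ₀ u v) *ᵣ f v) interiors)

  IsEigenvalue : ℝ → Set
  IsEigenvalue μ =
    ∃[ f ] ((∃[ v ] ¬ (f v ≈ 0ᵣ)) × (∀ u → applyΔ₀ f u ≈ μ *ᵣ f u))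

  IsSmallestEigenvalue : ℝ → Set
  IsSmallestEigenvalue μ = IsEigenvalue μ × (∀ ν → IsEigenvalue ν → μ ≤ᵣ ν)

  record IsSLO (v₀ : Fin n) (_≺_ : Rel (Fin n) 0ℓ) : Set where
    field
      isStrictTotalOrder : IsStrictTotalOrder _≡_ _≺_
      h      : Fin n → ℕ
      h-dist : ∀ v → IsDist v v₀ (h v)

    Child : Fin n → Fin n → Set
    Child v w = Adj v w × h w ≡ suc (h v)

    field
      S1 : ∀ {v w} → v ≺ w → h v ℕ.≤ h w
      S2 : ∀ {v₁ v₂ w₁ w₂} → v₁ ≺ v₂ → Child v₁ w₁ → Child v₂ w₂ → w₁ ≺ w₂
      S3 : ∀ {v w} → v ≺ w → Boundary v → Boundary w

  record IsSLO* (v₀ : Fin n) (_≺_ : Rel (Fin n) 0ℓ) : Set where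
    field
      isSLO : IsSLO v₀ _≺_
      S4    : ∀ {v w} → Interior v → Interior w → v ≺ w → degree v ℕ.≤ degree w

  IsSLO*Tree : Set₁
  IsSLO*Tree = IsTreeWithBoundary × (∃[ v₀ ] ∃ (IsSLO* v₀))

  interiorDegreeSum : ℕ
  interiorDegreeSum = sum (map (λ v → degree (proj₁ v)) interiors)

  -- Truncated subtraction is exact here whenever every interior vertex has
  -- degree at least d.
  d° : ℕ → ℕ
  d° d = d ℕ.+ sum (map (λ v → degree (proj₁ v) ℕ.∸ d) interiors)

  OneExceptionalDegree : ℕ → Set
  OneExceptionalDegree d =
    ∃[ v ] (Interior v × degree v ≡ d° d
      × (∀ w → Interior w → w ≢ v → degree w ≡ d))

record 𝒯 (d n k : ℕ) (G : Graph n) : Set where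
  field
    isTreeWithBoundary : IsTreeWithBoundary G
    interior-count     : length (interiors G) ≡ k
    interior-degree    : ∀ v → Interior G v → d ℕ.≤ degree G v

-- λ(G) ≤ λ(H).  Δ₀ is a real symmetric matrix of positive size, so each of
-- the two smallest eigenvalues exists and is unique up to _≈_.
_λ≤_ : ∀ {n} → Graph n → Graph n → Set
G λ≤ H = ∀ {μ ν} → IsSmallestEigenvalue G μ → IsSmallestEigenvalue H ν → μ ≤ᵣ ν

FaberKrahn : ∀ {n} → Pred (Graph n) 0ℓ → Graph n → Set
FaberKrahn 𝒞 G = 𝒞 G × (∀ H → 𝒞 H → G λ≤ H)

_≅_ : ∀ {n} → Graph n → Graph n → Set
_≅_ {n} G H =
  Σ (Permutation n n) λ π → ∀ u v → adj G u v ≡ adj H (π ⟨$⟩ʳ u) (π ⟨$⟩ʳ v)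

{-# OPTIONS --safe #-}
module Submission where

-- Let f > 0 be the ground state of a tree H in the class, rooted at a maximum
-- of f, and let f₀ ≥ f₁ ≥ … be its sorted values.  The Dirichlet energy of f is
-- the sum over the non-root vertices w of (f(w) - f(parent of w))².  The first
-- t + 1 vertices have at least m(t) = (t + 1)(d - 1) + 1 children altogether,
-- and the tree filled breadth-first with exactly that many children (all the
-- surplus going to the last interior vertex) pairs the sorted children with the
-- smallest parents allowed.  A layer-cake form of the rearrangement inequality
-- shows that moving the sorted values to this spiral tree does not increase the
-- energy, so the spiral tree has the least eigenvalue.  In the equality case
-- the sorted values are also an eigenfunction of the spiral tree; this forces
-- the children of a run of tied vertices to be tied as well, and breaking ties
-- by parents then identifies H with the spiral tree.  An SLO* tree with one
-- exceptional degree is the spiral tree by its definition.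
--
-- The ground state is constructed over the constructive reals by power
-- iteration, whose rate of convergence comes from Doeblin's contraction
-- argument; the inequality between eigenvalues is ¬¬-stable and isomorphism
-- with the spiral tree is decidable, so values may be compared classically.

-- No spectral theorem or min-max principle enters. Writing a function on the spiral tree as its
-- ground state times h turns energy minus μ times norm into a sum of squares; this one identity
-- gives the Rayleigh bound, its equality case, and the minimality of μ among the eigenvalues.
-- Comparing two trees through one sequence of values makes sense because both are numbered with
-- their interior vertices at 0, ..., κ: the norm and the Dirichlet condition do not notice which
-- tree is meant. The parameters are κ = k - 1, e = d - 2, q = d - 1, and D is the sum of d_v - d
-- over the interior vertices, which n, k and d determine. The obstacle in the equality case is
-- ties. A strict drop of the sorted values fixes the number of children of the vertices before it
-- and separates their values from the rest; inside a run of equal values the energy gives no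
-- information, and only the eigenvalue equation on the spiral tree does. The surplus D can then sit
-- only at the end of the last run, which must consist of κ alone unless D = 0.

open import Defs hiding (_≈_)
import Defs

open import Algebra.Bundles using (CommutativeMonoid; CommutativeRing; RawRing)
import Algebra.Properties.AbelianGroup as AbelianGroupProperties
import Algebra.Properties.CommutativeMonoid.Sum as CommutativeMonoidSum
import Algebra.Properties.CommutativeSemigroup as CommutativeSemigroupProperties
import Algebra.Properties.Ring as RingProperties
import Algebra.Properties.Semiring.Mult as SemiringMult
import Algebra.Properties.Semiring.Sum as SemiringSum
import Algebra.Solver.CommutativeMonoid as CommutativeMonoidSolver
import Algebra.Solver.Ring as RingSolver
open import Algebra.Solver.Ring.AlmostCommutativeRing using (fromCommutativeRing; _-Raw-AlmostCommutative⟶_; Induced-equivalence)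
open import Algebra.Structures using (IsCommutativeRing)
open import Data.Bool.Base using (Bool; true; false; if_then_else_; not; _∨_)
import Data.Bool.Properties as Bool
open import Data.Fin.Base as Fin using (Fin; zero; suc; toℕ)
open import Data.Fin.Permutation as Perm using (Permutation′; permutation; _⟨$⟩ʳ_; _⟨$⟩ˡ_)
import Data.Fin.Properties as Fin
open import Data.Fin.Subset using () renaming (∣_∣ to card)
open import Data.Integer.Base as ℤ using (+_)
import Data.Integer.Properties as ℤ
open import Data.List.Base as List using (List; []; _∷_; _∷ʳ_; length)
import Data.List.Properties as List
open import Data.List.Relation.Unary.All as All using (All; []; _∷_)
import Data.List.Relation.Unary.All.Properties as All
open import Data.List.Relation.Unary.AllPairs using ([]; _∷_)
import Data.List.Relation.Unary.AllPairs.Properties as AllPairs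
open import Data.List.Relation.Unary.Linked using (Linked; []; [-]; _∷_)
open import Data.List.Relation.Unary.Unique.Propositional using (Unique)
open import Data.Maybe.Base as Maybe using (Maybe; just; nothing; maybe′)
open import Data.Nat.Base as ℕ using (ℕ; zero; suc; z≤n; s≤s)
open import Data.Nat.Divisibility using (divides-refl)
import Data.Nat.DivMod as ℕ
import Data.Nat.Properties as ℕ
open import Data.Product.Base using (Σ; ∃; ∃-syntax; _×_; _,_; proj₁; proj₂)
open import Data.Rational.Base as ℚ using (ℚ; 0ℚ; 1ℚ; ½; ∣_∣)
import Data.Rational.Properties as ℚ
import Data.Rational.Solver as ℚSolver
import Data.Rational.Unnormalised.Base as ℚᵘ
import Data.Rational.Unnormalised.Properties as ℚᵘ
open import Data.Sum.Base using (_⊎_; inj₁; inj₂)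
import Data.Vec.Base as Vec
open import Function.Base using (_∘_)
open import Function.Bundles using (_⇔_; mk⇔)
open import Function.Definitions using (Injective)
open import Level using (0ℓ)
open import Relation.Binary.Bundles using (Poset)
open import Relation.Binary.Core using (Rel)
open import Relation.Binary.Definitions using (WeaklyDecidable; Tri; tri<; tri≈; tri>)
open import Relation.Binary.PropositionalEquality as ≡ using (_≡_; _≢_)
import Relation.Binary.Reasoning.PartialOrder as PartialOrderReasoning
import Relation.Binary.Reasoning.Setoid as SetoidReasoning
open import Relation.Binary.Structures using (IsStrictTotalOrder)
open import Relation.Nullary.Decidable using (Dec; yes; no; ⌊_⌋; dec⇒maybe; decidable-stable; map′; _×-dec_; _→-dec_)
open import Relation.Nullary.Negation using (¬_; contradiction)

-- Ordered integral domains and finite sums.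

-- Differences of naturals as solver coefficients, so that cancellation is
-- recognised over an arbitrary commutative ring.
module IntegerSolver (R : CommutativeRing 0ℓ 0ℓ) where
  open CommutativeRing R
  open SemiringMult semiring using () renaming (_×_ to _·_; ×-homo-+ to ·-homo-+; ×1-homo-* to ·1-homo-*)
  open RingProperties ring using (-‿distribˡ-*; -‿distribʳ-*)
  open AbelianGroupProperties +-abelianGroup using (⁻¹-∙-comm; ⁻¹-involutive; ε⁻¹≈ε)
  open SetoidReasoning setoid
  open CommutativeSemigroupProperties +-commutativeSemigroup using (interchange)

  private
    ι : ℕ → Carrier
    ι a = a · 1#

    val : ℕ × ℕ → Carrier
    val (a , b) = ι a - ι b

    differences : RawRing 0ℓ 0ℓ
    differences = record
      { Carrier = ℕ × ℕ
      ; _≈_ = _≡_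
      ; _+_ = λ (a , b) (c , d) → a ℕ.+ c , b ℕ.+ d
      ; _*_ = λ (a , b) (c , d) → a ℕ.* c ℕ.+ b ℕ.* d , a ℕ.* d ℕ.+ b ℕ.* c
      ; -_ = λ (a , b) → b , a
      ; 0# = 0 , 0
      ; 1# = 1 , 0
      }

    sub-interchange : ∀ x y z w → (x + y) - (z + w) ≈ (x - z) + (y - w)
    sub-interchange x y z w = begin
      (x + y) - (z + w)       ≈⟨ +-congˡ (⁻¹-∙-comm z w) ⟨
      (x + y) + (- z + - w)   ≈⟨ interchange x y (- z) (- w) ⟩
      (x - z) + (y - w)       ∎

    val-+ : ∀ u v → val (RawRing._+_ differences u v) ≈ val u + val v
    val-+ (a , b) (c , d) = trans
      (+-cong (·-homo-+ 1# a c) (-‿cong (·-homo-+ 1# b d)))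
      (sub-interchange (ι a) (ι c) (ι b) (ι d))

    val-* : ∀ u v → val (RawRing._*_ differences u v) ≈ val u * val v
    val-* (a , b) (c , d) = begin
      ι (a ℕ.* c ℕ.+ b ℕ.* d) - ι (a ℕ.* d ℕ.+ b ℕ.* c)
        ≈⟨ +-cong (split a c b d) (-‿cong (split a d b c)) ⟩
      (A * C + B * D) - (A * D + B * C)
        ≈⟨ sub-interchange (A * C) (B * D) (A * D) (B * C) ⟩
      (A * C - A * D) + (B * D - B * C)
        ≈⟨ +-cong (+-congˡ (-‿distribʳ-* A D)) (trans (+-cong (neg² B D) (-‿distribˡ-* B C)) (+-comm _ _)) ⟩
      (A * C + A * - D) + (- B * C + - B * - D)
        ≈⟨ +-cong (distribˡ A C (- D)) (distribˡ (- B) C (- D)) ⟨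
      A * (C - D) + - B * (C - D)
        ≈⟨ distribʳ (C - D) A (- B) ⟨
      (A - B) * (C - D) ∎
      where
      A = ι a
      B = ι b
      C = ι c
      D = ι d
      split : ∀ w x y z → ι (w ℕ.* x ℕ.+ y ℕ.* z) ≈ ι w * ι x + ι y * ι z
      split w x y z = trans (·-homo-+ 1# (w ℕ.* x) (y ℕ.* z)) (+-cong (·1-homo-* w x) (·1-homo-* y z))
      neg² : ∀ x y → x * y ≈ - x * - y
      neg² x y = begin
        x * y           ≈⟨ ⁻¹-involutive (x * y) ⟨
        - - (x * y)     ≈⟨ -‿cong (-‿distribˡ-* x y) ⟩
        - (- x * y)     ≈⟨ -‿distribʳ-* (- x) y ⟩
        - x * - y       ∎

    val-neg : ∀ u → val (RawRing.-_ differences u) ≈ - val u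
    val-neg (a , b) = begin
      ι b - ι a         ≈⟨ +-comm (ι b) (- ι a) ⟩
      - ι a + ι b       ≈⟨ +-congˡ (⁻¹-involutive (ι b)) ⟨
      - ι a + - - ι b   ≈⟨ ⁻¹-∙-comm (ι a) (- ι b) ⟩
      - (ι a - ι b)     ∎

    morphism : differences -Raw-AlmostCommutative⟶ fromCommutativeRing R
    morphism = record
      { ⟦_⟧ = val
      ; +-homo = val-+
      ; *-homo = val-*
      ; -‿homo = val-neg
      ; 0-homo = -‿inverseʳ 0#
      ; 1-homo = trans (+-cong (+-identityʳ 1#) ε⁻¹≈ε) (+-identityʳ 1#)
      }

    val-cong : ∀ a b c d → a ℕ.+ d ≡ c ℕ.+ b → val (a , b) ≈ val (c , d)
    val-cong a b c d eq = begin
      ι a - ι b                       ≈⟨ +-identityʳ _ ⟨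
      ι a - ι b + 0#                  ≈⟨ +-congˡ (-‿inverseʳ (ι d)) ⟨
      (ι a - ι b) + (ι d - ι d)       ≈⟨ interchange (ι a) (- ι b) (ι d) (- ι d) ⟩
      (ι a + ι d) + (- ι b + - ι d)   ≈⟨ +-cong (trans (sym (·-homo-+ 1# a d)) (trans (reflexive (≡.cong ι eq)) (·-homo-+ 1# c b))) (+-comm _ _) ⟩
      (ι c + ι b) + (- ι d + - ι b)   ≈⟨ interchange (ι c) (ι b) (- ι d) (- ι b) ⟩
      (ι c - ι d) + (ι b - ι b)       ≈⟨ +-congˡ (-‿inverseʳ (ι b)) ⟩
      ι c - ι d + 0#                  ≈⟨ +-identityʳ _ ⟩
      ι c - ι d                       ∎

    _≟ᶜ_ : WeaklyDecidable (Induced-equivalence morphism)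
    (a , b) ≟ᶜ (c , d) with a ℕ.+ d ℕ.≟ c ℕ.+ b
    ... | yes eq = just (val-cong a b c d eq)
    ... | no _ = nothing

  open RingSolver differences (fromCommutativeRing R) morphism _≟ᶜ_ public
    using (solve; _:=_; _:+_; _:*_; :-_; _:-_)

-- A classical ordered integral domain, phrased so that the constructive reals
-- are an instance: strict positivity is ¬ (x ≤ 0#), and ≤ is ¬¬-stable.
record OrderedDomain : Set₁ where
  infix 4 _≤_
  field
    commutativeRing : CommutativeRing 0ℓ 0ℓ
  open CommutativeRing commutativeRing public hiding (zero)
  field
    _≤_         : Rel Carrier 0ℓ
    ≤-reflexive : ∀ {x y} → x ≈ y → x ≤ y
    ≤-trans     : ∀ {x y z} → x ≤ y → y ≤ z → x ≤ z
    ≤-antisym   : ∀ {x y} → x ≤ y → y ≤ x → x ≈ y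
    +-monoˡ-≤   : ∀ z {x y} → x ≤ y → x + z ≤ y + z
    *-nonneg    : ∀ {x y} → 0# ≤ x → 0# ≤ y → 0# ≤ x * y
    *-pos       : ∀ {x y} → ¬ (x ≤ 0#) → ¬ (y ≤ 0#) → ¬ (x * y ≤ 0#)
    ≤-stable    : ∀ {x y} → ¬ ¬ (x ≤ y) → x ≤ y
    ≰⇒≥         : ∀ {x y} → ¬ (x ≤ y) → y ≤ x

module OrderedDomainProperties (K : OrderedDomain) where
  open OrderedDomain K public
  open IntegerSolver commutativeRing public
  open SemiringSum semiring public using (sum; sum-cong-≋; ∑-distrib-+; ∑-comm; sum-permute; *-distribˡ-sum; *-distribʳ-sum)
  open SemiringMult semiring public using () renaming (_×_ to _·_; ×-homo-+ to ·-homo-+; ×1-homo-* to ·1-homo-*)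

  poset : Poset 0ℓ 0ℓ 0ℓ
  poset = record
    { _≤_ = _≤_
    ; isPartialOrder = record
      { isPreorder = record { isEquivalence = isEquivalence ; reflexive = ≤-reflexive ; trans = ≤-trans }
      ; antisym = ≤-antisym
      }
    }
  open PartialOrderReasoning poset public

  Pos : Carrier → Set
  Pos x = ¬ (x ≤ 0#)

  ≤-refl : ∀ {x} → x ≤ x
  ≤-refl = ≤-reflexive refl

  ≤-resp : ∀ {x x′ y y′} → x ≈ x′ → y ≈ y′ → x ≤ y → x′ ≤ y′
  ≤-resp x≈x′ y≈y′ x≤y = ≤-trans (≤-reflexive (sym x≈x′)) (≤-trans x≤y (≤-reflexive y≈y′))

  +-mono-≤ : ∀ {x y z w} → x ≤ y → z ≤ w → x + z ≤ y + w
  +-mono-≤ {x} {y} {z} {w} x≤y z≤w =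
    ≤-trans (+-monoˡ-≤ z x≤y) (≤-resp (+-comm z y) (+-comm w y) (+-monoˡ-≤ y z≤w))

  ≤⇒0≤- : ∀ {x y} → x ≤ y → 0# ≤ y - x
  ≤⇒0≤- {x} x≤y = ≤-resp (-‿inverseʳ x) refl (+-monoˡ-≤ (- x) x≤y)

  0≤-⇒≤ : ∀ {x y} → 0# ≤ y - x → x ≤ y
  0≤-⇒≤ {x} {y} h = ≤-resp (+-identityˡ x) (solve 2 (λ x y → y :- x :+ x := y) refl x y) (+-monoˡ-≤ x h)

  -‿mono-≤ : ∀ {x y} → x ≤ y → - y ≤ - x
  -‿mono-≤ {x} {y} x≤y = 0≤-⇒≤ (≤-resp refl (solve 2 (λ x y → y :- x := :- x :- :- y) refl x y) (≤⇒0≤- x≤y))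

  +-nonneg : ∀ {x y} → 0# ≤ x → 0# ≤ y → 0# ≤ x + y
  +-nonneg 0≤x 0≤y = ≤-resp (+-identityˡ 0#) refl (+-mono-≤ 0≤x 0≤y)

  *-monoˡ-≤ : ∀ {x y z} → 0# ≤ z → x ≤ y → z * x ≤ z * y
  *-monoˡ-≤ {x} {y} {z} 0≤z x≤y = 0≤-⇒≤
    (≤-resp refl (solve 3 (λ x y z → z :* (y :- x) := z :* y :- z :* x) refl x y z) (*-nonneg 0≤z (≤⇒0≤- x≤y)))

  -- The sign of x cannot be decided. Stability of `≤` allows assuming that x² ≥ 0 fails; then x ≥ 0
  -- fails too, so -x ≥ 0, and (-x)² = x² gives the contradiction.
  square-nonneg : ∀ x → 0# ≤ x * x
  square-nonneg x = ≤-stable λ ¬0≤x² →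
    let 0≰x = λ 0≤x → ¬0≤x² (*-nonneg 0≤x 0≤x)
        0≤-x = ≤-resp refl (+-identityˡ (- x)) (≤⇒0≤- (≰⇒≥ 0≰x))
    in ¬0≤x² (≤-resp refl (solve 1 (λ x → :- x :* :- x := x :* x) refl x) (*-nonneg 0≤-x 0≤-x))

  Pos⇒0≤ : ∀ {x} → Pos x → 0# ≤ x
  Pos⇒0≤ = ≰⇒≥

  Pos-≤ : ∀ {x y} → Pos x → x ≤ y → Pos y
  Pos-≤ 0<x x≤y y≤0 = 0<x (≤-trans x≤y y≤0)

  *-cancel-≤0 : ∀ {x y} → Pos x → x * y ≤ 0# → y ≤ 0#
  *-cancel-≤0 0<x xy≤0 = ≤-stable λ 0<y → *-pos 0<x 0<y xy≤0

  ≤-diff : ∀ {x y e} → 0# ≤ e → e ≈ y - x → x ≤ y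
  ≤-diff 0≤e eq = 0≤-⇒≤ (≤-resp refl eq 0≤e)

  ≤⇒-≤0 : ∀ {x y} → x ≤ y → x - y ≤ 0#
  ≤⇒-≤0 {x} {y} x≤y = ≤-resp refl (-‿inverseʳ y) (+-monoˡ-≤ (- y) x≤y)

  -≤0⇒≤ : ∀ {x y} → x - y ≤ 0# → x ≤ y
  -≤0⇒≤ {x} {y} h = ≤-resp (solve 2 (λ x y → x :- y :+ y := x) refl x y) (+-identityˡ y) (+-monoˡ-≤ y h)

  *-cancelˡ-≤ : ∀ {x y z} → Pos x → x * y ≤ x * z → y ≤ z
  *-cancelˡ-≤ {x} {y} {z} 0<x xy≤xz = -≤0⇒≤ (*-cancel-≤0 0<x
    (≤-resp (solve 3 (λ x y z → x :* y :- x :* z := x :* (y :- z)) refl x y z) refl (≤⇒-≤0 xy≤xz)))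

  square-≤0 : ∀ {x} → x * x ≤ 0# → x ≈ 0#
  square-≤0 {x} x²≤0 = ≤-antisym (≤-stable λ 0<x → *-pos 0<x 0<x x²≤0)
    (≤-stable λ x<0 →
      let 0<-x = λ -x≤0 → x<0 (≤-diff (≤⇒0≤- -x≤0) (0-neg x))
      in *-pos 0<-x 0<-x (≤-resp (solve 1 (λ x → x :* x := :- x :* :- x) refl x) refl x²≤0))
    where
    0-neg : ∀ x → 0# - - x ≈ x - 0#
    0-neg x = trans (+-identityˡ (- - x)) (trans (solve 1 (λ x → :- :- x := x :- (x :- x)) refl x) (+-congˡ (-‿cong (-‿inverseʳ x))))

  0≤1 : 0# ≤ 1#
  0≤1 = ≤-resp refl (*-identityˡ 1#) (square-nonneg 1#)

  x≤x+y : ∀ {x y} → 0# ≤ y → x ≤ x + y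
  x≤x+y {x} 0≤y = ≤-resp (+-identityʳ x) refl (+-mono-≤ ≤-refl 0≤y)

  x≤y+x : ∀ {x y} → 0# ≤ y → x ≤ y + x
  x≤y+x {x} 0≤y = ≤-resp (+-identityˡ x) refl (+-mono-≤ 0≤y ≤-refl)

  sum-nonneg : ∀ {n} {t : Fin n → Carrier} → (∀ i → 0# ≤ t i) → 0# ≤ sum t
  sum-nonneg {zero}  h = ≤-refl
  sum-nonneg {suc n} h = +-nonneg (h zero) (sum-nonneg (h ∘ suc))

  sum-mono-≤ : ∀ {n} {s t : Fin n → Carrier} → (∀ i → s i ≤ t i) → sum s ≤ sum t
  sum-mono-≤ {zero}  h = ≤-refl
  sum-mono-≤ {suc n} h = +-mono-≤ (h zero) (sum-mono-≤ (h ∘ suc))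

  term≤sum : ∀ {n} {t : Fin n → Carrier} → (∀ i → 0# ≤ t i) → ∀ i → t i ≤ sum t
  term≤sum h zero    = x≤x+y (sum-nonneg (h ∘ suc))
  term≤sum h (suc i) = ≤-trans (term≤sum (h ∘ suc) i) (x≤y+x (h zero))

  sum-zero : ∀ {n} {t : Fin n → Carrier} → (∀ i → t i ≈ 0#) → sum t ≈ 0#
  sum-zero {zero}  h = refl
  sum-zero {suc n} h = trans (+-cong (h zero) (sum-zero (h ∘ suc))) (+-identityˡ 0#)

  sum-neg : ∀ {n} (t : Fin n → Carrier) → sum (λ i → - t i) ≈ - sum t
  sum-neg {zero}  t = trans (sym (-‿inverseʳ 0#)) (+-identityˡ (- 0#))
  sum-neg {suc n} t = trans (+-congˡ (sum-neg (t ∘ suc))) (solve 2 (λ x y → :- x :- y := :- (x :+ y)) refl _ _)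

  sum-sub : ∀ {n} (s t : Fin n → Carrier) → sum (λ i → s i - t i) ≈ sum s - sum t
  sum-sub s t = trans (∑-distrib-+ s (λ i → - t i)) (+-congˡ (sum-neg t))

  ι : ℕ → Carrier
  ι a = a · 1#

  ι-+ : ∀ a b → ι (a ℕ.+ b) ≈ ι a + ι b
  ι-+ = ·-homo-+ 1#

  ι-nonneg : ∀ a → 0# ≤ ι a
  ι-nonneg zero    = ≤-refl
  ι-nonneg (suc a) = +-nonneg 0≤1 (ι-nonneg a)

  ι-mono : ∀ {a b} → a ℕ.≤ b → ι a ≤ ι b
  ι-mono {b = b} z≤n = ι-nonneg b
  ι-mono (s≤s a≤b)   = +-mono-≤ ≤-refl (ι-mono a≤b)

  ι1* : ∀ x → ι 1 * x ≈ x
  ι1* x = trans (*-congʳ (+-identityʳ 1#)) (*-identityˡ x)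

  ι0* : ∀ x → ι 0 * x ≈ 0#
  ι0* = zeroˡ

  infixr 8 _^_
  _^_ : Carrier → ℕ → Carrier
  a ^ zero  = 1#
  a ^ suc j = a * a ^ j

  ^-nonneg : ∀ {a} → 0# ≤ a → ∀ j → 0# ≤ a ^ j
  ^-nonneg 0≤a zero    = 0≤1
  ^-nonneg 0≤a (suc j) = *-nonneg 0≤a (^-nonneg 0≤a j)

-- An indicator with values in ℕ rather than `Bool`: its sums are counts, and `ι` carries it into
-- any ordered domain. The recursion on both arguments lets sums over `Fin` compute along with it.
δ : ℕ → ℕ → ℕ
δ zero    zero    = 1
δ zero    (suc b) = 0
δ (suc a) zero    = 0
δ (suc a) (suc b) = δ a b

δ-refl : ∀ a → δ a a ≡ 1
δ-refl zero    = ≡.refl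
δ-refl (suc a) = δ-refl a

δ-≢ : ∀ {a b} → a ≢ b → δ a b ≡ 0
δ-≢ {zero}  {zero}  a≢b = contradiction ≡.refl a≢b
δ-≢ {zero}  {suc b} a≢b = ≡.refl
δ-≢ {suc a} {zero}  a≢b = ≡.refl
δ-≢ {suc a} {suc b} a≢b = δ-≢ (a≢b ∘ ≡.cong suc)

δ-sym : ∀ a b → δ a b ≡ δ b a
δ-sym zero    zero    = ≡.refl
δ-sym zero    (suc b) = ≡.refl
δ-sym (suc a) zero    = ≡.refl
δ-sym (suc a) (suc b) = δ-sym a b

δ≡1⇒≡ : ∀ a b → δ a b ≡ 1 → a ≡ b
δ≡1⇒≡ zero    zero    _ = ≡.refl
δ≡1⇒≡ (suc a) (suc b) h = ≡.cong suc (δ≡1⇒≡ a b h)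

⟦_≤_⟧ : ℕ → ℕ → ℕ
⟦ zero  ≤ b     ⟧ = 1
⟦ suc a ≤ zero  ⟧ = 0
⟦ suc a ≤ suc b ⟧ = ⟦ a ≤ b ⟧

⟦≤⟧-yes : ∀ {a b} → a ℕ.≤ b → ⟦ a ≤ b ⟧ ≡ 1
⟦≤⟧-yes z≤n     = ≡.refl
⟦≤⟧-yes (s≤s h) = ⟦≤⟧-yes h

⟦≤⟧-no : ∀ {a b} → b ℕ.< a → ⟦ a ≤ b ⟧ ≡ 0
⟦≤⟧-no (s≤s {n = a} z≤n) = ≡.refl
⟦≤⟧-no (s≤s (s≤s h))     = ⟦≤⟧-no (s≤s h)

⟦≤⟧≤1 : ∀ a b → ⟦ a ≤ b ⟧ ℕ.≤ 1
⟦≤⟧≤1 zero    b       = ℕ.≤-refl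
⟦≤⟧≤1 (suc a) zero    = z≤n
⟦≤⟧≤1 (suc a) (suc b) = ⟦≤⟧≤1 a b

module NatIndexedSums (K : OrderedDomain) where
  open OrderedDomainProperties K

  S : ℕ → (ℕ → Carrier) → Carrier
  S n g = sum {n} (λ i → g (toℕ i))

  S-cong : ∀ n {g h} → (∀ i → i ℕ.< n → g i ≈ h i) → S n g ≈ S n h
  S-cong n eq = sum-cong-≋ {n} (λ i → eq (toℕ i) (Fin.toℕ<n i))

  S-+ : ∀ n g h → S n (λ i → g i + h i) ≈ S n g + S n h
  S-+ n g h = ∑-distrib-+ {n} (g ∘ toℕ) (h ∘ toℕ)

  S-sub : ∀ n g h → S n (λ i → g i - h i) ≈ S n g - S n h
  S-sub n g h = sum-sub {n} (g ∘ toℕ) (h ∘ toℕ)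

  S-*ˡ : ∀ n c g → S n (λ i → c * g i) ≈ c * S n g
  S-*ˡ n c g = sym (*-distribˡ-sum {n} c (g ∘ toℕ))

  S-swap : ∀ m n (g : ℕ → ℕ → Carrier) → S m (λ i → S n (g i)) ≈ S n (λ j → S m (λ i → g i j))
  S-swap m n g = ∑-comm {m} {n} (λ i j → g (toℕ i) (toℕ j))

  S-nonneg : ∀ n {g} → (∀ i → i ℕ.< n → 0# ≤ g i) → 0# ≤ S n g
  S-nonneg n h = sum-nonneg {n} (λ i → h (toℕ i) (Fin.toℕ<n i))

  S-mono-≤ : ∀ n {g h} → (∀ i → i ℕ.< n → g i ≤ h i) → S n g ≤ S n h
  S-mono-≤ n h = sum-mono-≤ {n} (λ i → h (toℕ i) (Fin.toℕ<n i))

  S-zero : ∀ n {g} → (∀ i → i ℕ.< n → g i ≈ 0#) → S n g ≈ 0#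
  S-zero n h = sum-zero {n} (λ i → h (toℕ i) (Fin.toℕ<n i))

  term≤S : ∀ n {g} → (∀ i → i ℕ.< n → 0# ≤ g i) → ∀ i → i ℕ.< n → g i ≤ S n g
  term≤S n {g} h i i<n = ≤-resp (reflexive (≡.cong g (Fin.toℕ-fromℕ< i<n))) refl
    (term≤sum {n} (λ j → h (toℕ j) (Fin.toℕ<n j)) (Fin.fromℕ< i<n))

  S-δ : ∀ n a (g : ℕ → Carrier) → a ℕ.< n → S n (λ j → ι (δ a j) * g j) ≈ g a
  S-δ (suc n) zero    g a<n = trans (+-cong (ι1* (g 0)) (S-zero n (λ j _ → ι0* (g (suc j))))) (+-identityʳ (g 0))
  S-δ (suc n) (suc a) g (s≤s a<n) = trans (+-cong (ι0* (g 0)) (S-δ n a (g ∘ suc) a<n)) (+-identityˡ _)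

  -- The indicator starts the telescoping sum at a, so ψ a - ψ n depends on a only through the
  -- numbers `⟦ a ≤ t ⟧`. This is the discrete layer-cake representation.
  S-telescope : ∀ n a (ψ : ℕ → Carrier) → a ℕ.≤ n → S n (λ t → ι ⟦ a ≤ t ⟧ * (ψ t - ψ (suc t))) ≈ ψ a - ψ n
  S-telescope zero    zero    ψ z≤n = sym (-‿inverseʳ (ψ 0))
  S-telescope (suc n) zero    ψ z≤n = trans (+-cong (ι1* _) (S-telescope n 0 (ψ ∘ suc) z≤n))
    (solve 3 (λ x y z → (x :- y) :+ (y :- z) := x :- z) refl (ψ 0) (ψ 1) (ψ (suc n)))
  S-telescope (suc n) (suc a) ψ (s≤s a≤n) = trans (+-cong (ι0* _) (S-telescope n a (ψ ∘ suc) a≤n)) (+-identityˡ _)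

-- Dirichlet energy and the ground-state representation.

-- Vertices are 0, …, N with root 0; p x is the parent of the vertex suc x.
ch : (ℕ → ℕ) → ℕ → ℕ → ℕ
ch p zero    j = 0
ch p (suc x) j = δ (p x) j

edges : (ℕ → ℕ) → ℕ → ℕ → ℕ
edges p i j = ch p i j ℕ.+ ch p j i

module Energy (K : OrderedDomain) (N : ℕ) where
  open OrderedDomainProperties K
  open NatIndexedSums K

  L : (ℕ → ℕ) → (ℕ → Carrier) → ℕ → Carrier
  L p F i = S (suc N) (λ j → ι (edges p i j) * (F i - F j))

  E : (ℕ → ℕ) → (ℕ → Carrier) → Carrier
  E p F = S N (λ x → (F (suc x) - F (p x)) * (F (suc x) - F (p x)))

  ‖_‖² : (ℕ → Carrier) → Carrier
  ‖ F ‖² = S (suc N) (λ i → F i * F i)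

  module _ (p : ℕ → ℕ) (p≤N : ∀ x → x ℕ.< N → p x ℕ.≤ N) where

    child-sum : (φ : ℕ → ℕ → Carrier) →
      S (suc N) (λ i → S (suc N) (λ j → ι (ch p i j) * φ i j)) ≈ S N (λ x → φ (suc x) (p x))
    child-sum φ = trans (+-cong (S-zero (suc N) (λ j _ → ι0* (φ 0 j))) (S-cong N (λ x x<N → S-δ (suc N) (p x) (φ (suc x)) (s≤s (p≤N x x<N)))))
      (+-identityˡ _)

    -- `ch p i j` selects the one parent of i and its transpose shows the same edge from the parent,
    -- so each edge appears once in either orientation.
    edge-sum : (φ : ℕ → ℕ → Carrier) →
      S (suc N) (λ i → S (suc N) (λ j → ι (edges p i j) * φ i j)) ≈ S N (λ x → φ (suc x) (p x) + φ (p x) (suc x))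
    edge-sum φ = begin-equality
      S n (λ i → S n (λ j → ι (edges p i j) * φ i j))
        ≈⟨ S-cong n (λ i _ → S-cong n (λ j _ → trans (*-congʳ (ι-+ (ch p i j) (ch p j i))) (distribʳ (φ i j) _ _))) ⟩
      S n (λ i → S n (λ j → ι (ch p i j) * φ i j + ι (ch p j i) * φ i j))
        ≈⟨ S-cong n (λ i _ → S-+ n (λ j → ι (ch p i j) * φ i j) (λ j → ι (ch p j i) * φ i j)) ⟩
      S n (λ i → S n (λ j → ι (ch p i j) * φ i j) + S n (λ j → ι (ch p j i) * φ i j))
        ≈⟨ S-+ n (λ i → S n (λ j → ι (ch p i j) * φ i j)) (λ i → S n (λ j → ι (ch p j i) * φ i j)) ⟩
      S n (λ i → S n (λ j → ι (ch p i j) * φ i j)) + S n (λ i → S n (λ j → ι (ch p j i) * φ i j))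
        ≈⟨ +-congˡ (S-swap n n (λ i j → ι (ch p j i) * φ i j)) ⟩
      S n (λ i → S n (λ j → ι (ch p i j) * φ i j)) + S n (λ j → S n (λ i → ι (ch p j i) * φ i j))
        ≈⟨ +-cong (child-sum φ) (child-sum (λ j i → φ i j)) ⟩
      S N (λ x → φ (suc x) (p x)) + S N (λ x → φ (p x) (suc x))
        ≈⟨ S-+ N (λ x → φ (suc x) (p x)) (λ x → φ (p x) (suc x)) ⟨
      S N (λ x → φ (suc x) (p x) + φ (p x) (suc x)) ∎
      where n = suc N

    S-L : ∀ F i c → c * L p F i ≈ S (suc N) (λ j → ι (edges p i j) * (c * (F i - F j)))
    S-L F i c = trans (sym (S-*ˡ (suc N) c (λ j → ι (edges p i j) * (F i - F j))))
      (S-cong (suc N) (λ j _ → solve 3 (λ c e y → c :* (e :* y) := e :* (c :* y)) refl c (ι (edges p i j)) (F i - F j)))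

    -- Summation by parts: the two orientations of an edge contribute a (a - b) + b (b - a) = (a -
    -- b)².
    green : ∀ F → S (suc N) (λ i → F i * L p F i) ≈ E p F
    green F = trans (S-cong (suc N) (λ i _ → S-L F i (F i)))
      (trans (edge-sum (λ i j → F i * (F i - F j)))
        (S-cong N (λ x _ → solve 2 (λ a b → a :* (a :- b) :+ b :* (b :- a) := (a :- b) :* (a :- b)) refl (F (suc x)) (F (p x)))))

  -- The reciprocals `f⁻` are data: an ordered domain need not have division, and over the
  -- constructive reals the negative statement `Pos` yields no reciprocal. `vanish` is the Dirichlet
  -- condition.
  record GroundState (p : ℕ → ℕ) (I : ℕ → Set) (μ : Carrier) (f f⁻ : ℕ → Carrier) : Set where
    field
      I?       : ∀ i → Dec (I i)
      vanish   : ∀ i → ¬ I i → f i ≈ 0#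
      positive : ∀ i → I i → Pos (f i)
      inverse  : ∀ i → I i → f i * f⁻ i ≈ 1#
      eigen    : ∀ i → i ℕ.≤ N → I i → L p f i ≈ μ * f i

  -- Substituting g = f h turns E p g - μ ‖ g ‖² into a sum of squares.
  module Jacobi (p : ℕ → ℕ) (p≤N : ∀ x → x ℕ.< N → p x ℕ.≤ N) {I μ f f⁻} (gs : GroundState p I μ f f⁻) where
    open GroundState gs

    f-nonneg : ∀ i → 0# ≤ f i
    f-nonneg i with I? i
    ... | yes Ii = Pos⇒0≤ (positive i Ii)
    ... | no ¬Ii = ≤-reflexive (sym (vanish i ¬Ii))

    module _ (g : ℕ → Carrier) (g-vanish : ∀ i → ¬ I i → g i ≈ 0#) where

      h : ℕ → Carrier
      h i = f⁻ i * g i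

      g≈fh : ∀ i → g i ≈ f i * h i
      g≈fh i with I? i
      ... | yes Ii = sym (trans (sym (*-assoc (f i) (f⁻ i) (g i))) (trans (*-congʳ (inverse i Ii)) (*-identityˡ (g i))))
      ... | no ¬Ii = trans (g-vanish i ¬Ii) (sym (trans (*-congʳ (vanish i ¬Ii)) (zeroˡ (h i))))

      W : ℕ → ℕ → Carrier
      W i j = f i * f j * ((h i - h j) * (h i - h j))

      W-nonneg : ∀ i j → 0# ≤ W i j
      W-nonneg i j = *-nonneg (*-nonneg (f-nonneg i) (f-nonneg j)) (square-nonneg (h i - h j))

      eigen-f : ∀ i → i ℕ.≤ N → f i * L p f i ≈ f i * (μ * f i)
      eigen-f i i≤N with I? i
      ... | yes Ii = *-congˡ (eigen i i≤N Ii)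
      ... | no ¬Ii = trans (trans (*-congʳ (vanish i ¬Ii)) (zeroˡ _)) (sym (trans (*-congʳ (vanish i ¬Ii)) (zeroˡ _)))

      -- In row i the eigenvalue equation times f i (h i)² is subtracted. This removes μ and leaves
      -- f i f j ((h i)² - h i h j) for each neighbour j; the two orientations of an edge then add
      -- up to `W`.
      jacobi : E p g - μ * ‖ g ‖² ≈ S N (λ x → W (suc x) (p x))
      jacobi = begin-equality
        E p g - μ * ‖ g ‖²
          ≈⟨ +-cong (sym (green p p≤N g)) (-‿cong (sym (S-*ˡ n μ (λ i → g i * g i)))) ⟩
        S n (λ i → g i * L p g i) - S n (λ i → μ * (g i * g i))
          ≈⟨ S-sub n (λ i → g i * L p g i) (λ i → μ * (g i * g i)) ⟨
        S n (λ i → g i * L p g i - μ * (g i * g i))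
          ≈⟨ S-cong n (λ i i<n → row i (ℕ.≤-pred i<n)) ⟩
        S n (λ i → S n (λ j → ι (edges p i j) * (f i * f j * (h i * h i - h i * h j))))
          ≈⟨ edge-sum p p≤N (λ i j → f i * f j * (h i * h i - h i * h j)) ⟩
        S N (λ x → f (suc x) * f (p x) * (h (suc x) * h (suc x) - h (suc x) * h (p x)) + f (p x) * f (suc x) * (h (p x) * h (p x) - h (p x) * h (suc x)))
          ≈⟨ S-cong N (λ x _ → solve 4 (λ a b u v → a :* b :* (u :* u :- u :* v) :+ b :* a :* (v :* v :- v :* u) := a :* b :* ((u :- v) :* (u :- v))) refl (f (suc x)) (f (p x)) (h (suc x)) (h (p x))) ⟩
        S N (λ x → W (suc x) (p x)) ∎
        where
        n = suc N
        row : ∀ i → i ℕ.≤ N → g i * L p g i - μ * (g i * g i) ≈ S n (λ j → ι (edges p i j) * (f i * f j * (h i * h i - h i * h j)))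
        row i i≤N = begin-equality
          g i * L p g i - μ * (g i * g i)
            ≈⟨ +-congˡ (-‿cong (trans (*-congˡ (*-cong (g≈fh i) (g≈fh i))) (solve 3 (λ m a u → m :* ((a :* u) :* (a :* u)) := (u :* u) :* (a :* (m :* a))) refl μ (f i) (h i)))) ⟩
          g i * L p g i - (h i * h i) * (f i * (μ * f i))
            ≈⟨ +-congˡ (-‿cong (trans (*-congˡ (sym (eigen-f i i≤N))) (sym (*-assoc _ _ _)))) ⟩
          g i * L p g i - (h i * h i * f i) * L p f i
            ≈⟨ +-cong (S-L p p≤N g i (g i)) (-‿cong (S-L p p≤N f i (h i * h i * f i))) ⟩
          S n (λ j → ι (edges p i j) * (g i * (g i - g j))) - S n (λ j → ι (edges p i j) * (h i * h i * f i * (f i - f j)))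
            ≈⟨ S-sub n (λ j → ι (edges p i j) * (g i * (g i - g j))) (λ j → ι (edges p i j) * (h i * h i * f i * (f i - f j))) ⟨
          S n (λ j → ι (edges p i j) * (g i * (g i - g j)) - ι (edges p i j) * (h i * h i * f i * (f i - f j)))
            ≈⟨ S-cong n (λ j _ → trans (+-congʳ (*-congˡ (*-cong (g≈fh i) (+-cong (g≈fh i) (-‿cong (g≈fh j))))))
                 (solve 5 (λ e a b u v → e :* ((a :* u) :* (a :* u :- b :* v)) :- e :* (u :* u :* a :* (a :- b)) := e :* (a :* b :* (u :* u :- u :* v))) refl (ι (edges p i j)) (f i) (f j) (h i) (h j))) ⟩
          S n (λ j → ι (edges p i j) * (f i * f j * (h i * h i - h i * h j))) ∎

      rayleigh : μ * ‖ g ‖² ≤ E p g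
      rayleigh = 0≤-⇒≤ (≤-resp refl (sym jacobi) (S-nonneg N (λ x _ → W-nonneg (suc x) (p x))))

      module _ (tight : E p g ≤ μ * ‖ g ‖²) where

        W-zero : ∀ x → x ℕ.< N → W (suc x) (p x) ≈ 0#
        W-zero x x<N = ≤-antisym
          (≤-trans (term≤S N (λ y _ → W-nonneg (suc y) (p y)) x x<N) (≤-resp jacobi refl (≤⇒-≤0 tight)))
          (W-nonneg (suc x) (p x))

        W-child : ∀ i j → i ℕ.≤ N → ι (ch p i j) * W i j ≈ 0#
        W-child zero    j _ = ι0* (W 0 j)
        W-child (suc x) j x<N with p x ℕ.≟ j
        ... | yes ≡.refl = trans (*-congˡ (W-zero x x<N)) (zeroʳ _)
        ... | no px≢j    = trans (*-congʳ (reflexive (≡.cong ι (δ-≢ px≢j)))) (ι0* (W (suc x) j))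

        W-edge : ∀ i j → i ℕ.≤ N → j ℕ.≤ N → ι (edges p i j) * W i j ≈ 0#
        W-edge i j i≤N j≤N = begin-equality
          ι (edges p i j) * W i j                       ≈⟨ trans (*-congʳ (ι-+ (ch p i j) (ch p j i))) (distribʳ (W i j) _ _) ⟩
          ι (ch p i j) * W i j + ι (ch p j i) * W i j   ≈⟨ +-congˡ (*-congˡ (solve 4 (λ a b u v → a :* b :* ((u :- v) :* (u :- v)) := b :* a :* ((v :- u) :* (v :- u))) refl (f i) (f j) (h i) (h j))) ⟩
          ι (ch p i j) * W i j + ι (ch p j i) * W j i   ≈⟨ +-cong (W-child i j i≤N) (W-child j i j≤N) ⟩
          0# + 0#                                       ≈⟨ +-identityˡ 0# ⟩
          0#                                            ∎

        -- Equality makes every edge term `W` vanish, so f j (h i - h j) = 0 for each neighbour j of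
        -- an interior i. In the row of i, g is then h i times f, and the eigenvalue equation of f
        -- carries over.
        tight⇒eigen : ∀ i → i ℕ.≤ N → I i → L p g i ≈ μ * g i
        tight⇒eigen i i≤N Ii = begin-equality
          L p g i
            ≈⟨ S-cong n (λ j j<n → trans (*-congˡ (+-cong (g≈fh i) (-‿cong (g≈fh j))))
                 (trans (solve 5 (λ e a b u v → e :* (a :* u :- b :* v) := e :* (b :* (u :- v)) :+ e :* (u :* (a :- b))) refl (ι (edges p i j)) (f i) (f j) (h i) (h j))
                   (trans (+-congʳ (zero-edge j (ℕ.≤-pred j<n))) (+-identityˡ _)))) ⟩
          S n (λ j → ι (edges p i j) * (h i * (f i - f j)))
            ≈⟨ S-L p p≤N f i (h i) ⟨
          h i * L p f i
            ≈⟨ *-congˡ (eigen i i≤N Ii) ⟩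
          h i * (μ * f i)
            ≈⟨ trans (solve 3 (λ u m a → u :* (m :* a) := m :* (a :* u)) refl (h i) μ (f i)) (*-congˡ (sym (g≈fh i))) ⟩
          μ * g i ∎
          where
          n = suc N
          zero-edge : ∀ j → j ℕ.≤ N → ι (edges p i j) * (f j * (h i - h j)) ≈ 0#
          -- Multiplying the square by f i · f⁻ i = 1 exhibits the factor `ι (edges p i j) * W i j`,
          -- which is 0.
          zero-edge j j≤N = square-≤0 (≤-reflexive (begin-equality
            ι (edges p i j) * (f j * (h i - h j)) * (ι (edges p i j) * (f j * (h i - h j)))
              ≈⟨ trans (sym (*-identityˡ _)) (*-congʳ (sym (inverse i Ii))) ⟩
            f i * f⁻ i * (ι (edges p i j) * (f j * (h i - h j)) * (ι (edges p i j) * (f j * (h i - h j))))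
              ≈⟨ solve 5 (λ a a′ e b u → a :* a′ :* (e :* (b :* u) :* (e :* (b :* u))) := (a′ :* e :* b) :* (e :* (a :* b :* (u :* u)))) refl (f i) (f⁻ i) (ι (edges p i j)) (f j) (h i - h j) ⟩
            (f⁻ i * ι (edges p i j) * f j) * (ι (edges p i j) * W i j)
              ≈⟨ *-congˡ (W-edge i j i≤N j≤N) ⟩
            (f⁻ i * ι (edges p i j) * f j) * 0#
              ≈⟨ zeroʳ _ ⟩
            0# ∎))

module NatSums where
  open SemiringSum ℕ.+-*-semiring public using (sum; sum-cong-≗; ∑-distrib-+; ∑-comm; sum-permute)

  C : ℕ → (ℕ → ℕ) → ℕ
  C n g = sum {n} (λ i → g (toℕ i))

  C-cong : ∀ n {g h} → (∀ i → i ℕ.< n → g i ≡ h i) → C n g ≡ C n h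
  C-cong n eq = sum-cong-≗ {n} (λ i → eq (toℕ i) (Fin.toℕ<n i))

  C-initial : ∀ {n m} → m ℕ.≤ n → C n (λ x → ⟦ suc x ≤ m ⟧) ≡ m
  C-initial {zero}  z≤n = ≡.refl
  C-initial {suc n} {zero} z≤n = C-initial {n} z≤n
  C-initial {suc n} {suc m} (s≤s m≤n) = ≡.cong suc (C-initial m≤n)

open NatSums using (C; C-cong; C-initial)

-- Since p x is the parent of `suc x`, this is the number of children that the vertices 0, ..., t
-- have together.
count≤ : ℕ → (ℕ → ℕ) → ℕ → ℕ
count≤ N p t = C N (λ x → ⟦ p x ≤ t ⟧)

-- The spiral tree.

-- The breadth-first tree with interior vertices 0, …, κ: the root has q + 1
-- children, the vertices 1, …, κ - 1 have q each and κ has the remaining ones.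
module Spiral (κ e D : ℕ) where

  q : ℕ
  q = suc e

  m : ℕ → ℕ
  m t = suc (suc t ℕ.* q)

  -- `suc N` is the number of vertices. With d = e + 2 and all interior degrees equal to d there
  -- would be m κ vertices besides the root; D is the total excess of the interior degrees over d.
  N : ℕ
  N = m κ ℕ.+ D

  -- The truncated `x ∸ 1` puts x = 0 and x = 1 into the same block, which gives the root its
  -- additional child; the minimum with κ sends the whole surplus to κ.
  p* : ℕ → ℕ
  p* x = κ ℕ.⊓ ((x ℕ.∸ 1) ℕ./ q)

  p*≤κ : ∀ x → p* x ℕ.≤ κ
  p*≤κ x = ℕ.m⊓n≤m κ _

  p*-monotone : ∀ {x y} → x ℕ.≤ y → p* x ℕ.≤ p* y
  p*-monotone x≤y = ℕ.⊓-monoʳ-≤ κ (ℕ./-monoˡ-≤ q (ℕ.∸-monoˡ-≤ 1 x≤y))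

  t<m : ∀ t → t ℕ.< m t
  t<m t = s≤s (ℕ.≤-trans (ℕ.n≤1+n t) (ℕ.m≤m*n (suc t) q))

  κ≤N : κ ℕ.≤ N
  κ≤N = ℕ.≤-trans (ℕ.<⇒≤ (t<m κ)) (ℕ.m≤m+n (m κ) D)

  m-mono : ∀ {s t} → s ℕ.≤ t → m s ℕ.≤ m t
  m-mono s≤t = s≤s (ℕ.*-monoˡ-≤ q (s≤s s≤t))

  m≤N : ∀ {t} → t ℕ.≤ κ → m t ℕ.≤ N
  m≤N t≤κ = ℕ.≤-trans (m-mono t≤κ) (ℕ.m≤m+n (m κ) D)

  m-suc : ∀ t → m (suc t) ≡ m t ℕ.+ q
  m-suc t = ≡.cong suc (ℕ.+-comm q (suc t ℕ.* q))

  <m⇒p*≤ : ∀ {x t} → x ℕ.< m t → p* x ℕ.≤ t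
  <m⇒p*≤ {x} {t} (s≤s x≤) = ℕ.≤-trans (ℕ.m⊓n≤n κ _) (ℕ.≤-pred (ℕ.m<n*o⇒m/o<n (lemma x x≤)))
    where
    lemma : ∀ x → x ℕ.≤ suc t ℕ.* q → x ℕ.∸ 1 ℕ.< suc t ℕ.* q
    lemma zero    _   = s≤s z≤n
    lemma (suc x) x<  = x<

  m≤⇒<p* : ∀ {x t} → t ℕ.< κ → m t ℕ.≤ x → t ℕ.< p* x
  m≤⇒<p* {suc x} {t} t<κ (s≤s tq≤x) = ℕ.⊓-glb t<κ
    (≡.subst (ℕ._≤ x ℕ./ q) (ℕ.m*n/n≡m (suc t) q) (ℕ./-monoˡ-≤ q tq≤x))

  p*≤⇒<m : ∀ {x t} → t ℕ.< κ → p* x ℕ.≤ t → x ℕ.< m t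
  p*≤⇒<m t<κ p*≤t = ℕ.≰⇒> (λ m≤x → ℕ.<⇒≱ (m≤⇒<p* t<κ m≤x) p*≤t)

  ⟦p*≤⟧ : ∀ x {t} → t ℕ.< κ → ⟦ p* x ≤ t ⟧ ≡ ⟦ suc x ≤ m t ⟧
  ⟦p*≤⟧ x {t} t<κ with x ℕ.<? m t
  ... | yes x<m = ≡.trans (⟦≤⟧-yes (<m⇒p*≤ x<m)) (≡.sym (⟦≤⟧-yes x<m))
  ... | no x≮m  = ≡.trans (⟦≤⟧-no (m≤⇒<p* t<κ (ℕ.≮⇒≥ x≮m))) (≡.sym (⟦≤⟧-no (s≤s (ℕ.≮⇒≥ x≮m))))

  count-p* : ∀ {t} → t ℕ.< κ → count≤ N p* t ≡ m t
  count-p* t<κ = ≡.trans (C-cong N (λ x _ → ⟦p*≤⟧ x t<κ)) (C-initial (m≤N (ℕ.<⇒≤ t<κ)))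

  -- Every tree in the class, labelled with its interior vertices first, has
  -- this shape: the first t + 1 vertices have at least m t children in total.
  record Dominating (p : ℕ → ℕ) : Set where
    field
      p≤κ       : ∀ x → x ℕ.< N → p x ℕ.≤ κ
      m₀≤count  : m 0 ℕ.≤ count≤ N p 0
      count-suc : ∀ t → t ℕ.< κ → count≤ N p t ℕ.+ q ℕ.≤ count≤ N p (suc t)

    m≤count : ∀ t → t ℕ.≤ κ → m t ℕ.≤ count≤ N p t
    m≤count zero    _   = m₀≤count
    m≤count (suc t) t<κ = ℕ.≤-trans (ℕ.≤-reflexive (m-suc t))
      (ℕ.≤-trans (ℕ.+-monoˡ-≤ q (m≤count t (ℕ.<⇒≤ t<κ))) (count-suc t t<κ))

-- The rearrangement inequality and its equality case.

module Rearrangement (K : OrderedDomain) (κ e D : ℕ) where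
  open OrderedDomainProperties K
  open NatIndexedSums K
  open Spiral κ e D
  open Energy K N

  ι-C : ∀ n g → ι (C n g) ≈ S n (ι ∘ g)
  ι-C zero    g = refl
  ι-C (suc n) g = trans (ι-+ (g 0) (C n (g ∘ suc))) (+-congˡ (ι-C n (g ∘ suc)))

  Descending : (ℕ → Carrier) → Set
  Descending F = ∀ t → F (suc t) ≤ F t

  descending : ∀ {F} → Descending F → ∀ {s t} → s ℕ.≤ t → F t ≤ F s
  descending {F} desc {s} {t} s≤t = ≡.subst (λ u → F u ≤ F s) (ℕ.m+[n∸m]≡n s≤t) (go (t ℕ.∸ s))
    where
    go : ∀ r → F (s ℕ.+ r) ≤ F s
    go zero    = ≡.subst (λ u → F u ≤ F s) (≡.sym (ℕ.+-identityʳ s)) ≤-refl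
    go (suc r) = ≡.subst (λ u → F u ≤ F s) (≡.sym (ℕ.+-suc s r)) (≤-trans (desc (s ℕ.+ r)) (go r))

  module _ (F : ℕ → Carrier) (desc : Descending F) (p : ℕ → ℕ) (dom : Dominating p) where
    open Dominating dom

    private
      ψ : ℕ → ℕ → Carrier
      ψ x t = (F (suc x) - F t) * (F (suc x) - F t)

    drop : ℕ → Carrier
    drop t = F t - F (suc t)

    private
      ε : ℕ → ℕ → Carrier
      ε t x = ι ⟦ p x ≤ t ⟧ - ι ⟦ p* x ≤ t ⟧

      -- From (s - f)² - (s - g)² = (f - g)(f + g - 2s), where s is the value of x and f, g are the
      -- parent values F t and F (t + 1): the second factor.
      a : ℕ → ℕ → Carrier
      a t x = F t + F (suc t) - (F x + F x)

      Y : ℕ → Carrier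
      Y t = S N (λ x → ε t x * a t (suc x))

      V : ℕ → ℕ → ℕ → Carrier
      V t z x = ε t x * (F z - F (suc x))

    drop-nonneg : ∀ t → 0# ≤ drop t
    drop-nonneg t = ≤⇒0≤- (desc t)

    -- Each vertex x contributes a telescoping sum over the values it is
    -- attached above; interchanging the sums leaves one term per threshold t.
    layer-cake : E p F - E p* F ≈ S κ (λ t → drop t * Y t)
    layer-cake = begin-equality
      E p F - E p* F
        ≈⟨ S-sub N (λ x → ψ x (p x)) (λ x → ψ x (p* x)) ⟨
      S N (λ x → ψ x (p x) - ψ x (p* x))
        ≈⟨ S-cong N per-vertex ⟩
      S N (λ x → S κ (λ t → drop t * (ε t x * a t (suc x))))
        ≈⟨ S-swap N κ (λ x t → drop t * (ε t x * a t (suc x))) ⟩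
      S κ (λ t → S N (λ x → drop t * (ε t x * a t (suc x))))
        ≈⟨ S-cong κ (λ t _ → S-*ˡ N (drop t) (λ x → ε t x * a t (suc x))) ⟩
      S κ (λ t → drop t * Y t) ∎
      where
      per-vertex : ∀ x → x ℕ.< N → ψ x (p x) - ψ x (p* x) ≈ S κ (λ t → drop t * (ε t x * a t (suc x)))
      per-vertex x x<N = begin-equality
        ψ x (p x) - ψ x (p* x)
          -- The value at κ is the common end of both telescoping sums.
          ≈⟨ solve 3 (λ u v w → u :- v := (u :- w) :- (v :- w)) refl _ _ (ψ x κ) ⟩
        (ψ x (p x) - ψ x κ) - (ψ x (p* x) - ψ x κ)
          ≈⟨ +-cong (S-telescope κ (p x) (ψ x) (p≤κ x x<N)) (-‿cong (S-telescope κ (p* x) (ψ x) (p*≤κ x))) ⟨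
        S κ (λ t → ι ⟦ p x ≤ t ⟧ * (ψ x t - ψ x (suc t))) - S κ (λ t → ι ⟦ p* x ≤ t ⟧ * (ψ x t - ψ x (suc t)))
          ≈⟨ S-sub κ (λ t → ι ⟦ p x ≤ t ⟧ * (ψ x t - ψ x (suc t))) (λ t → ι ⟦ p* x ≤ t ⟧ * (ψ x t - ψ x (suc t))) ⟨
        S κ (λ t → ι ⟦ p x ≤ t ⟧ * (ψ x t - ψ x (suc t)) - ι ⟦ p* x ≤ t ⟧ * (ψ x t - ψ x (suc t)))
          ≈⟨ S-cong κ (λ t _ → solve 5 (λ u v s f g →
               u :* ((s :- f) :* (s :- f) :- (s :- g) :* (s :- g)) :- v :* ((s :- f) :* (s :- f) :- (s :- g) :* (s :- g))
               := (f :- g) :* ((u :- v) :* (f :+ g :- (s :+ s)))) refl (ι ⟦ p x ≤ t ⟧) (ι ⟦ p* x ≤ t ⟧) (F (suc x)) (F t) (F (suc t))) ⟩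
        S κ (λ t → drop t * (ε t x * a t (suc x))) ∎

    private
      module _ (t : ℕ) (t<κ : t ℕ.< κ) where

        excess : S N (ε t) ≈ ι (count≤ N p t) - ι (m t)
        excess = trans (S-sub N (λ x → ι ⟦ p x ≤ t ⟧) (λ x → ι ⟦ p* x ≤ t ⟧))
          (+-cong (sym (ι-C N (λ x → ⟦ p x ≤ t ⟧)))
            (-‿cong (trans (sym (ι-C N (λ x → ⟦ p* x ≤ t ⟧))) (reflexive (≡.cong ι (count-p* t<κ))))))

        excess-nonneg : 0# ≤ S N (ε t)
        excess-nonneg = ≤-resp refl (sym excess) (≤⇒0≤- (ι-mono (m≤count t (ℕ.<⇒≤ t<κ))))

        -- The sign of either factor is decided by whether x < m t.
        V-nonneg : ∀ z → m t ℕ.≤ z → z ℕ.≤ suc (m t) → ∀ x → 0# ≤ V t z x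
        V-nonneg z m≤z z≤m x with x ℕ.<? m t
        ... | yes x<m = ≤-resp refl
          (solve 4 (λ u v w s → (v :- u) :* (s :- w) := (u :- v) :* (w :- s)) refl (ι ⟦ p x ≤ t ⟧) (ι ⟦ p* x ≤ t ⟧) (F z) (F (suc x)))
          (*-nonneg
            (≤⇒0≤- (ι-mono (≡.subst (⟦ p x ≤ t ⟧ ℕ.≤_) (≡.sym (⟦≤⟧-yes (<m⇒p*≤ x<m))) (⟦≤⟧≤1 (p x) t))))
            (≤⇒0≤- (descending desc (ℕ.≤-trans x<m m≤z))))
        ... | no x≮m = *-nonneg
          (≤⇒0≤- (ι-mono (≡.subst (ℕ._≤ ⟦ p x ≤ t ⟧) (≡.sym (⟦≤⟧-no (m≤⇒<p* t<κ (ℕ.≮⇒≥ x≮m)))) z≤n)))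
          (≤⇒0≤- (descending desc (ℕ.≤-trans z≤m (s≤s (ℕ.≮⇒≥ x≮m)))))

        -- Replacing each F (suc x) by a pivot F z separates twice a sum of terms of constant sign
        -- from the pivot's own coefficient times the excess of the child count over m t.
        Y-split : ∀ z → Y t ≈ (S N (V t z) + S N (V t z)) + a t z * S N (ε t)
        Y-split z = begin-equality
          Y t
            ≈⟨ S-cong N (λ x _ → solve 5 (λ u f g w s → u :* (f :+ g :- (s :+ s)) := (u :* (w :- s) :+ u :* (w :- s)) :+ (f :+ g :- (w :+ w)) :* u) refl (ε t x) (F t) (F (suc t)) (F z) (F (suc x))) ⟩
          S N (λ x → (V t z x + V t z x) + a t z * ε t x)
            ≈⟨ S-+ N (λ x → V t z x + V t z x) (λ x → a t z * ε t x) ⟩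
          S N (λ x → V t z x + V t z x) + S N (λ x → a t z * ε t x)
            ≈⟨ +-cong (S-+ N (V t z) (V t z)) (S-*ˡ N (a t z) (ε t)) ⟩
          (S N (V t z) + S N (V t z)) + a t z * S N (ε t) ∎

        -- In the spiral tree the vertices 1, ..., m t are the children of 0, ..., t. Both sides of
        -- this cut, m t and m t + 1, serve as pivots, and the equality case uses both.
        z₁ : ℕ
        z₁ = suc (m t)

        ΣV-nonneg : ∀ z → m t ℕ.≤ z → z ℕ.≤ z₁ → 0# ≤ S N (V t z)
        ΣV-nonneg z m≤z z≤m = S-nonneg N (λ x _ → V-nonneg z m≤z z≤m x)

        -- The difference of the two sides is 2 (F (t + 1) - F z₁). At a strict drop the coefficient
        -- of the excess count in `Y-split` is therefore strictly positive, so the excess must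
        -- vanish there.
        drop≤a : drop t ≤ a t z₁
        drop≤a = ≤-diff (+-nonneg Ft≥ Ft≥)
          (solve 3 (λ f g w → (g :- w) :+ (g :- w) := (f :+ g :- (w :+ w)) :- (f :- g)) refl (F t) (F (suc t)) (F z₁))
          where Ft≥ = ≤⇒0≤- (descending desc (s≤s (ℕ.<⇒≤ (t<m t))))

        Y-nonneg : 0# ≤ Y t
        Y-nonneg = ≤-resp refl (sym (Y-split z₁)) (+-nonneg (+-nonneg ΣV ΣV) (*-nonneg (≤-trans (drop-nonneg t) drop≤a) excess-nonneg))
          where ΣV = ΣV-nonneg z₁ (ℕ.n≤1+n (m t)) ℕ.≤-refl

        module _ (0<drop : Pos (drop t)) (Y≤0 : Y t ≤ 0#) where

          excess≤0 : S N (ε t) ≤ 0#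
          excess≤0 = *-cancel-≤0 (Pos-≤ 0<drop drop≤a)
            (≤-trans (x≤y+x (+-nonneg ΣV ΣV)) (≤-resp (Y-split z₁) refl Y≤0))
            where ΣV = ΣV-nonneg z₁ (ℕ.n≤1+n (m t)) ℕ.≤-refl

          count≡m : count≤ N p t ≡ m t
          count≡m = ℕ.≤-antisym (ℕ.≮⇒≥ λ m<count → 0<drop (x≤0 m<count)) (m≤count t (ℕ.<⇒≤ t<κ))
            where
            x≤0 : m t ℕ.< count≤ N p t → drop t ≤ 0#
            -- Nothing says that 1 is positive in the domain, so 1 ≤ 0 is no contradiction by
            -- itself; multiplied by `drop t` it becomes one.
            x≤0 m<count = ≤-resp (trans (*-comm _ _) (*-identityˡ (drop t))) (zeroʳ (drop t)) (*-monoˡ-≤ (drop-nonneg t)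
              (≤-trans (≤-diff (≤⇒0≤- (ι-mono m<count)) (solve 3 (λ c o w → c :- (o :+ w) := (c :- w) :- o) refl (ι (count≤ N p t)) 1# (ι (m t))))
                (≤-resp excess refl excess≤0)))

          V≈0 : ∀ z → m t ℕ.≤ z → z ℕ.≤ z₁ → ∀ x → x ℕ.< N → V t z x ≈ 0#
          V≈0 z m≤z z≤m x x<N = ≤-antisym
            (≤-trans (term≤S N (λ y _ → V-nonneg z m≤z z≤m y) x x<N)
              (≤-trans (x≤x+y ΣV) (≤-resp (trans (Y-split z) (trans (+-congˡ (trans (*-congˡ excess≈0) (zeroʳ _))) (+-identityʳ _))) refl Y≤0)))
            (V-nonneg z m≤z z≤m x)
            where
            ΣV = ΣV-nonneg z m≤z z≤m
            excess≈0 = ≤-antisym excess≤0 excess-nonneg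

          -- `V` vanishes at both pivots. If p x ≤ t although the spiral tree puts x beyond the cut,
          -- the coefficient at the pivot m t is 1, so F (suc x) = F (m t); `high` treats the
          -- converse with coefficient -1 and the pivot m t + 1. Only vertices tied with the value
          -- at the cut can cross it.
          low : ∀ x → x ℕ.< N → p x ℕ.≤ t → F (m t) ≤ F (suc x)
          low x x<N px≤t with x ℕ.<? m t
          ... | yes x<m = descending desc x<m
          ... | no x≮m = -≤0⇒≤ (≤-reflexive (begin-equality
            F (m t) - F (suc x)                          ≈⟨ ι1* _ ⟨
            ι 1 * (F (m t) - F (suc x))                  ≈⟨ *-congʳ (ε≈ (⟦≤⟧-yes px≤t) (⟦≤⟧-no (m≤⇒<p* t<κ (ℕ.≮⇒≥ x≮m)))) ⟨
            V t (m t) x                                  ≈⟨ V≈0 (m t) ℕ.≤-refl (ℕ.n≤1+n _) x x<N ⟩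
            0#                                           ∎))
            where
            ε≈ : ⟦ p x ≤ t ⟧ ≡ 1 → ⟦ p* x ≤ t ⟧ ≡ 0 → ε t x ≈ ι 1
            ε≈ e₁ e₂ = trans (+-cong (reflexive (≡.cong ι e₁)) (-‿cong (reflexive (≡.cong ι e₂))))
              (trans (+-congˡ (trans (sym (+-identityˡ _)) (-‿inverseʳ 0#))) (+-identityʳ _))

          high : ∀ x → x ℕ.< N → t ℕ.< p x → F (suc x) ≤ F (suc (m t))
          high x x<N t<px with x ℕ.<? m t
          ... | no x≮m = descending desc (s≤s (ℕ.≮⇒≥ x≮m))
          ... | yes x<m = -≤0⇒≤ (≤-reflexive (begin-equality
            F (suc x) - F z₁                             ≈⟨ ι1* _ ⟨
            ι 1 * (F (suc x) - F z₁)                     ≈⟨ solve 3 (λ u v w → u :* (v :- w) := (:- u) :* (w :- v)) refl (ι 1) (F (suc x)) (F z₁) ⟩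
            - ι 1 * (F z₁ - F (suc x))                   ≈⟨ *-congʳ (ε≈ (⟦≤⟧-no t<px) (⟦≤⟧-yes (<m⇒p*≤ x<m))) ⟨
            V t z₁ x                                     ≈⟨ V≈0 z₁ (ℕ.n≤1+n _) ℕ.≤-refl x x<N ⟩
            0#                                           ∎))
            where
            ε≈ : ⟦ p x ≤ t ⟧ ≡ 0 → ⟦ p* x ≤ t ⟧ ≡ 1 → ε t x ≈ - ι 1
            ε≈ e₁ e₂ = trans (+-cong (reflexive (≡.cong ι e₁)) (-‿cong (reflexive (≡.cong ι e₂)))) (+-identityˡ _)

    rearrangement : E p* F ≤ E p F
    rearrangement = ≤-diff (S-nonneg κ (λ t t<κ → *-nonneg (drop-nonneg t) (Y-nonneg t t<κ))) (sym layer-cake)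

    -- The equality case at a strict drop of F.
    record Separated (t : ℕ) : Set where
      field
        count≡  : count≤ N p t ≡ m t
        above   : ∀ x → x ℕ.< N → p x ℕ.≤ t → F (m t) ≤ F (suc x)
        below   : ∀ x → x ℕ.< N → t ℕ.< p x → F (suc x) ≤ F (suc (m t))

    separated : E p F ≤ E p* F → ∀ t → t ℕ.< κ → Pos (drop t) → Separated t
    separated tight t t<κ 0<drop = record
      { count≡ = count≡m t t<κ 0<drop Y≤0
      ; above  = low t t<κ 0<drop Y≤0
      ; below  = high t t<κ 0<drop Y≤0
      }
      where
      Y≤0 : Y t ≤ 0#
      Y≤0 = *-cancel-≤0 0<drop (≤-trans
        (term≤S κ (λ s s<κ → *-nonneg (drop-nonneg s) (Y-nonneg s s<κ)) t t<κ)
        (≤-resp layer-cake refl (≤⇒-≤0 tight)))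

-- Monotone parent functions are determined by their counts.

Monotone : ℕ → (ℕ → ℕ) → Set
Monotone N p = ∀ {x y} → x ℕ.< y → y ℕ.< N → p x ℕ.≤ p y

count≤-zero : ∀ N p t → (∀ x → x ℕ.< N → t ℕ.< p x) → count≤ N p t ≡ 0
count≤-zero zero    p t h = ≡.refl
count≤-zero (suc N) p t h = ≡.cong₂ ℕ._+_ (⟦≤⟧-no (h 0 (s≤s z≤n))) (count≤-zero N (p ∘ suc) t (λ x x<N → h (suc x) (s≤s x<N)))

-- For monotone p the set of x with p x ≤ t is an initial segment, hence known from its size.
-- Besides parent functions, this is applied to the boundary indicator of a numbering.
monotone-initial : ∀ N p t → Monotone N p → ∀ x → x ℕ.< N → (x ℕ.< count≤ N p t → p x ℕ.≤ t) × (count≤ N p t ℕ.≤ x → t ℕ.< p x)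
monotone-initial (suc N) p t mono x x<N with p 0 ℕ.≤? t
... | no p0≰t = (λ x<c → contradiction (≡.subst (x ℕ.<_) none x<c) λ ()) , (λ _ → all x x<N)
  where
  all : ∀ y → y ℕ.< suc N → t ℕ.< p y
  all zero    _   = ℕ.≰⇒> p0≰t
  all (suc y) y<N = ℕ.<-≤-trans (ℕ.≰⇒> p0≰t) (mono (s≤s z≤n) y<N)
  none : count≤ (suc N) p t ≡ 0
  none = count≤-zero (suc N) p t all
monotone-initial (suc N) p t mono zero    x<N | yes p0≤t =
  (λ _ → p0≤t) , λ c≤0 → contradiction (≡.subst (λ b → b ℕ.+ count≤ N (p ∘ suc) t ℕ.≤ 0) (⟦≤⟧-yes p0≤t) c≤0) λ ()
monotone-initial (suc N) p t mono (suc x) (s≤s x<N) | yes p0≤t =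
  (λ x<c → proj₁ rec (ℕ.≤-pred (≡.subst (suc x ℕ.<_) c≡ x<c))) , (λ c≤x → proj₂ rec (ℕ.≤-pred (≡.subst (ℕ._≤ suc x) c≡ c≤x)))
  where
  c≡ : count≤ (suc N) p t ≡ suc (count≤ N (p ∘ suc) t)
  c≡ = ≡.cong (ℕ._+ count≤ N (p ∘ suc) t) (⟦≤⟧-yes p0≤t)
  rec = monotone-initial N (p ∘ suc) t (λ x<y y<N → mono (s≤s x<y) (s≤s y<N)) x x<N

module SpiralUnique (κ e D : ℕ) where
  open Spiral κ e D

  spiral-unique : ∀ p → (∀ x → x ℕ.< N → p x ℕ.≤ κ) → (∀ t → t ℕ.< κ → count≤ N p t ≡ m t) → Monotone N p →
    ∀ x → x ℕ.< N → p x ≡ p* x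
  spiral-unique p p≤κ count≡m mono x x<N = ℕ.≤-antisym (ℕ.≮⇒≥ p*≮p) (ℕ.≮⇒≥ p≮p*)
    where
    p≮p* : ¬ (p x ℕ.< p* x)
    p≮p* px<p*x = ℕ.<⇒≱ px<p*x (<m⇒p*≤ (ℕ.≰⇒> λ m≤x → ℕ.<-irrefl ≡.refl
      (proj₂ (monotone-initial N p (p x) mono x x<N) (≡.subst (ℕ._≤ x) (≡.sym (count≡m (p x) px<κ)) m≤x))))
      where px<κ = ℕ.<-≤-trans px<p*x (p*≤κ x)
    p*≮p : ¬ (p* x ℕ.< p x)
    p*≮p p*x<px = ℕ.<⇒≱ p*x<px (proj₁ (monotone-initial N p (p* x) mono x x<N)
      (≡.subst (x ℕ.<_) (≡.sym (count≡m (p* x) p*x<κ)) (p*≤⇒<m p*x<κ ℕ.≤-refl)))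
      where p*x<κ = ℕ.<-≤-trans p*x<px (p≤κ x x<N)

  -- Each step from t to t + 1 adds at least q to the count of p and exactly q to m, so an excess at
  -- t would still be present at r + t.
  count-squeeze : ∀ {p} → Dominating p → ∀ r t → r ℕ.+ t ℕ.≤ κ → count≤ N p (r ℕ.+ t) ℕ.≤ m (r ℕ.+ t) → count≤ N p t ≡ m t
  count-squeeze dom zero    t t≤κ h = ℕ.≤-antisym h (Dominating.m≤count dom t t≤κ)
  count-squeeze dom (suc r) t t≤κ h = count-squeeze dom r t (ℕ.<⇒≤ t≤κ)
    (ℕ.+-cancelʳ-≤ q _ _ (ℕ.≤-trans (Dominating.count-suc dom (r ℕ.+ t) t≤κ) (ℕ.≤-trans h (ℕ.≤-reflexive (m-suc (r ℕ.+ t))))))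

  count≤N : ∀ n p t → count≤ n p t ℕ.≤ n
  count≤N zero    p t = z≤n
  count≤N (suc n) p t = ℕ.+-mono-≤ (⟦≤⟧≤1 (p 0) t) (count≤N n (p ∘ suc) t)

-- Ties of an eigenfunction on the spiral tree.

module SpiralTies (K : OrderedDomain) (κ e D : ℕ) where
  open OrderedDomainProperties K
  open NatIndexedSums K
  open Spiral κ e D
  open SpiralUnique κ e D
  open Energy K N
  open Rearrangement K κ e D

  S-append : ∀ a b g → S (a ℕ.+ b) g ≈ S a g + S b (λ j → g (a ℕ.+ j))
  S-append zero    b g = sym (+-identityˡ _)
  S-append (suc a) b g = trans (+-congˡ (S-append a b (g ∘ suc))) (sym (+-assoc _ _ _))

  S-blocks : ∀ a b (g : ℕ → Carrier) → S (a ℕ.* b) g ≈ S a (λ i → S b (λ z → g (i ℕ.* b ℕ.+ z)))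
  S-blocks zero    b g = refl
  S-blocks (suc a) b g = trans (S-append b (a ℕ.* b) g) (+-congˡ (trans (S-blocks a b (λ j → g (b ℕ.+ j)))
    (S-cong a (λ i _ → S-cong b (λ z _ → reflexive (≡.cong g (≡.sym (ℕ.+-assoc b (i ℕ.* b) z))))))))

  P : (ℕ → Carrier) → ℕ → Carrier
  P F zero    = F 1
  P F (suc y) = F (p* y)

  -- The first child of i for 0 < i ≤ κ, and the second child of the root, vertex 1 being set aside.
  -- The block of q children ends at first i + e = m i.
  first : ℕ → ℕ
  first i = suc (suc (i ℕ.* q))

  -- The D surplus children of κ are numbered directly after its regular block, from first (κ + 1)
  -- on.
  surplus : (ℕ → Carrier) → ℕ → Carrier
  surplus F i = ι (δ κ i) * S D (λ z → F i - F (first (suc κ) ℕ.+ z))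

  -- The first child of the root takes the place of the root's parent in L, so
  -- that all interior vertices obey one formula.
  L-spiral : ∀ F i → i ℕ.≤ κ → L p* F i ≈ (F i - P F i) + (S q (λ z → F i - F (first i ℕ.+ z)) + surplus F i)
  L-spiral F i i≤κ = begin-equality
    L p* F i
      ≈⟨ S-cong (suc N) (λ j _ → trans (*-congʳ (ι-+ (ch p* i j) (ch p* j i))) (distribʳ (F i - F j) _ _)) ⟩
    S (suc N) (λ j → ι (ch p* i j) * (F i - F j) + ι (ch p* j i) * (F i - F j))
      ≈⟨ S-+ (suc N) (λ j → ι (ch p* i j) * (F i - F j)) (λ j → ι (ch p* j i) * (F i - F j)) ⟩
    S (suc N) (λ j → ι (ch p* i j) * (F i - F j)) + (ι 0 * (F i - F 0) + (ι (δ (p* 0) i) * (F i - F 1) + S (suc κ ℕ.* q ℕ.+ D) G))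
      ≈⟨ solve 4 (λ u v w s → u :+ (v :+ (w :+ s)) := ((u :+ v) :+ w) :+ s) refl _ _ _ _ ⟩
    ((S (suc N) (λ j → ι (ch p* i j) * (F i - F j)) + ι 0 * (F i - F 0)) + ι (δ (p* 0) i) * (F i - F 1)) + S (suc κ ℕ.* q ℕ.+ D) G
      ≈⟨ +-cong (trans (+-congʳ (trans (+-congˡ (ι0* _)) (+-identityʳ _))) (parent i i≤κ)) children ⟩
    (F i - P F i) + (S q (λ z → F i - F (first i ℕ.+ z)) + surplus F i) ∎
    where
    G : ℕ → Carrier
    G y = ι (δ (p* (suc y)) i) * (F i - F (suc (suc y)))

    parent : ∀ i → i ℕ.≤ κ → S (suc N) (λ j → ι (ch p* i j) * (F i - F j)) + ι (δ (p* 0) i) * (F i - F 1) ≈ F i - P F i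
    parent zero i≤κ = trans (+-cong (S-zero (suc N) (λ j _ → ι0* (F 0 - F j))) (trans (*-congʳ (reflexive (≡.cong (λ u → ι (δ u 0)) (ℕ.⊓-zeroʳ κ)))) (ι1* _))) (+-identityˡ _)
    parent (suc y) i≤κ = trans (+-cong (S-δ (suc N) (p* y) (λ j → F (suc y) - F j) (s≤s (ℕ.≤-trans (p*≤κ y) κ≤N)))
      (trans (*-congʳ (reflexive (≡.cong (λ u → ι (δ u (suc y))) (ℕ.⊓-zeroʳ κ)))) (ι0* _))) (+-identityʳ _)

    /-block : ∀ b z → z ℕ.< q → (b ℕ.* q ℕ.+ z) ℕ./ q ≡ b
    /-block b z z<q = ≡.trans (ℕ.+-distrib-/-∣ˡ {m = b ℕ.* q} z (divides-refl b))
      (≡.trans (≡.cong₂ ℕ._+_ (ℕ.m*n/n≡m b q) (ℕ.m<n⇒m/n≡0 z<q)) (ℕ.+-identityʳ b))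

    block : ∀ b → b ℕ.< suc κ → S q (λ z → G (b ℕ.* q ℕ.+ z)) ≈ ι (δ i b) * S q (λ z → F i - F (first b ℕ.+ z))
    block b (s≤s b≤κ) = trans
      (S-cong q (λ z z<q → *-congʳ {x = F i - F (first b ℕ.+ z)} (reflexive (≡.cong ι (≡.trans
        (≡.cong (λ u → δ u i) (≡.trans (≡.cong (κ ℕ.⊓_) (/-block b z z<q)) (ℕ.m≥n⇒m⊓n≡n b≤κ))) (δ-sym b i))))))
      (S-*ˡ q (ι (δ i b)) (λ z → F i - F (first b ℕ.+ z)))

    rest : ∀ z → p* (suc (suc κ ℕ.* q ℕ.+ z)) ≡ κ
    rest z = ℕ.m≤n⇒m⊓n≡m (ℕ.≤-trans (ℕ.n≤1+n κ)
      (≡.subst (ℕ._≤ (suc κ ℕ.* q ℕ.+ z) ℕ./ q) (ℕ.m*n/n≡m (suc κ) q) (ℕ./-monoˡ-≤ q (ℕ.m≤m+n (suc κ ℕ.* q) z))))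

    children : S (suc κ ℕ.* q ℕ.+ D) G ≈ S q (λ z → F i - F (first i ℕ.+ z)) + surplus F i
    children = trans (S-append (suc κ ℕ.* q) D G) (+-cong
      (trans (S-blocks (suc κ) q G) (trans (S-cong (suc κ) block) (S-δ (suc κ) i (λ b → S q (λ z → F i - F (first b ℕ.+ z))) (s≤s i≤κ))))
      (trans (S-cong D (λ z _ → *-congʳ {x = F i - F (first (suc κ) ℕ.+ z)} (reflexive (≡.cong (λ u → ι (δ u i)) (rest z)))))
        (S-*ˡ D (ι (δ κ i)) (λ z → F i - F (first (suc κ) ℕ.+ z)))))

  module _ (F : ℕ → Carrier) (desc : Descending F) (F-zero : ∀ t → κ ℕ.< t → F t ≈ 0#) (F-pos : ∀ t → t ℕ.≤ κ → Pos (F t))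
           (μ : Carrier) (eigen : ∀ i → i ℕ.≤ κ → L p* F i ≈ μ * F i) where

    F-nonneg : ∀ t → 0# ≤ F t
    F-nonneg t with t ℕ.≤? κ
    ... | yes t≤κ = Pos⇒0≤ (F-pos t t≤κ)
    ... | no t≰κ  = ≤-reflexive (sym (F-zero t (ℕ.≰⇒> t≰κ)))

    surplus-κ : surplus F κ ≈ ι D * F κ
    surplus-κ = trans (trans (*-congʳ (reflexive (≡.cong ι (δ-refl κ)))) (ι1* _)) (trans
      (S-cong D (λ z _ → trans (+-congˡ (-‿cong (F-zero _ (κ<last z)))) (trans (+-congˡ (trans (sym (+-identityˡ _)) (-‿inverseʳ 0#))) (+-identityʳ (F κ)))))
      (const D))
      where
      κ<last : ∀ z → κ ℕ.< first (suc κ) ℕ.+ z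
      κ<last z = ℕ.≤-trans (ℕ.≤-trans (t<m κ) (ℕ.n≤1+n _)) (ℕ.m≤m+n (first (suc κ)) z)
      const : ∀ n → S n (λ _ → F κ) ≈ ι n * F κ
      const zero    = sym (zeroˡ (F κ))
      const (suc n) = trans (+-cong (sym (*-identityˡ (F κ))) (const n)) (sym (distribʳ (F κ) 1# (ι n)))

    surplus-nonneg : ∀ i → 0# ≤ surplus F i
    surplus-nonneg i with κ ℕ.≟ i
    ... | yes ≡.refl = ≤-resp refl (sym surplus-κ) (*-nonneg (ι-nonneg D) (F-nonneg κ))
    ... | no κ≢i     = ≤-reflexive (sym (trans (*-congʳ (reflexive (≡.cong ι (δ-≢ κ≢i)))) (ι0* _)))

    surplus-zero : ∀ i → i ℕ.< κ → surplus F i ≈ 0#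
    surplus-zero i i<κ = trans (*-congʳ (reflexive (≡.cong ι (δ-≢ (λ κ≡i → ℕ.<-irrefl (≡.sym κ≡i) i<κ))))) (ι0* _)

    module Tie (a : ℕ) (a<κ : a ℕ.< κ) (tie : F a ≤ F (suc a)) where

      tie≈ : F a ≈ F (suc a)
      tie≈ = ≤-antisym tie (desc a)

      P-desc : P F (suc a) ≤ P F a
      P-desc = go a tie
        where
        go : ∀ a → F a ≤ F (suc a) → P F (suc a) ≤ P F a
        -- Vertex 1 has parent 0 while the root is given 1 in place of a parent, so the required
        -- inequality F 0 ≤ F 1 is the tie itself.
        go zero    tie = ≤-trans (≤-reflexive (reflexive (≡.cong F (ℕ.⊓-zeroʳ κ)))) tie
        go (suc y) _   = descending desc (p*-monotone (ℕ.n≤1+n y))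

      gap : ℕ → Carrier
      gap z = F (first a ℕ.+ z) - F (first (suc a) ℕ.+ z)

      gap-nonneg : ∀ z → 0# ≤ gap z
      gap-nonneg z = ≤⇒0≤- (descending desc (ℕ.+-monoˡ-≤ z (s≤s (s≤s (ℕ.*-monoˡ-≤ q (ℕ.n≤1+n a))))))

      -- At a tie the eigenvalue equations at a and a + 1 have equal right-hand sides. Their
      -- difference consists of terms that are all nonnegative, since F descends, `p*` is monotone
      -- and the surplus children are leaves; hence each of them is zero.
      balance : (P F a - P F (suc a)) + (S q gap + surplus F (suc a)) ≈ 0#
      balance = begin-equality
        (P F a - P F (suc a)) + (S q gap + surplus F (suc a))
          ≈⟨ +-cong (trans (solve 3 (λ c x y → x :- y := (c :- y) :- (c :- x)) refl (F a) (P F a) (P F (suc a))) (+-congʳ (+-congʳ tie≈)))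
               (+-congʳ (trans (S-cong q (λ z _ → trans (solve 3 (λ c x y → x :- y := (c :- y) :- (c :- x)) refl (F a) (F (first a ℕ.+ z)) (F (first (suc a) ℕ.+ z))) (+-congʳ (+-congʳ tie≈))))
                 (S-sub q (λ z → F (suc a) - F (first (suc a) ℕ.+ z)) (λ z → F a - F (first a ℕ.+ z))))) ⟩
        ((F (suc a) - P F (suc a)) - (F a - P F a)) + ((S′ - S₀) + surplus F (suc a))
          ≈⟨ solve 5 (λ x′ x s′ s u → (x′ :- x) :+ ((s′ :- s) :+ u) := (x′ :+ (s′ :+ u)) :- (x :+ s)) refl (F (suc a) - P F (suc a)) (F a - P F a) S′ S₀ (surplus F (suc a)) ⟩
        ((F (suc a) - P F (suc a)) + (S′ + surplus F (suc a))) - ((F a - P F a) + S₀)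
          ≈⟨ +-cong (trans (sym (L-spiral F (suc a) a<κ)) (eigen (suc a) a<κ))
               (-‿cong (trans (+-congˡ (trans (sym (+-identityʳ S₀)) (+-congˡ (sym (surplus-zero a a<κ))))) (trans (sym (L-spiral F a (ℕ.<⇒≤ a<κ))) (eigen a (ℕ.<⇒≤ a<κ))))) ⟩
        μ * F (suc a) - μ * F a
          ≈⟨ +-congʳ (*-congˡ (sym tie≈)) ⟩
        μ * F a - μ * F a
          ≈⟨ -‿inverseʳ _ ⟩
        0# ∎
        where
        S₀ = S q (λ z → F a - F (first a ℕ.+ z))
        S′ = S q (λ z → F (suc a) - F (first (suc a) ℕ.+ z))

      ΣG-nonneg : 0# ≤ S q gap
      ΣG-nonneg = S-nonneg q (λ z _ → gap-nonneg z)

      rest≤0 : S q gap + surplus F (suc a) ≤ 0#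
      rest≤0 = ≤-trans (x≤y+x (≤⇒0≤- P-desc)) (≤-reflexive balance)

      gap≤0 : ∀ z → z ℕ.< q → F (first a ℕ.+ z) ≤ F (first (suc a) ℕ.+ z)
      gap≤0 z z<q = -≤0⇒≤ (≤-trans (term≤S q (λ y _ → gap-nonneg y) z z<q) (≤-trans (x≤x+y (surplus-nonneg (suc a))) rest≤0))

      first-tie : F (first a) ≤ F (first (suc a))
      first-tie = ≡.subst₂ (λ u v → F u ≤ F v) (ℕ.+-identityʳ (first a)) (ℕ.+-identityʳ (first (suc a))) (gap≤0 0 (s≤s z≤n))

      last≡m : ∀ b → first b ℕ.+ e ≡ m b
      last≡m b = ≡.cong suc (≡.trans (≡.sym (ℕ.+-suc (b ℕ.* q) e)) (ℕ.+-comm (b ℕ.* q) q))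

      last-tie : F (m a) ≤ F (m (suc a))
      last-tie = ≡.subst₂ (λ u v → F u ≤ F v) (last≡m a) (last≡m (suc a)) (gap≤0 e ℕ.≤-refl)

      -- The surplus children of κ are leaves, where F vanishes, so they add D · F κ to the balance.
      -- As F κ > 0, only D = 0 is possible.
      no-surplus : suc a ≡ κ → D ≡ 0
      no-surplus ≡.refl = D≡0 D (≤-trans (≤-reflexive (sym surplus-κ)) (≤-trans (x≤y+x ΣG-nonneg) rest≤0))
        where
        D≡0 : ∀ D → ι D * F κ ≤ 0# → D ≡ 0
        D≡0 zero    _ = ≡.refl
        D≡0 (suc D) h = contradiction (≤-trans (≤-trans (≤-reflexive (sym (*-identityˡ (F κ))))
          (≤-trans (x≤x+y (*-nonneg (ι-nonneg D) (F-nonneg κ))) (≤-reflexive (sym (distribʳ (F κ) 1# (ι D)))))) h) (F-pos κ ℕ.≤-refl)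

    first-chain : ∀ r s → s ℕ.+ r ℕ.≤ κ → F s ≤ F (s ℕ.+ r) → F (first s) ≤ F (first (s ℕ.+ r))
    first-chain zero    s _ _ = ≡.subst (λ u → F (first s) ≤ F (first u)) (≡.sym (ℕ.+-identityʳ s)) ≤-refl
    first-chain (suc r) s h tie rewrite ℕ.+-suc s r = ≤-trans
      (first-chain r s (ℕ.<⇒≤ h) (≤-trans tie (desc (s ℕ.+ r))))
      (Tie.first-tie (s ℕ.+ r) h (≤-trans (descending desc (ℕ.m≤m+n s r)) tie))

    -- As F descends, all children of a run of tied vertices carry one value.
    block-constant : ∀ {s t} → s ℕ.< t → t ℕ.≤ κ → F s ≤ F t → F (first s) ≤ F (m t)
    block-constant {s} {suc t} (s≤s s≤t) t<κ tie = ≤-trans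
      (≡.subst (λ u → F (first s) ≤ F (first u)) s+r≡ (first-chain (suc t ℕ.∸ s) s (≡.subst (ℕ._≤ κ) (≡.sym s+r≡) t<κ) (≡.subst (λ u → F s ≤ F u) (≡.sym s+r≡) tie)))
      (≤-trans (desc (m t)) (Tie.last-tie t t<κ (≤-trans (descending desc s≤t) tie)))
      where
      s+r≡ : s ℕ.+ (suc t ℕ.∸ s) ≡ suc t
      s+r≡ = ℕ.m+[n∸m]≡n (ℕ.m≤n⇒m≤1+n s≤t)

    κ-tie⇒D≡0 : ∀ {s} → s ℕ.< κ → F s ≤ F κ → D ≡ 0
    κ-tie⇒D≡0 {s} s<κ tie = go κ ≡.refl s<κ
      where
      go : ∀ k → k ≡ κ → s ℕ.< k → D ≡ 0
      go (suc k) eq (s≤s s≤k) = Tie.no-surplus k (ℕ.≤-reflexive eq)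
        (≤-trans (descending desc s≤k) (≡.subst (λ u → F s ≤ F u) (≡.sym eq) tie)) eq

    -- If 0, 1 and 2 were tied, `block-constant` would give all children of the root the value F 0,
    -- so L p* F 0 ≤ 0, against μ F 0 > 0.
    root-run : Pos μ → 2 ℕ.≤ κ → ¬ (F 0 ≤ F 2)
    root-run 0<μ 2≤κ tie = *-pos 0<μ (F-pos 0 z≤n) (≤-trans (≤-reflexive (trans (sym (eigen 0 z≤n)) (L-spiral F 0 z≤n)))
      (≤-trans (+-mono-≤ (≤⇒-≤0 (≤-trans tie (desc 1))) (+-mono-≤ (S-≤0 q block≤0) (≤-reflexive (surplus-zero 0 (ℕ.<-≤-trans (s≤s z≤n) 2≤κ)))))
        (≤-reflexive (trans (+-identityˡ _) (+-identityˡ _)))))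
      where
      S-≤0 : ∀ n {g} → (∀ i → i ℕ.< n → g i ≤ 0#) → S n g ≤ 0#
      S-≤0 n h = ≤-trans (S-mono-≤ n h) (≤-reflexive (S-zero n (λ _ _ → refl)))
      block≤0 : ∀ z → z ℕ.< q → F 0 - F (first 0 ℕ.+ z) ≤ 0#
      block≤0 z z<q = ≤⇒-≤0 (≤-trans tie (≤-trans (block-constant {0} {1} (s≤s z≤n) (ℕ.<⇒≤ 2≤κ) (≤-trans tie (desc 1)))
        (descending desc (s≤s (ℕ.≤-trans z<q (ℕ.m≤m+n q _))))))

    -- If μ ≤ 0 the energy is at most 0, so its term for the edge from κ to the leaf N, which equals
    -- (F κ)², would vanish.
    μ-pos : μ * ‖ F ‖² ≈ E p* F → Pos μ
    μ-pos eq μ≤0 = F-pos κ ℕ.≤-refl (≤-reflexive (square-≤0 (≤-trans (≤-reflexive lastSquare) (≤-trans (term≤S N (λ y _ → square-nonneg (F (suc y) - F (p* y))) x ℕ.≤-refl)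
      (≤-trans (≤-reflexive (trans (sym eq) (*-comm μ ‖ F ‖²))) (≤-trans (*-monoˡ-≤ (S-nonneg (suc N) (λ i _ → square-nonneg (F i))) μ≤0) (≤-reflexive (zeroʳ _))))))))
      where
      x = suc κ ℕ.* q ℕ.+ D
      κ≤p*x : κ ℕ.≤ p* x
      κ≤p*x = ℕ.≮⇒≥ λ p*x<κ → ℕ.<⇒≱ (p*≤⇒<m p*x<κ ℕ.≤-refl)
        (ℕ.≤-trans (s≤s (ℕ.*-monoˡ-≤ q p*x<κ)) (ℕ.≤-trans (ℕ.+-monoˡ-≤ (κ ℕ.* q) (s≤s (z≤n {e}))) (ℕ.m≤m+n (suc κ ℕ.* q) D)))
      p*x≡κ : p* x ≡ κ
      p*x≡κ = ℕ.≤-antisym (p*≤κ x) κ≤p*x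
      lastSquare : F κ * F κ ≈ (F (suc x) - F (p* x)) * (F (suc x) - F (p* x))
      lastSquare = begin-equality
        F κ * F κ
          ≈⟨ solve 2 (λ f o → f :* f := ((o :- o) :- f) :* ((o :- o) :- f)) refl (F κ) 0# ⟩
        ((0# - 0#) - F κ) * ((0# - 0#) - F κ)
          ≈⟨ *-cong same same ⟩
        (F (suc x) - F (p* x)) * (F (suc x) - F (p* x)) ∎
        where
        same : (0# - 0#) - F κ ≈ F (suc x) - F (p* x)
        same = +-cong (trans (-‿inverseʳ 0#) (sym (F-zero (suc x) (ℕ.≤-trans (t<m κ) (ℕ.m≤m+n (m κ) D))))) (-‿cong (reflexive (≡.cong F (≡.sym p*x≡κ))))

-- Rigidity: equality of the energies forces the spiral tree.

module Rigidity (K : OrderedDomain) (κ e D : ℕ) where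
  open OrderedDomainProperties K
  open Spiral κ e D
  open SpiralUnique κ e D
  open Energy K N
  open Rearrangement K κ e D
  open SpiralTies K κ e D

  module _ (F : ℕ → Carrier) (desc : Descending F) (F-zero : ∀ t → κ ℕ.< t → F t ≈ 0#) (F-pos : ∀ t → t ℕ.≤ κ → Pos (F t))
           (F≤? : ∀ s t → Dec (F s ≤ F t))
           (μ : Carrier) (0<μ : Pos μ) (eigen : ∀ i → i ℕ.≤ κ → L p* F i ≈ μ * F i)
           (p : ℕ → ℕ) (dom : Dominating p) (loopless : ∀ x → x ℕ.< N → p x ≢ suc x)
           (tie-ordered : ∀ {x y} → x ℕ.< y → y ℕ.< N → F (suc x) ≤ F (suc y) → p x ℕ.≤ p y)
           (tight : E p F ≤ E p* F) where
    open Dominating dom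

    Drop : ℕ → Set
    Drop t = ¬ (F t ≤ F (suc t))

    sep : ∀ {t} → t ℕ.< κ → Drop t → Separated F desc p dom t
    sep {t} t<κ dropt = separated F desc p dom tight t t<κ (λ le → dropt (-≤0⇒≤ le))

    drop-or-tie : ∀ r s → (∃[ t ] (s ℕ.≤ t × t ℕ.< s ℕ.+ r × Drop t)) ⊎ (F s ≤ F (s ℕ.+ r))
    drop-or-tie zero    s = inj₂ (≡.subst (λ u → F s ≤ F u) (≡.sym (ℕ.+-identityʳ s)) ≤-refl)
    drop-or-tie (suc r) s rewrite ℕ.+-suc s r with drop-or-tie r s | F≤? (s ℕ.+ r) (suc (s ℕ.+ r))
    ... | inj₁ (t , s≤t , t< , d) | _      = inj₁ (t , s≤t , ℕ.m≤n⇒m≤1+n t< , d)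
    ... | inj₂ _                  | no d   = inj₁ (s ℕ.+ r , ℕ.m≤m+n s r , ℕ.≤-refl , d)
    ... | inj₂ tie                | yes t  = inj₂ (≤-trans tie t)

    -- A run is a maximal interval of tied vertices. On the left it is bounded by 0 or by a drop
    -- just before it, on the right (`run-end`) by κ or by a drop just after it.
    run-start : ∀ a → ∃[ s ] (s ℕ.≤ a × F s ≤ F a × (∀ s′ → s ≡ suc s′ → Drop s′))
    run-start zero = 0 , z≤n , ≤-refl , λ _ ()
    run-start (suc a) with F≤? a (suc a)
    ... | no d    = suc a , ℕ.≤-refl , ≤-refl , λ { _ ≡.refl → d }
    ... | yes tie = let s , s≤a , Fs , d = run-start a in s , ℕ.m≤n⇒m≤1+n s≤a , ≤-trans Fs tie , d

    run-end : ∀ r b → r ℕ.+ b ≡ κ → ∃[ t ] (b ℕ.≤ t × t ℕ.≤ κ × F b ≤ F t × (t ≡ κ ⊎ (t ℕ.< κ × Drop t)))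
    run-end zero    b eq = b , ℕ.≤-refl , ℕ.≤-reflexive eq , ≤-refl , inj₁ eq
    run-end (suc r) b eq with F≤? b (suc b)
    ... | no d    = b , ℕ.≤-refl , ℕ.<⇒≤ b<κ , ≤-refl , inj₂ (b<κ , d)
      where b<κ = ℕ.≤-trans (s≤s (ℕ.m≤n+m b r)) (ℕ.≤-reflexive eq)
    ... | yes tie =
      let t , b≤t , t≤κ , Ft , d = run-end r (suc b) (≡.trans (ℕ.+-suc r b) eq)
      in t , ℕ.<⇒≤ b≤t , t≤κ , ≤-trans tie Ft , d

    -- Let s and t be the ends of the run containing both parents. The drop before s keeps F (suc x)
    -- at most at F (first s), the drop after t keeps F (suc y) at least at F (m t), and
    -- `block-constant` joins the two. The runs without such a drop need separate arguments.
    same-run : ∀ x y → x ℕ.< N → y ℕ.< N → p y ℕ.< p x → F (p y) ≤ F (p x) → F (suc x) ≤ F (suc y)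
    same-run x y x<N y<N py<px tie = ≤-trans (upper s s≤py Fs starts) (≤-trans
      (block-constant F desc F-zero F-pos μ eigen s<t t≤κ Fs≤Ft) (lower ends))
      where
      left = run-start (p y)
      s = proj₁ left
      s≤py = proj₁ (proj₂ left)
      Fs = proj₁ (proj₂ (proj₂ left))
      starts = proj₂ (proj₂ (proj₂ left))
      right = run-end (κ ℕ.∸ p x) (p x) (ℕ.m∸n+n≡m (p≤κ x x<N))
      t = proj₁ right
      px≤t = proj₁ (proj₂ right)
      t≤κ = proj₁ (proj₂ (proj₂ right))
      Ft = proj₁ (proj₂ (proj₂ (proj₂ right)))
      ends = proj₂ (proj₂ (proj₂ (proj₂ right)))
      s<t : s ℕ.< t
      s<t = ℕ.≤-<-trans s≤py (ℕ.<-≤-trans py<px px≤t)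
      Fs≤Ft : F s ≤ F t
      Fs≤Ft = ≤-trans Fs (≤-trans tie Ft)
      lower : t ≡ κ ⊎ (t ℕ.< κ × Drop t) → F (m t) ≤ F (suc y)
      lower (inj₂ (t<κ , d)) = Separated.above (sep t<κ d) y y<N (ℕ.≤-trans (ℕ.<⇒≤ py<px) px≤t)
      -- The run reaches κ, so D = 0 and m t is the last vertex N.
      lower (inj₁ t≡κ) = descending desc (≡.subst (suc y ℕ.≤_) N≡m y<N)
        where
        N≡m : N ≡ m t
        N≡m = ≡.trans (≡.cong (m κ ℕ.+_) (κ-tie⇒D≡0 F desc F-zero F-pos μ eigen (≡.subst (s ℕ.<_) t≡κ s<t) (≡.subst (λ u → F s ≤ F u) t≡κ Fs≤Ft)))
          (≡.trans (ℕ.+-identityʳ (m κ)) (≡.cong m (≡.sym t≡κ)))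
      upper : ∀ s → s ℕ.≤ p y → F s ≤ F (p y) → (∀ s′ → s ≡ suc s′ → Drop s′) → F (suc x) ≤ F (first s)
      upper (suc s′) s<py _ d = Separated.below (sep s′<κ (d s′ ≡.refl)) x x<N s′<px
        where
        s′<px = ℕ.<-trans s<py py<px
        s′<κ = ℕ.<-≤-trans s′<px (p≤κ x x<N)
      -- The run starts at the root, with no drop before it. As first 0 = 2, only vertex 1 is in
      -- question. Its parent exceeds 0 and is not 1 itself, so 0, 1 and 2 would be tied, which
      -- `root-run` excludes.
      upper zero _ F0 _ with x ℕ.≟ 0
      ... | no x≢0     = descending desc (s≤s (ℕ.n≢0⇒n>0 x≢0))
      ... | yes ≡.refl = contradiction (≤-trans F0 (≤-trans tie (descending desc 2≤p0))) (root-run F desc F-zero F-pos μ eigen 0<μ (ℕ.≤-trans 2≤p0 (p≤κ 0 x<N)))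
        where
        2≤p0 : 2 ℕ.≤ p 0
        2≤p0 = ℕ.≤∧≢⇒< (ℕ.≤-<-trans z≤n py<px) (loopless 0 x<N ∘ ≡.sym)

    -- For x < y an inverted pair of parents makes F (suc x) ≤ F (suc y), through a drop between the
    -- parents or through a common run. The tie rule then orders the parents the other way.
    monotone : Monotone N p
    monotone {x} {y} x<y y<N = ℕ.≮⇒≥ λ py<px → ℕ.<⇒≱ py<px (tie-ordered x<y y<N (tied py<px))
      where
      x<N = ℕ.<-trans x<y y<N
      tied : p y ℕ.< p x → F (suc x) ≤ F (suc y)
      tied py<px with drop-or-tie (p x ℕ.∸ p y) (p y)
      ... | inj₂ tie = same-run x y x<N y<N py<px (≡.subst (λ u → F (p y) ≤ F u) (ℕ.m+[n∸m]≡n (ℕ.<⇒≤ py<px)) tie)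
      ... | inj₁ (t , py≤t , t<px′ , d) = ≤-trans (Separated.below s x x<N t<px) (≤-trans (desc (m t)) (Separated.above s y y<N py≤t))
        where
        t<px = ≡.subst (t ℕ.<_) (ℕ.m+[n∸m]≡n (ℕ.<⇒≤ py<px)) t<px′
        s = sep (ℕ.<-≤-trans t<px (p≤κ x x<N)) d

    -- A drop between κ - 1 and κ makes the count at κ - 1 exact. A tie there forces D = 0, and the
    -- count at κ cannot exceed N = m κ. `count-squeeze` carries either equality down to t.
    counts : ∀ t → t ℕ.< κ → count≤ N p t ≡ m t
    counts t t<κ = go κ ≡.refl t<κ
      where
      go : ∀ k → k ≡ κ → t ℕ.< k → count≤ N p t ≡ m t
      go (suc k) ≡.refl (s≤s t≤k) with F≤? k (suc k)
      ... | yes tie = count-squeeze dom (suc k ℕ.∸ t) t (ℕ.≤-reflexive r+t≡) (≡.subst (λ u → count≤ N p u ℕ.≤ m u) (≡.sym r+t≡)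
              (ℕ.≤-trans (count≤N N p (suc k)) (ℕ.≤-reflexive (≡.trans (≡.cong (m κ ℕ.+_) (κ-tie⇒D≡0 F desc F-zero F-pos μ eigen ℕ.≤-refl tie)) (ℕ.+-identityʳ (m κ))))))
        where r+t≡ = ℕ.m∸n+n≡m (ℕ.m≤n⇒m≤1+n t≤k)
      ... | no d = count-squeeze dom (k ℕ.∸ t) t (≡.subst (ℕ._≤ suc k) (≡.sym r+t≡) (ℕ.n≤1+n k))
              (≡.subst (λ u → count≤ N p u ℕ.≤ m u) (≡.sym r+t≡) (ℕ.≤-reflexive (Separated.count≡ (sep ℕ.≤-refl d))))
        where r+t≡ = ℕ.m∸n+n≡m t≤k

    rigid : ∀ x → x ℕ.< N → p x ≡ p* x
    rigid = spiral-unique p p≤κ counts monotone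

-- Doeblin contraction.

-- Doeblin's argument: applying an operator whose entries on I are bounded
-- away from 0 contracts the ratio of two nonnegative vectors.
module Contraction (K : OrderedDomain) {n : ℕ} (I : Fin n → Set) (I? : ∀ v → Dec (I v)) (v₀ : Fin n) (I₀ : I v₀) where
  open OrderedDomainProperties K
  open CommutativeMonoidSolver *-commutativeMonoid using (_⊕_; _⊜_) renaming (solve to solve-*)

  Vector : Set
  Vector = Fin n → Carrier

  NonNeg : Vector → Set
  NonNeg x = ∀ v → 0# ≤ x v

  Supported : Vector → Set
  Supported x = ∀ v → ¬ I v → x v ≈ 0#

  sum≤ : ∀ {m} {t : Fin m → Carrier} {a} → (∀ v → t v ≤ a) → sum t ≤ ι m * a
  sum≤ {zero}  {a = a} h = ≤-reflexive (sym (zeroˡ a))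
  sum≤ {suc m} {a = a} h = ≤-trans (+-mono-≤ (≤-trans (h zero) (≤-reflexive (sym (*-identityˡ a)))) (sum≤ (h ∘ suc))) (≤-reflexive (sym (distribʳ a 1# (ι m))))

  1≤* : ∀ {a b} → 1# ≤ a → 1# ≤ b → 1# ≤ a * b
  1≤* 1≤a 1≤b = ≤-trans 1≤a (≤-trans (≤-reflexive (trans (sym (*-identityˡ _)) (*-comm _ _))) (*-monoˡ-≤ (≤-trans 0≤1 1≤a) 1≤b))

  -- On I the entries of B x lie between sum x / c and b · sum x, and s is 1 / (c b). All bounds are
  -- multiplied out, since the domain comes without division.
  record MixingOperator (B : Vector → Vector) (c b s : Carrier) : Set where
    field
      B-nonneg    : ∀ {x} → NonNeg x → NonNeg (B x)
      B-supported : ∀ x → Supported (B x)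
      B-combine   : ∀ a d x y v → B (λ u → a * x u - d * y u) v ≈ a * B x v - d * B y v
      spread      : ∀ {x} → NonNeg x → Supported x → ∀ {v} → I v → sum x ≤ c * B x v
      bound       : ∀ {x} → NonNeg x → ∀ v → B x v ≤ b * sum x
      1≤c         : 1# ≤ c
      1≤b         : 1# ≤ b
      s-nonneg    : 0# ≤ s
      cbs≈1       : c * b * s ≈ 1#

  module Contracting (B : Vector → Vector) (c b s : Carrier) (op : MixingOperator B c b s)
    (invert : ∀ a → Pos a → ∃[ r ] (0# ≤ r × a * r ≈ 1#)) (1-pos : Pos 1#) where
    open MixingOperator op

    power : ℕ → Vector → Vector
    power zero    x = x
    power (suc j) x = B (power j x)

    c-pos : Pos c
    c-pos = Pos-≤ 1-pos 1≤c

    θ : Carrier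
    θ = 1# - s

    θ-nonneg : 0# ≤ θ
    θ-nonneg = ≤⇒0≤- (≤-trans (≤-reflexive (trans (sym (*-identityˡ s)) (*-comm 1# s)))
      (≤-trans (*-monoˡ-≤ s-nonneg (1≤* 1≤c 1≤b)) (≤-reflexive (trans (*-comm s (c * b)) cbs≈1))))

    Sandwich : Carrier → Carrier → Vector → Vector → Set
    Sandwich L U x y = (∀ v → L * x v ≤ y v) × (∀ v → y v ≤ U * x v)

    B-pos : ∀ {x} → NonNeg x → Supported x → Pos (sum x) → Pos (sum (B x))
    B-pos {x} x≥0 sx 0<X ΣB≤0 = 0<X (begin
      sum x          ≤⟨ spread x≥0 sx I₀ ⟩
      c * B x v₀     ≤⟨ *-monoˡ-≤ (Pos⇒0≤ c-pos) (≤-trans (term≤sum (B-nonneg x≥0) v₀) ΣB≤0) ⟩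
      c * 0#         ≈⟨ zeroʳ c ⟩
      0#             ∎)

    -- Doeblin's minorisation, with `rX` = 1 / sum x. On I an entry of B z is at least sum z / c and
    -- one of B x at most b · sum x, so B z contains the share s · sum z / sum x of B x.
    fraction : ∀ {x z} → NonNeg x → NonNeg z → Supported z → ∀ {rX} → 0# ≤ rX → sum x * rX ≈ 1# →
      ∀ v → sum z * (s * rX) * B x v ≤ B z v
    fraction {x} {z} x≥0 z≥0 sz {rX} 0≤rX XrX≈1 v = case (I? v)
     where
     case : Dec (I v) → sum z * (s * rX) * B x v ≤ B z v
     case (no ¬Iv) = ≤-reflexive (trans (*-congˡ (B-supported x v ¬Iv)) (trans (zeroʳ _) (sym (B-supported z v ¬Iv))))
     case (yes Iv) = *-cancelˡ-≤ c-pos (begin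
      c * (sum z * (s * rX) * B x v)             ≈⟨ solve-* 5 (λ c z s r x → (c ⊕ ((z ⊕ (s ⊕ r)) ⊕ x)) ⊜ (((c ⊕ z) ⊕ (s ⊕ r)) ⊕ x)) refl c (sum z) s rX (B x v) ⟩
      (c * sum z * (s * rX)) * B x v             ≤⟨ *-monoˡ-≤ (*-nonneg (*-nonneg (Pos⇒0≤ c-pos) (sum-nonneg z≥0)) (*-nonneg s-nonneg 0≤rX)) (bound x≥0 v) ⟩
      (c * sum z * (s * rX)) * (b * sum x)       ≈⟨ solve-* 6 (λ c z s r b x → (((c ⊕ z) ⊕ (s ⊕ r)) ⊕ (b ⊕ x)) ⊜ ((((c ⊕ b) ⊕ s) ⊕ (x ⊕ r)) ⊕ z)) refl c (sum z) s rX b (sum x) ⟩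
      (c * b * s) * (sum x * rX) * sum z         ≈⟨ trans (*-congʳ (trans (*-cong cbs≈1 XrX≈1) (*-identityˡ 1#))) (*-identityˡ (sum z)) ⟩
      sum z                                      ≤⟨ spread z≥0 sz Iv ⟩
      c * B z v                                  ∎)

    sum-combine : ∀ a d (x y : Vector) → sum (λ u → a * x u - d * y u) ≈ a * sum x - d * sum y
    sum-combine a d x y = trans (sum-sub (λ u → a * x u) (λ u → d * y u)) (+-cong (sym (*-distribˡ-sum a x)) (-‿cong (sym (*-distribˡ-sum d y))))

    -- Applying `fraction` to y - L x and to U x - y moves both bounds inwards. The two sums add up
    -- to (U - L) sum x, so the gap shrinks by exactly the factor 1 - s.
    contract : ∀ {x y L U} → NonNeg x → Supported x → Supported y → Pos (sum x) → Sandwich L U x y →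
      ∃[ L′ ] ∃[ U′ ] (L ≤ L′ × U′ - L′ ≈ θ * (U - L) × Sandwich L′ U′ (B x) (B y))
    contract {x} {y} {L} {U} x≥0 sx sy 0<X (lo , hi) =
      L + sum z * (s * rX) , U - sum z′ * (s * rX)
      , x≤x+y (*-nonneg (sum-nonneg z≥0) (*-nonneg s-nonneg 0≤rX))
      , difference , lower , upper
      where
      rX = proj₁ (invert (sum x) 0<X)
      0≤rX = proj₁ (proj₂ (invert (sum x) 0<X))
      XrX≈1 = proj₂ (proj₂ (invert (sum x) 0<X))
      z z′ : Vector
      z u = 1# * y u - L * x u
      z′ u = U * x u - 1# * y u
      z≥0 : NonNeg z
      z≥0 u = ≤⇒0≤- (≤-trans (lo u) (≤-reflexive (sym (*-identityˡ _))))
      z′≥0 : NonNeg z′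
      z′≥0 u = ≤⇒0≤- (≤-trans (≤-reflexive (*-identityˡ _)) (hi u))
      vanish : ∀ a d {p q} → p ≈ 0# → q ≈ 0# → a * p - d * q ≈ 0#
      vanish a d p≈0 q≈0 = trans (+-cong (trans (*-congˡ p≈0) (zeroʳ a)) (-‿cong (trans (*-congˡ q≈0) (zeroʳ d)))) (-‿inverseʳ 0#)
      sz : Supported z
      sz v ¬Iv = vanish 1# L (sy v ¬Iv) (sx v ¬Iv)
      sz′ : Supported z′
      sz′ v ¬Iv = vanish U 1# (sx v ¬Iv) (sy v ¬Iv)
      lower : ∀ v → (L + sum z * (s * rX)) * B x v ≤ B y v
      lower v = begin
        (L + sum z * (s * rX)) * B x v               ≈⟨ distribʳ (B x v) L _ ⟩
        L * B x v + sum z * (s * rX) * B x v         ≤⟨ +-mono-≤ ≤-refl (fraction x≥0 z≥0 sz 0≤rX XrX≈1 v) ⟩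
        L * B x v + B z v                            ≈⟨ +-congˡ (B-combine 1# L y x v) ⟩
        L * B x v + (1# * B y v - L * B x v)         ≈⟨ trans (solve 2 (λ p q → p :+ (q :- p) := q) refl _ _) (*-identityˡ _) ⟩
        B y v                                        ∎
      upper : ∀ v → B y v ≤ (U - sum z′ * (s * rX)) * B x v
      upper v = begin
        B y v                                        ≈⟨ trans (solve 2 (λ p q → q := p :- (p :- q)) refl (U * B x v) (B y v)) (+-congˡ (-‿cong (+-congˡ (-‿cong (sym (*-identityˡ _)))))) ⟩
        U * B x v - (U * B x v - 1# * B y v)         ≈⟨ +-congˡ (-‿cong (B-combine U 1# x y v)) ⟨
        U * B x v - B z′ v                           ≤⟨ +-mono-≤ ≤-refl (-‿mono-≤ (fraction x≥0 z′≥0 sz′ 0≤rX XrX≈1 v)) ⟩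
        U * B x v - sum z′ * (s * rX) * B x v        ≈⟨ solve 3 (λ U f x → U :* x :- f :* x := (U :- f) :* x) refl U (sum z′ * (s * rX)) (B x v) ⟩
        (U - sum z′ * (s * rX)) * B x v              ∎
      difference : (U - sum z′ * (s * rX)) - (L + sum z * (s * rX)) ≈ θ * (U - L)
      difference = begin-equality
        (U - sum z′ * (s * rX)) - (L + sum z * (s * rX))
          ≈⟨ +-cong (+-congˡ (-‿cong (*-congʳ (sum-combine U 1# x y)))) (-‿cong (+-congˡ (*-congʳ (sum-combine 1# L y x)))) ⟩
        (U - (U * sum x - 1# * sum y) * (s * rX)) - (L + (1# * sum y - L * sum x) * (s * rX))
          ≈⟨ solve 5 (λ U L X y a → (U :- (U :* X :- y) :* a) :- (L :+ (y :- L :* X) :* a) := (U :- L) :- X :* a :* (U :- L)) refl U L (sum x) (1# * sum y) (s * rX) ⟩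
        (U - L) - sum x * (s * rX) * (U - L)
          ≈⟨ +-congˡ (-‿cong (*-congʳ (solve-* 3 (λ X s r → (X ⊕ (s ⊕ r)) ⊜ ((X ⊕ r) ⊕ s)) refl (sum x) s rX))) ⟩
        (U - L) - (sum x * rX) * s * (U - L)
          ≈⟨ +-cong (sym (*-identityˡ _)) (-‿cong (*-congʳ (trans (*-congʳ XrX≈1) (*-identityˡ s)))) ⟩
        1# * (U - L) - s * (U - L)
          ≈⟨ solve 3 (λ o s d → o :* d :- s :* d := (o :- s) :* d) refl 1# s (U - L) ⟩
        θ * (U - L) ∎

    Q : Carrier
    Q = (c * b) * (c * b)

    -- After one application each vector is on I within a factor c b of a multiple of its former
    -- sum, so the extreme ratios of the two differ at most by the factor `Q` = (c b)².
    start-sandwich : ∀ {x y} → NonNeg x → NonNeg y → Supported x → Supported y → Pos (sum x) → Pos (sum y) →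
      ∃[ L ] (0# ≤ L × Sandwich L (Q * L) (B x) (B y))
    start-sandwich {x} {y} x≥0 y≥0 sx sy 0<X 0<Y = L , *-nonneg (sum-nonneg y≥0) (*-nonneg s-nonneg 0≤rX) , fraction x≥0 y≥0 sy 0≤rX XrX≈1 , upper
      where
      rX = proj₁ (invert (sum x) 0<X)
      0≤rX = proj₁ (proj₂ (invert (sum x) 0<X))
      XrX≈1 = proj₂ (proj₂ (invert (sum x) 0<X))
      L = sum y * (s * rX)
      0≤b = ≤-trans 0≤1 1≤b
      upper : ∀ v → B y v ≤ Q * L * B x v
      upper v = case (I? v)
       where
       case : Dec (I v) → B y v ≤ Q * L * B x v
       case (no ¬Iv) = ≤-reflexive (trans (B-supported y v ¬Iv) (sym (trans (*-congˡ (B-supported x v ¬Iv)) (zeroʳ _))))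
       case (yes Iv) = begin
        B y v                                         ≤⟨ bound y≥0 v ⟩
        b * sum y                                     ≈⟨ trans (*-congˡ (trans (sym (*-identityˡ _)) (*-congʳ (trans (sym (*-identityˡ 1#)) (*-cong (sym cbs≈1) (sym XrX≈1)))))) refl ⟩
        b * ((c * b * s) * (sum x * rX) * sum y)      ≈⟨ solve-* 6 (λ b c s X r Y → (b ⊕ ((((c ⊕ b) ⊕ s) ⊕ (X ⊕ r)) ⊕ Y)) ⊜ (((b ⊕ (c ⊕ b)) ⊕ (Y ⊕ (s ⊕ r))) ⊕ X)) refl b c s (sum x) rX (sum y) ⟩
        (b * (c * b) * L) * sum x                     ≤⟨ *-monoˡ-≤ (*-nonneg (*-nonneg 0≤b (*-nonneg (Pos⇒0≤ c-pos) 0≤b)) (*-nonneg (sum-nonneg y≥0) (*-nonneg s-nonneg 0≤rX))) (spread x≥0 sx Iv) ⟩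
        (b * (c * b) * L) * (c * B x v)               ≈⟨ solve-* 4 (λ b c L x → (((b ⊕ (c ⊕ b)) ⊕ L) ⊕ (c ⊕ x)) ⊜ ((((c ⊕ b) ⊕ (c ⊕ b)) ⊕ L) ⊕ x)) refl b c L (B x v) ⟩
        Q * L * B x v                                 ∎

    record Good (x : Vector) : Set where
      field
        nonneg    : NonNeg x
        supported : Supported x
        positive  : Pos (sum x)

    B-good : ∀ {x} → Good x → Good (B x)
    B-good {x} g = record
      { nonneg = B-nonneg nonneg ; supported = B-supported x ; positive = B-pos nonneg supported positive }
      where open Good g

    power-good : ∀ j {x} → Good x → Good (power j x)
    power-good zero    g = g
    power-good (suc j) g = B-good (power-good j g)

    power-sandwich : ∀ {x y} → Good x → Good y → ∀ j →
      ∃[ L ] ∃[ U ] (0# ≤ L × U - L ≤ θ ^ j * Q * L × Sandwich L U (power (suc j) x) (power (suc j) y))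
    power-sandwich {x} {y} gx gy j =
      let L , U , L₀≤L , U-L≈ , sw = go j
      in L , U , ≤-trans 0≤L₀ L₀≤L , ≤-trans (≤-reflexive U-L≈) (begin
        θ ^ j * (Q * L₀ - L₀)   ≤⟨ *-monoˡ-≤ (^-nonneg θ-nonneg j) (≤-diff 0≤L₀ (solve 2 (λ q l → l := q :- (q :- l)) refl (Q * L₀) L₀)) ⟩
        θ ^ j * (Q * L₀)        ≈⟨ *-assoc (θ ^ j) Q L₀ ⟨
        θ ^ j * Q * L₀          ≤⟨ *-monoˡ-≤ (*-nonneg (^-nonneg θ-nonneg j) (square-nonneg (c * b))) L₀≤L ⟩
        θ ^ j * Q * L           ∎) , sw
      where
      module X = Good gx
      module Y = Good gy
      start₀ = start-sandwich X.nonneg Y.nonneg X.supported Y.supported X.positive Y.positive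
      L₀ = proj₁ start₀
      0≤L₀ = proj₁ (proj₂ start₀)
      go : ∀ j → ∃[ L ] ∃[ U ] (L₀ ≤ L × U - L ≈ θ ^ j * (Q * L₀ - L₀) × Sandwich L U (power (suc j) x) (power (suc j) y))
      go zero = L₀ , Q * L₀ , ≤-refl , sym (*-identityˡ _) , proj₂ (proj₂ start₀)
      go (suc j) =
        let L , U , L₀≤L , U-L≈ , sw = go j
            g = power-good (suc j) gx
            L′ , U′ , L≤L′ , eq , sw′ = contract (Good.nonneg g) (Good.supported g) (Good.supported (power-good (suc j) gy)) (Good.positive g) sw
        in L′ , U′ , ≤-trans L₀≤L L≤L′ , trans eq (trans (*-congˡ U-L≈) (sym (*-assoc θ (θ ^ j) _))) , sw′

    -- Divided by sum x′ · sum y′, this bounds the distance between the normalised iterates in both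
    -- directions.
    cross : ∀ {x y} → Good x → Good y → ∀ j v → let x′ = power (suc j) x ; y′ = power (suc j) y in
      y′ v * sum x′ - x′ v * sum y′ ≤ θ ^ j * Q * (sum x′ * sum y′) × x′ v * sum y′ - y′ v * sum x′ ≤ θ ^ j * Q * (sum x′ * sum y′)
    cross {x} {y} gx gy j v =
        ≤-trans (+-mono-≤ yX≤ (-‿mono-≤ LxX≤)) gap
      , ≤-trans (+-mono-≤ xY≤ (-‿mono-≤ LX≤)) gap
      where
      x′ = power (suc j) x
      y′ = power (suc j) y
      module X = Good (power-good (suc j) gx)
      sw = power-sandwich gx gy j
      L = proj₁ sw
      U = proj₁ (proj₂ sw)
      0≤L = proj₁ (proj₂ (proj₂ sw))
      U-L≤ = proj₁ (proj₂ (proj₂ (proj₂ sw)))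
      lo = proj₁ (proj₂ (proj₂ (proj₂ (proj₂ sw))))
      hi = proj₂ (proj₂ (proj₂ (proj₂ (proj₂ sw))))
      LX≤Y : L * sum x′ ≤ sum y′
      LX≤Y = ≤-trans (≤-reflexive (*-distribˡ-sum L x′)) (sum-mono-≤ lo)
      Y≤UX : sum y′ ≤ U * sum x′
      Y≤UX = ≤-trans (sum-mono-≤ hi) (≤-reflexive (sym (*-distribˡ-sum U x′)))
      0≤X = sum-nonneg X.nonneg
      yX≤ : y′ v * sum x′ ≤ U * (x′ v * sum x′)
      yX≤ = ≤-trans (≤-reflexive (*-comm _ _)) (≤-trans (*-monoˡ-≤ 0≤X (hi v)) (≤-reflexive (solve 3 (λ X U x → X :* (U :* x) := U :* (x :* X)) refl (sum x′) U (x′ v))))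
      LX≤ : L * (x′ v * sum x′) ≤ y′ v * sum x′
      LX≤ = ≤-trans (≤-reflexive (solve 3 (λ X L x → L :* (x :* X) := X :* (L :* x)) refl (sum x′) L (x′ v))) (≤-trans (*-monoˡ-≤ 0≤X (lo v)) (≤-reflexive (*-comm _ _)))
      LxX≤ : L * (x′ v * sum x′) ≤ x′ v * sum y′
      LxX≤ = ≤-trans (≤-reflexive (solve 3 (λ X L x → L :* (x :* X) := x :* (L :* X)) refl (sum x′) L (x′ v))) (*-monoˡ-≤ (X.nonneg v) LX≤Y)
      xY≤ : x′ v * sum y′ ≤ U * (x′ v * sum x′)
      xY≤ = ≤-trans (*-monoˡ-≤ (X.nonneg v) Y≤UX) (≤-reflexive (solve 3 (λ X U x → x :* (U :* X) := U :* (x :* X)) refl (sum x′) U (x′ v)))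
      κ = θ ^ j * Q
      0≤κ = *-nonneg (^-nonneg θ-nonneg j) (square-nonneg (c * b))
      gap : U * (x′ v * sum x′) - L * (x′ v * sum x′) ≤ κ * (sum x′ * sum y′)
      gap = begin
        U * (x′ v * sum x′) - L * (x′ v * sum x′)   ≈⟨ solve 3 (λ U L z → U :* z :- L :* z := z :* (U :- L)) refl U L (x′ v * sum x′) ⟩
        (x′ v * sum x′) * (U - L)                   ≤⟨ *-monoˡ-≤ (*-nonneg (X.nonneg v) 0≤X) U-L≤ ⟩
        (x′ v * sum x′) * (κ * L)                   ≈⟨ solve-* 4 (λ x X k L → ((x ⊕ X) ⊕ (k ⊕ L)) ⊜ (k ⊕ (x ⊕ (L ⊕ X)))) refl (x′ v) (sum x′) κ L ⟩
        κ * (x′ v * (L * sum x′))                   ≤⟨ *-monoˡ-≤ 0≤κ (*-monoˡ-≤ (X.nonneg v) LX≤Y) ⟩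
        κ * (x′ v * sum y′)                         ≈⟨ *-congˡ (*-comm _ _) ⟩
        κ * (sum y′ * x′ v)                         ≤⟨ *-monoˡ-≤ 0≤κ (*-monoˡ-≤ (≤-trans (*-nonneg 0≤L 0≤X) LX≤Y) (term≤sum X.nonneg v)) ⟩
        κ * (sum y′ * sum x′)                       ≈⟨ *-congˡ (*-comm _ _) ⟩
        κ * (sum x′ * sum y′)                       ∎

-- Power iteration with a nonnegative integer matrix.

module Iteration (K : OrderedDomain) {n : ℕ} (w : Fin n → Fin n → ℕ) (I : Fin n → Set) (I? : ∀ v → Dec (I v)) (v₀ : Fin n) (I₀ : I v₀) where
  open OrderedDomainProperties K
  open CommutativeMonoidSolver *-commutativeMonoid using (_⊕_; _⊜_) renaming (solve to solve-*)
  open Contraction K I I? v₀ I₀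

  T : Vector → Vector
  T x v = sum (λ u → ι (w v u) * x u)

  iterate : ℕ → Vector → Vector
  iterate zero    x = x
  iterate (suc k) x = T (iterate k x)

  iterate-+ : ∀ k l x → iterate (k ℕ.+ l) x ≡ iterate k (iterate l x)
  iterate-+ zero    l x = ≡.refl
  iterate-+ (suc k) l x = ≡.cong T (iterate-+ k l x)

  T-nonneg : ∀ {x} → NonNeg x → NonNeg (T x)
  T-nonneg h v = sum-nonneg (λ u → *-nonneg (ι-nonneg (w v u)) (h u))

  iterate-nonneg : ∀ k {x} → NonNeg x → NonNeg (iterate k x)
  iterate-nonneg zero    h = h
  iterate-nonneg (suc k) h = T-nonneg (iterate-nonneg k h)

  T-cong : ∀ {x y} → (∀ v → x v ≈ y v) → ∀ v → T x v ≈ T y v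
  T-cong h v = sum-cong-≋ (λ u → *-congˡ (h u))

  T-combine : ∀ a b x y v → T (λ u → a * x u - b * y u) v ≈ a * T x v - b * T y v
  T-combine a b x y v = begin-equality
    sum (λ u → ι (w v u) * (a * x u - b * y u))
      ≈⟨ sum-cong-≋ (λ u → solve 5 (λ i a b x y → i :* (a :* x :- b :* y) := a :* (i :* x) :- b :* (i :* y)) refl (ι (w v u)) a b (x u) (y u)) ⟩
    sum (λ u → a * (ι (w v u) * x u) - b * (ι (w v u) * y u))
      ≈⟨ sum-sub (λ u → a * (ι (w v u) * x u)) (λ u → b * (ι (w v u) * y u)) ⟩
    sum (λ u → a * (ι (w v u) * x u)) - sum (λ u → b * (ι (w v u) * y u))
      ≈⟨ +-cong (*-distribˡ-sum a (λ u → ι (w v u) * x u)) (-‿cong (*-distribˡ-sum b (λ u → ι (w v u) * y u))) ⟨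
    a * T x v - b * T y v ∎

  iterate-combine : ∀ k a b x y v → iterate k (λ u → a * x u - b * y u) v ≈ a * iterate k x v - b * iterate k y v
  iterate-combine zero    a b x y v = refl
  iterate-combine (suc k) a b x y v = trans (T-cong (iterate-combine k a b x y) v) (T-combine a b (iterate k x) (iterate k y) v)

  iterate-bounded : 1 ℕ.≤ n → ∀ W → 1 ℕ.≤ W → (∀ v u → w v u ℕ.≤ W) → ∀ k →
    ∃[ b ] (1# ≤ b × (∀ {x} → NonNeg x → ∀ v → iterate k x v ≤ b * sum x))
  iterate-bounded 1≤n W 1≤W w≤W zero = 1# , ≤-refl , λ h v → ≤-trans (term≤sum h v) (≤-reflexive (sym (*-identityˡ _)))
  iterate-bounded 1≤n W 1≤W w≤W (suc k) = let b , 1≤b , hb = iterate-bounded 1≤n W 1≤W w≤W k in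
    ι W * (ι n * b) , 1≤* (1≤ι 1≤W) (1≤* (1≤ι 1≤n) 1≤b) , λ {x} h v → begin
      T (iterate k x) v                            ≤⟨ sum-mono-≤ (λ u → ≤-trans (≤-reflexive (*-comm _ _)) (≤-trans (*-monoˡ-≤ (iterate-nonneg k h u) (ι-mono (w≤W v u))) (≤-reflexive (*-comm _ _)))) ⟩
      sum (λ u → ι W * iterate k x u)              ≈⟨ *-distribˡ-sum (ι W) (iterate k x) ⟨
      ι W * sum (iterate k x)                      ≤⟨ *-monoˡ-≤ (ι-nonneg W) (sum≤ (hb h)) ⟩
      ι W * (ι n * (b * sum x))                    ≈⟨ solve-* 4 (λ W n b X → (W ⊕ (n ⊕ (b ⊕ X))) ⊜ ((W ⊕ (n ⊕ b)) ⊕ X)) refl (ι W) (ι n) b (sum x) ⟩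
      ι W * (ι n * b) * sum x                      ∎
    where
    1≤ι : ∀ {a} → 1 ℕ.≤ a → 1# ≤ ι a
    1≤ι 1≤a = ≤-trans (≤-reflexive (sym (+-identityʳ 1#))) (ι-mono 1≤a)

  module _ (off : ∀ v u → ¬ I v → w v u ≡ 0) where

    T-supported : ∀ x → Supported (T x)
    T-supported x v ¬Iv = sum-zero (λ u → trans (*-congʳ (reflexive (≡.cong ι (off v u ¬Iv)))) (ι0* (x u)))

    mixingOperator : ∀ M → (∀ {x} → NonNeg x → ∀ {u v} → I u → I v → x u ≤ iterate (suc M) x v) →
      1# ≤ ι n → ∀ b → 1# ≤ b → (∀ {x} → NonNeg x → ∀ v → iterate (suc M) x v ≤ b * sum x) →
      ∀ s → 0# ≤ s → ι n * b * s ≈ 1# → MixingOperator (iterate (suc M)) (ι n) b s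
    mixingOperator M mixing 1≤n b 1≤b bound s 0≤s eq = record
      { B-nonneg = iterate-nonneg (suc M)
      ; B-supported = λ x → T-supported (iterate M x)
      ; B-combine = iterate-combine (suc M)
      ; spread = λ {x} x≥0 sx {v} Iv → sum≤ (λ u → entry x≥0 sx Iv u (I? u))
      ; bound = bound
      ; 1≤c = 1≤n
      ; 1≤b = 1≤b
      ; s-nonneg = 0≤s
      ; cbs≈1 = eq
      }
      where
      entry : ∀ {x} → NonNeg x → Supported x → ∀ {v} → I v → ∀ u → Dec (I u) → x u ≤ iterate (suc M) x v
      entry x≥0 sx Iv u (yes Iu) = mixing x≥0 Iu Iv
      entry x≥0 sx {v} Iv u (no ¬Iu) = ≤-trans (≤-reflexive (sx u ¬Iu)) (iterate-nonneg (suc M) x≥0 v)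

    indicator : ∀ {v} → Dec (I v) → Carrier
    indicator (yes _) = 1#
    indicator (no _)  = 0#

    ones : Vector
    ones v = indicator (I? v)

    orbit : ℕ → Vector
    orbit m = iterate m ones

    orbit-nonneg : ∀ m → NonNeg (orbit m)
    orbit-nonneg m = iterate-nonneg m λ v → nonneg (I? v)
      where
      nonneg : ∀ {v} (d : Dec (I v)) → 0# ≤ indicator d
      nonneg (yes _) = 0≤1
      nonneg (no _)  = ≤-refl

    orbit-supported : ∀ m → Supported (orbit m)
    orbit-supported zero v ¬Iv = zeros (I? v)
      where
      zeros : (d : Dec (I v)) → indicator d ≈ 0#
      zeros (yes Iv) = contradiction Iv ¬Iv
      zeros (no _)   = refl
    orbit-supported (suc m) = T-supported (orbit m)

    entry≤T : ∀ {x} → NonNeg x → ∀ {u v} → 1 ℕ.≤ w v u → x u ≤ T x v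
    entry≤T {x} x≥0 {u} {v} 1≤w = begin
      x u                 ≈⟨ ι1* (x u) ⟨
      ι 1 * x u           ≈⟨ *-comm _ _ ⟩
      x u * ι 1           ≤⟨ *-monoˡ-≤ (x≥0 u) (ι-mono 1≤w) ⟩
      x u * ι (w v u)     ≈⟨ *-comm _ _ ⟩
      ι (w v u) * x u     ≤⟨ term≤sum (λ u → *-nonneg (ι-nonneg (w v u)) (x≥0 u)) u ⟩
      T x v               ∎

    -- The self-loop keeps the entry at v₀ from shrinking, so every vector of the orbit has a
    -- positive sum and can be normalised.
    orbit-≥1 : (∀ v → I v → 1 ℕ.≤ w v v) → ∀ m → 1# ≤ orbit m v₀
    orbit-≥1 loop zero = one (I? v₀)
      where
      one : (d : Dec (I v₀)) → 1# ≤ indicator d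
      one (yes _)  = ≤-refl
      one (no ¬I₀) = contradiction I₀ ¬I₀
    orbit-≥1 loop (suc m) = ≤-trans (orbit-≥1 loop m) (entry≤T (orbit-nonneg m) (loop v₀ I₀))

    module Normalised (loop : ∀ v → I v → 1 ℕ.≤ w v v) (M : ℕ) (c b s : Carrier) (op : MixingOperator (iterate (suc M)) c b s)
      (c≈n : c ≈ ι n)
      (invert : ∀ a → Pos a → ∃[ r ] (0# ≤ r × a * r ≈ 1#)) (1-pos : Pos 1#) where
      open Contracting (iterate (suc M)) c b s op invert 1-pos public
      open MixingOperator op

      good : ∀ m → Good (orbit m)
      good m = record
        { nonneg = orbit-nonneg m
        ; supported = orbit-supported m
        ; positive = Pos-≤ 1-pos (≤-trans (orbit-≥1 loop m) (term≤sum (orbit-nonneg m) v₀))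
        }

      scale : ∀ m → ∃[ r ] (0# ≤ r × sum (orbit m) * r ≈ 1#)
      scale m = invert (sum (orbit m)) (Good.positive (good m))

      f : ℕ → Vector
      f m v = orbit m v * proj₁ (scale m)

      power-orbit : ∀ j a → power j (orbit a) ≡ orbit (j ℕ.* suc M ℕ.+ a)
      power-orbit zero    a = ≡.refl
      power-orbit (suc j) a = ≡.trans (≡.cong (iterate (suc M)) (power-orbit j a))
        (≡.trans (≡.sym (iterate-+ (suc M) (j ℕ.* suc M ℕ.+ a) ones)) (≡.cong orbit (≡.sym (ℕ.+-assoc (suc M) (j ℕ.* suc M) a))))

      rescale : ∀ {x y X Y r r′ κ} → 0# ≤ r → 0# ≤ r′ → X * r ≈ 1# → Y * r′ ≈ 1# →
        y * X - x * Y ≤ κ * (X * Y) → y * r′ - x * r ≤ κ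
      rescale {x} {y} {X} {Y} {r} {r′} {κ} 0≤r 0≤r′ Xr Yr′ h = begin
        y * r′ - x * r                            ≈⟨ +-cong (trans (sym (*-identityˡ _)) (*-congʳ (sym Xr))) (-‿cong (trans (sym (*-identityˡ _)) (*-congʳ (sym Yr′)))) ⟩
        X * r * (y * r′) - Y * r′ * (x * r)       ≈⟨ +-cong (solve-* 4 (λ X r y r′ → ((X ⊕ r) ⊕ (y ⊕ r′)) ⊜ ((r ⊕ r′) ⊕ (y ⊕ X))) refl X r y r′)
                                                       (-‿cong (solve-* 4 (λ Y r′ x r → ((Y ⊕ r′) ⊕ (x ⊕ r)) ⊜ ((r ⊕ r′) ⊕ (x ⊕ Y))) refl Y r′ x r)) ⟩
        r * r′ * (y * X) - r * r′ * (x * Y)       ≈⟨ solve 3 (λ a p q → a :* p :- a :* q := a :* (p :- q)) refl (r * r′) (y * X) (x * Y) ⟩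
        r * r′ * (y * X - x * Y)                  ≤⟨ *-monoˡ-≤ (*-nonneg 0≤r 0≤r′) h ⟩
        r * r′ * (κ * (X * Y))                    ≈⟨ solve-* 5 (λ r r′ κ X Y → ((r ⊕ r′) ⊕ (κ ⊕ (X ⊕ Y))) ⊜ (((X ⊕ r) ⊕ (Y ⊕ r′)) ⊕ κ)) refl r r′ κ X Y ⟩
        X * r * (Y * r′) * κ                      ≈⟨ trans (*-congʳ (trans (*-cong Xr Yr′) (*-identityˡ 1#))) (*-identityˡ κ) ⟩
        κ                                         ∎

      -- Both indices are the same power of the mixing operator applied to two points of the orbit,
      -- and `cross` admits any two starting vectors. The bound is uniform in a and a′ and thus a
      -- Cauchy modulus.
      near : ∀ j a a′ v → f (suc j ℕ.* suc M ℕ.+ a′) v - f (suc j ℕ.* suc M ℕ.+ a) v ≤ θ ^ j * Q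
      near j a a′ v = rescale
        (proj₁ (proj₂ (scale m))) (proj₁ (proj₂ (scale m′))) (proj₂ (proj₂ (scale m))) (proj₂ (proj₂ (scale m′)))
        (≡.subst₂ (λ x y → y v * sum x - x v * sum y ≤ θ ^ j * Q * (sum x * sum y)) (power-orbit (suc j) a) (power-orbit (suc j) a′)
          (proj₁ (cross (good a) (good a′) j v)))
        where
        m = suc j ℕ.* suc M ℕ.+ a
        m′ = suc j ℕ.* suc M ℕ.+ a′

      f-supported : ∀ m → Supported (f m)
      f-supported m v ¬Iv = trans (*-congʳ (orbit-supported m v ¬Iv)) (zeroˡ _)

      -- A mixing step multiplies the sum by at most c b, and the old sum is at most c times any new
      -- entry on I. The bound does not depend on m, so it survives in the limit and permits
      -- reciprocals.
      lower : ∀ m {v} → I v → 1# ≤ c * b * c * f (suc M ℕ.+ m) v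
      lower m {v} Iv = begin
        1#                                       ≈⟨ proj₂ (proj₂ (scale m′)) ⟨
        sum (orbit m′) * r                       ≈⟨ *-comm _ _ ⟩
        r * sum (orbit m′)                       ≈⟨ *-congˡ (reflexive (≡.cong sum (iterate-+ (suc M) m ones))) ⟩
        r * sum (iterate (suc M) (orbit m))      ≤⟨ *-monoˡ-≤ 0≤r (≤-trans (sum≤ (bound (orbit-nonneg m))) (≤-reflexive (*-congʳ (sym c≈n)))) ⟩
        r * (c * (b * sum (orbit m)))            ≈⟨ solve-* 4 (λ r c b X → (r ⊕ (c ⊕ (b ⊕ X))) ⊜ (((r ⊕ c) ⊕ b) ⊕ X)) refl r c b (sum (orbit m)) ⟩
        r * c * b * sum (orbit m)                ≤⟨ *-monoˡ-≤ (*-nonneg (*-nonneg 0≤r (Pos⇒0≤ c-pos)) (≤-trans 0≤1 1≤b)) (spread (orbit-nonneg m) (orbit-supported m) Iv) ⟩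
        r * c * b * (c * iterate (suc M) (orbit m) v)   ≈⟨ *-congˡ (*-congˡ (reflexive (≡.cong (λ x → x v) (≡.sym (iterate-+ (suc M) m ones))))) ⟩
        r * c * b * (c * orbit m′ v)             ≈⟨ solve-* 4 (λ r c b x → (((r ⊕ c) ⊕ b) ⊕ (c ⊕ x)) ⊜ (((c ⊕ b) ⊕ c) ⊕ (x ⊕ r))) refl r c b (orbit m′ v) ⟩
        c * b * c * f m′ v                       ∎
        where
        m′ = suc M ℕ.+ m
        r = proj₁ (scale m′)
        0≤r = proj₁ (proj₂ (scale m′))

      T-scale : ∀ m v → T (f m) v ≈ orbit (suc m) v * proj₁ (scale m)
      T-scale m v = trans (sum-cong-≋ (λ u → sym (*-assoc (ι (w v u)) (orbit m u) (proj₁ (scale m))))) (sym (*-distribʳ-sum (proj₁ (scale m)) (λ u → ι (w v u) * orbit m u)))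

      -- The eigenvalue equation before the limit: the growth of the sum stands for the eigenvalue,
      -- and the index on the right is one ahead.
      growth : ∀ m v → T (f m) v ≈ sum (T (f m)) * f (suc m) v
      growth m v = begin-equality
        T (f m) v                                                    ≈⟨ T-scale m v ⟩
        x v * r                                                      ≈⟨ trans (sym (*-identityˡ _)) (*-congʳ (sym (proj₂ (proj₂ (scale (suc m)))))) ⟩
        sum x * r′ * (x v * r)                                       ≈⟨ solve-* 4 (λ X r′ x r → ((X ⊕ r′) ⊕ (x ⊕ r)) ⊜ ((X ⊕ r) ⊕ (x ⊕ r′))) refl (sum x) r′ (x v) r ⟩
        sum x * r * (x v * r′)                                       ≈⟨ *-congʳ (trans (*-distribʳ-sum r x) (sum-cong-≋ (λ u → sym (T-scale m u)))) ⟩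
        sum (T (f m)) * f (suc m) v                                  ∎
        where
        x = orbit (suc m)
        r = proj₁ (scale m)
        r′ = proj₁ (scale (suc m))

-- Rational estimates.

module ℚ-Lemmas where
  open ℚSolver.+-*-Solver

  -- Reduces an inequality to a known one together with a ring identity between the two differences,
  -- which the solver can prove.
  <-via : ∀ {a b c d} → a ℚ.< b → b ℚ.- a ≡ d ℚ.- c → c ℚ.< d
  <-via {a} {b} {c} {d} a<b eq = ≡.subst₂ ℚ._<_ (ℚ.+-identityˡ c) (back c d)
    (ℚ.+-monoˡ-< c (≡.subst (0ℚ ℚ.<_) eq (≡.subst (ℚ._< b ℚ.- a) (ℚ.+-inverseʳ a) (ℚ.+-monoˡ-< (ℚ.- a) a<b))))
    where
    back : ∀ c d → d ℚ.- c ℚ.+ c ≡ d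
    back = solve 2 (λ c d → d :- c :+ c := d) ≡.refl

  ≤-via : ∀ {a b c d} → a ℚ.≤ b → b ℚ.- a ≡ d ℚ.- c → c ℚ.≤ d
  ≤-via {a} {b} {c} {d} a≤b eq = ≡.subst₂ ℚ._≤_ (ℚ.+-identityˡ c) (back c d)
    (ℚ.+-monoˡ-≤ c (≡.subst (0ℚ ℚ.≤_) eq (≡.subst (ℚ._≤ b ℚ.- a) (ℚ.+-inverseʳ a) (ℚ.+-monoˡ-≤ (ℚ.- a) a≤b))))
    where
    back : ∀ c d → d ℚ.- c ℚ.+ c ≡ d
    back = solve 2 (λ c d → d :- c :+ c := d) ≡.refl

  *-0< : ∀ {p q} → 0ℚ ℚ.< p → 0ℚ ℚ.< q → 0ℚ ℚ.< p ℚ.* q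
  *-0< {p} {q} 0<p 0<q = ℚ.positive⁻¹ (p ℚ.* q) {{ℚ.pos*pos⇒pos p {{ℚ.positive 0<p}} q {{ℚ.positive 0<q}}}}

  *-0≤ : ∀ {p q} → 0ℚ ℚ.≤ p → 0ℚ ℚ.≤ q → 0ℚ ℚ.≤ p ℚ.* q
  *-0≤ {p} {q} 0≤p 0≤q = ℚ.nonNegative⁻¹ (p ℚ.* q) {{ℚ.nonNeg*nonNeg⇒nonNeg p {{ℚ.nonNegative 0≤p}} q {{ℚ.nonNegative 0≤q}}}}

  *-mono-≤ : ∀ {a b c d} → 0ℚ ℚ.≤ a → 0ℚ ℚ.≤ d → a ℚ.≤ b → c ℚ.≤ d → a ℚ.* c ℚ.≤ b ℚ.* d
  *-mono-≤ {a} {b} {c} {d} 0≤a 0≤d a≤b c≤d = ℚ.≤-trans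
    (ℚ.*-monoˡ-≤-nonNeg a {{ℚ.nonNegative 0≤a}} c≤d) (ℚ.*-monoʳ-≤-nonNeg d {{ℚ.nonNegative 0≤d}} a≤b)

  reciprocal : ∀ p → 0ℚ ℚ.< p → ∃[ r ] (0ℚ ℚ.< r × p ℚ.* r ≡ 1ℚ)
  reciprocal p 0<p = (ℚ.1/ p) {{nz}} , ℚ.positive⁻¹ _ {{ℚ.1/pos⇒pos p {{pos}}}} , ℚ.*-inverseʳ p {{nz}}
    where
    pos = ℚ.positive 0<p
    nz = ℚ.pos⇒nonZero p {{pos}}

  fifth : ∀ ε → 0ℚ ℚ.< ε → ∃[ η ] (0ℚ ℚ.< η × η ℚ.+ η ℚ.+ η ℚ.+ η ℚ.+ η ≡ ε)
  fifth ε 0<ε = ε ℚ.* ⅕ , *-0< 0<ε (ℚ.positive⁻¹ ⅕) , five ε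
    where
    ⅕ = + 1 ℚ./ 5
    five : ∀ ε → ε ℚ.* ⅕ ℚ.+ ε ℚ.* ⅕ ℚ.+ ε ℚ.* ⅕ ℚ.+ ε ℚ.* ⅕ ℚ.+ ε ℚ.* ⅕ ≡ ε
    five = solve 1 (λ ε → ε :* con ⅕ :+ ε :* con ⅕ :+ ε :* con ⅕ :+ ε :* con ⅕ :+ ε :* con ⅕ := ε) ≡.refl

  p≤∣p∣ : ∀ p → p ℚ.≤ ∣ p ∣
  p≤∣p∣ p with ℚ.≤-total 0ℚ p
  ... | inj₁ 0≤p = ℚ.≤-reflexive (≡.sym (ℚ.0≤p⇒∣p∣≡p 0≤p))
  ... | inj₂ p≤0 = ℚ.≤-trans p≤0 (ℚ.0≤∣p∣ p)

  ∣-∣-comm : ∀ p q → ∣ p ℚ.- q ∣ ≡ ∣ q ℚ.- p ∣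
  ∣-∣-comm p q = ≡.trans (≡.cong ∣_∣ (solve 2 (λ p q → p :- q := :- (q :- p)) ≡.refl p q)) (ℚ.∣-p∣≡∣p∣ (q ℚ.- p))

  -‿<⇒∣∣< : ∀ p q {ε} → p ℚ.- q ℚ.< ε → q ℚ.- p ℚ.< ε → ∣ p ℚ.- q ∣ ℚ.< ε
  -‿<⇒∣∣< p q {ε} h₁ h₂ with ℚ.∣p∣≡p∨∣p∣≡-p (p ℚ.- q)
  ... | inj₁ eq = ≡.subst (ℚ._< ε) (≡.sym eq) h₁
  ... | inj₂ eq = ≡.subst (ℚ._< ε) (≡.sym (≡.trans eq (solve 2 (λ p q → :- (p :- q) := q :- p) ≡.refl p q))) h₂

Eventually : (ℕ → Set) → Set
Eventually P = ∃[ N ] (∀ n → N ℕ.≤ n → P n)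

_⟨∧⟩_ : ∀ {P Q} → Eventually P → Eventually Q → Eventually (λ n → P n × Q n)
(M , hM) ⟨∧⟩ (N , hN) = M ℕ.⊔ N , λ n le → hM n (ℕ.m⊔n≤o⇒m≤o M N le) , hN n (ℕ.m⊔n≤o⇒n≤o M N le)

eventually-map : ∀ {P Q : ℕ → Set} → (∀ n → P n → Q n) → Eventually P → Eventually Q
eventually-map f (N , h) = N , λ n le → f n (h n le)

eventually-here : ∀ {P} → Eventually P → ∃ P
eventually-here (N , h) = N , h N ℕ.≤-refl

-- The constructive reals as an ordered domain.

module ℝ-Lemmas where
  open Defs using (_≈_)
  open ℚ-Lemmas
  open ℚSolver.+-*-Solver

  pointwise : ∀ x y → (∀ n → seq x n ≡ seq y n) → x ≈ y
  pointwise x y eq ε 0<ε = 0 , λ n _ → ≡.subst (λ z → ∣ z ∣ ℚ.< ε) (≡.sym (≡.trans (≡.cong (ℚ._- seq y n) (eq n)) (ℚ.+-inverseʳ (seq y n)))) 0<ε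

  bounded : ∀ x → ∃[ B ] (0ℚ ℚ.< B × Eventually (λ n → ∣ seq x n ∣ ℚ.< B))
  bounded x =
    let N , h = cauchy x 1ℚ (ℚ.positive⁻¹ 1ℚ)
        B = ∣ seq x N ∣ ℚ.+ 1ℚ
    in B , ℚ.+-mono-≤-< (ℚ.0≤∣p∣ (seq x N)) (ℚ.positive⁻¹ 1ℚ) , N , λ n N≤n →
      ℚ.≤-<-trans
        (ℚ.≤-trans (ℚ.≤-reflexive (≡.cong ∣_∣ (solve 2 (λ a b → a := b :+ (a :- b)) ≡.refl (seq x n) (seq x N)))) (ℚ.∣p+q∣≤∣p∣+∣q∣ (seq x N) (seq x n ℚ.- seq x N)))
        (ℚ.+-monoʳ-< ∣ seq x N ∣ (h n N N≤n ℕ.≤-refl))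

  half : ∀ ε → 0ℚ ℚ.< ε → ∃[ η ] (0ℚ ℚ.< η × η ℚ.+ η ≡ ε)
  half ε 0<ε = ε ℚ.* ½ , *-0< 0<ε (ℚ.positive⁻¹ ½) , solve 1 (λ ε → ε :* con ½ :+ ε :* con ½ := ε) ≡.refl ε

  scale : ∀ B ε → 0ℚ ℚ.< B → 0ℚ ℚ.< ε → ∃[ η ] (0ℚ ℚ.< η × B ℚ.* η ≡ ε)
  scale B ε 0<B 0<ε =
    let r , 0<r , Br≡1 = reciprocal B 0<B
    in r ℚ.* ε , *-0< 0<r 0<ε , ≡.trans (≡.sym (ℚ.*-assoc B r ε)) (≡.trans (≡.cong (ℚ._* ε) Br≡1) (ℚ.*-identityˡ ε))

  ∣*∣< : ∀ p q B η → ∣ p ∣ ℚ.< B → 0ℚ ℚ.< B → ∣ q ∣ ℚ.< η → ∣ p ℚ.* q ∣ ℚ.< B ℚ.* η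
  ∣*∣< p q B η p<B 0<B q<η = ℚ.≤-<-trans
    (ℚ.≤-trans (ℚ.≤-reflexive (ℚ.∣p*q∣≡∣p∣*∣q∣ p q)) (ℚ.*-monoʳ-≤-nonNeg ∣ q ∣ {{ℚ.nonNegative (ℚ.0≤∣p∣ q)}} (ℚ.<⇒≤ p<B)))
    (ℚ.*-monoʳ-<-pos B {{ℚ.positive 0<B}} q<η)

  triangle : ∀ {p q r : ℚ} {η θ} → p ≡ q ℚ.+ r → ∣ q ∣ ℚ.< η → ∣ r ∣ ℚ.< θ → ∣ p ∣ ℚ.< η ℚ.+ θ
  triangle {q = q} {r} ≡.refl hq hr = ℚ.≤-<-trans (ℚ.∣p+q∣≤∣p∣+∣q∣ q r) (ℚ.+-mono-< hq hr)

  ≈-refl : ∀ {x} → x ≈ x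
  ≈-refl {x} = pointwise x x λ _ → ≡.refl

  ≈-sym : ∀ {x y} → x ≈ y → y ≈ x
  ≈-sym {x} {y} h ε 0<ε = eventually-map (λ n → ≡.subst (ℚ._< ε) (∣-∣-comm (seq x n) (seq y n))) (h ε 0<ε)

  ≈-trans : ∀ {x y z} → x ≈ y → y ≈ z → x ≈ z
  ≈-trans {x} {y} {z} h₁ h₂ ε 0<ε =
    let η , 0<η , 2η = half ε 0<ε
    in eventually-map (λ n (a , b) → ≡.subst (∣ seq x n ℚ.- seq z n ∣ ℚ.<_) 2η
         (triangle (solve 3 (λ x y z → x :- z := (x :- y) :+ (y :- z)) ≡.refl (seq x n) (seq y n) (seq z n)) a b)) (h₁ η 0<η ⟨∧⟩ h₂ η 0<η)

  +ᵣ-cong : ∀ {x x′ y y′} → x ≈ x′ → y ≈ y′ → x +ᵣ y ≈ x′ +ᵣ y′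
  +ᵣ-cong {x} {x′} {y} {y′} h₁ h₂ ε 0<ε =
    let η , 0<η , 2η = half ε 0<ε
    in eventually-map (λ n (a , b) → ≡.subst (∣ _ ∣ ℚ.<_) 2η
         (triangle (solve 4 (λ x x′ y y′ → x :+ y :- (x′ :+ y′) := (x :- x′) :+ (y :- y′)) ≡.refl (seq x n) (seq x′ n) (seq y n) (seq y′ n)) a b)) (h₁ η 0<η ⟨∧⟩ h₂ η 0<η)

  *ᵣ-cong : ∀ {x x′ y y′} → x ≈ x′ → y ≈ y′ → x *ᵣ y ≈ x′ *ᵣ y′
  *ᵣ-cong {x} {x′} {y} {y′} h₁ h₂ ε 0<ε =
    let η , 0<η , 2η = half ε 0<ε
        B , 0<B , hB = bounded x
        B′ , 0<B′ , hB′ = bounded y′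
        θ , 0<θ , Bθ = scale B η 0<B 0<η
        θ′ , 0<θ′ , B′θ′ = scale B′ η 0<B′ 0<η
    in eventually-map (λ n ((a , b) , c , d) → ≡.subst (∣ _ ∣ ℚ.<_) 2η
         (triangle (solve 4 (λ x x′ y y′ → x :* y :- x′ :* y′ := x :* (y :- y′) :+ y′ :* (x :- x′)) ≡.refl (seq x n) (seq x′ n) (seq y n) (seq y′ n))
           (≡.subst (∣ _ ∣ ℚ.<_) Bθ (∣*∣< (seq x n) (seq y n ℚ.- seq y′ n) B θ c 0<B b))
           (≡.subst (∣ _ ∣ ℚ.<_) B′θ′ (∣*∣< (seq y′ n) (seq x n ℚ.- seq x′ n) B′ θ′ d 0<B′ a))))
         ((h₁ θ′ 0<θ′ ⟨∧⟩ h₂ θ 0<θ) ⟨∧⟩ (hB ⟨∧⟩ hB′))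

  -1ᵣ : ℝ
  -1ᵣ = fromℚ (ℚ.- 1ℚ)

  -ᵣ_ : ℝ → ℝ
  -ᵣ x = -1ᵣ *ᵣ x

  1ᵣ : ℝ
  1ᵣ = fromℚ 1ℚ

  isCommutativeRing : IsCommutativeRing _≈_ _+ᵣ_ _*ᵣ_ -ᵣ_ 0ᵣ 1ᵣ
  isCommutativeRing = record
    { isRing = record
      { +-isAbelianGroup = record
        { isGroup = record
          { isMonoid = record
            { isSemigroup = record
              { isMagma = record
                { isEquivalence = record { refl = λ {x} → ≈-refl {x} ; sym = λ {x} {y} → ≈-sym {x} {y} ; trans = λ {x} {y} {z} → ≈-trans {x} {y} {z} }
                ; ∙-cong = λ {x} {x′} {y} {y′} → +ᵣ-cong {x} {x′} {y} {y′}
                }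
              ; assoc = λ x y z → pointwise (x +ᵣ y +ᵣ z) (x +ᵣ (y +ᵣ z)) λ n → ℚ.+-assoc (seq x n) (seq y n) (seq z n)
              }
            ; identity = (λ x → pointwise (0ᵣ +ᵣ x) x λ n → ℚ.+-identityˡ (seq x n)) , (λ x → pointwise (x +ᵣ 0ᵣ) x λ n → ℚ.+-identityʳ (seq x n))
            }
          ; inverse = (λ x → pointwise ((-ᵣ x) +ᵣ x) 0ᵣ λ n → solve 1 (λ x → con (ℚ.- 1ℚ) :* x :+ x := con 0ℚ) ≡.refl (seq x n))
                    , (λ x → pointwise (x +ᵣ (-ᵣ x)) 0ᵣ λ n → solve 1 (λ x → x :+ con (ℚ.- 1ℚ) :* x := con 0ℚ) ≡.refl (seq x n))
          ; ⁻¹-cong = λ {x} {y} → *ᵣ-cong { -1ᵣ} { -1ᵣ} {x} {y} (≈-refl { -1ᵣ})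
          }
        ; comm = λ x y → pointwise (x +ᵣ y) (y +ᵣ x) λ n → ℚ.+-comm (seq x n) (seq y n)
        }
      ; *-cong = λ {x} {x′} {y} {y′} → *ᵣ-cong {x} {x′} {y} {y′}
      ; *-assoc = λ x y z → pointwise (x *ᵣ y *ᵣ z) (x *ᵣ (y *ᵣ z)) λ n → ℚ.*-assoc (seq x n) (seq y n) (seq z n)
      ; *-identity = (λ x → pointwise (1ᵣ *ᵣ x) x λ n → ℚ.*-identityˡ (seq x n)) , (λ x → pointwise (x *ᵣ 1ᵣ) x λ n → ℚ.*-identityʳ (seq x n))
      ; distrib = (λ x y z → pointwise (x *ᵣ (y +ᵣ z)) (x *ᵣ y +ᵣ x *ᵣ z) λ n → ℚ.*-distribˡ-+ (seq x n) (seq y n) (seq z n)) , (λ x y z → pointwise ((y +ᵣ z) *ᵣ x) (y *ᵣ x +ᵣ z *ᵣ x) λ n → ℚ.*-distribʳ-+ (seq x n) (seq y n) (seq z n))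
      }
    ; *-comm = λ x y → pointwise (x *ᵣ y) (y *ᵣ x) λ n → ℚ.*-comm (seq x n) (seq y n)
    }

  ≤ᵣ-reflexive : ∀ {x y} → x ≈ y → x ≤ᵣ y
  ≤ᵣ-reflexive {x} {y} h ε 0<ε = eventually-map (λ n lt → <-via (ℚ.≤-<-trans (p≤∣p∣ _) lt)
    (solve 3 (λ x y ε → ε :- (x :- y) := (y :+ ε) :- x) ≡.refl (seq x n) (seq y n) ε)) (h ε 0<ε)

  ≤ᵣ-trans : ∀ {x y z} → x ≤ᵣ y → y ≤ᵣ z → x ≤ᵣ z
  ≤ᵣ-trans {x} {y} {z} h₁ h₂ ε 0<ε =
    let η , 0<η , 2η = half ε 0<ε
    in eventually-map (λ n (a , b) → <-via (ℚ.+-mono-< a b)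
         (≡.trans (solve 4 (λ x y z η → (y :+ η :+ (z :+ η)) :- (x :+ y) := (z :+ (η :+ η)) :- x) ≡.refl (seq x n) (seq y n) (seq z n) η)
           (≡.cong (λ ε → seq z n ℚ.+ ε ℚ.- seq x n) 2η))) (h₁ η 0<η ⟨∧⟩ h₂ η 0<η)

  ≤ᵣ-antisym : ∀ {x y} → x ≤ᵣ y → y ≤ᵣ x → x ≈ y
  ≤ᵣ-antisym {x} {y} h₁ h₂ ε 0<ε = eventually-map (λ n (a , b) → -‿<⇒∣∣< (seq x n) (seq y n)
      (<-via a (solve 3 (λ x y ε → (y :+ ε) :- x := ε :- (x :- y)) ≡.refl (seq x n) (seq y n) ε))
      (<-via b (solve 3 (λ x y ε → (x :+ ε) :- y := ε :- (y :- x)) ≡.refl (seq x n) (seq y n) ε)))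
    (h₁ ε 0<ε ⟨∧⟩ h₂ ε 0<ε)

  +ᵣ-monoˡ-≤ : ∀ z {x y} → x ≤ᵣ y → x +ᵣ z ≤ᵣ y +ᵣ z
  +ᵣ-monoˡ-≤ z {x} {y} h ε 0<ε = eventually-map (λ n a → <-via a
    (solve 4 (λ x y z ε → (y :+ ε) :- x := (y :+ z :+ ε) :- (x :+ z)) ≡.refl (seq x n) (seq y n) (seq z n) ε)) (h ε 0<ε)

  _#>_ : ℝ → ℝ → Set
  x #> y = ∃[ η ] (0ℚ ℚ.< η × Eventually (λ n → seq y n ℚ.+ η ℚ.< seq x n))

  -- Both sequences are inspected at one index N with tolerance η = ε / 5. Passing from N to n costs
  -- at most 2η in all, so testing x < y + 3η at N yields either x < y + 5η from N on, or a lasting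
  -- gap of η.
  compare : ∀ x y ε → 0ℚ ℚ.< ε → Eventually (λ n → seq x n ℚ.< seq y n ℚ.+ ε) ⊎ x #> y
  compare x y ε 0<ε = helper (seq x N ℚ.<? seq y N ℚ.+ (η ℚ.+ η ℚ.+ η))
    where
    fth = fifth ε 0<ε
    η = proj₁ fth
    0<η = proj₁ (proj₂ fth)
    5η = proj₂ (proj₂ fth)
    cx = cauchy x η 0<η
    cy = cauchy y η 0<η
    N = proj₁ cx ℕ.⊔ proj₁ cy
    x-near : ∀ n → N ℕ.≤ n → ∣ seq x n ℚ.- seq x N ∣ ℚ.< η
    x-near n le = proj₂ cx n N (ℕ.m⊔n≤o⇒m≤o (proj₁ cx) _ le) (ℕ.m≤m⊔n (proj₁ cx) (proj₁ cy))
    y-near : ∀ n → N ℕ.≤ n → ∣ seq y n ℚ.- seq y N ∣ ℚ.< η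
    y-near n le = proj₂ cy n N (ℕ.m⊔n≤o⇒n≤o (proj₁ cx) _ le) (ℕ.m≤n⊔m (proj₁ cx) (proj₁ cy))
    helper : Dec (seq x N ℚ.< seq y N ℚ.+ (η ℚ.+ η ℚ.+ η)) → Eventually (λ n → seq x n ℚ.< seq y n ℚ.+ ε) ⊎ x #> y
    helper (yes lt) = inj₁ (N , λ n le → <-via
      (ℚ.+-mono-< (ℚ.+-mono-< (ℚ.≤-<-trans (p≤∣p∣ _) (x-near n le)) (ℚ.≤-<-trans (p≤∣p∣ _) (≡.subst (ℚ._< η) (∣-∣-comm (seq y n) (seq y N)) (y-near n le)))) lt)
      (≡.trans (solve 5 (λ x x₀ y y₀ η → (η :+ η :+ (y₀ :+ (η :+ η :+ η))) :- ((x :- x₀) :+ (y₀ :- y) :+ x₀) := (y :+ (η :+ η :+ η :+ η :+ η)) :- x) ≡.refl (seq x n) (seq x N) (seq y n) (seq y N) η)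
        (≡.cong (λ ε → seq y n ℚ.+ ε ℚ.- seq x n) 5η)))
    helper (no ¬lt) = inj₂ (η , 0<η , N , λ n le → <-via
      (ℚ.+-mono-<-≤ (ℚ.+-mono-< (ℚ.≤-<-trans (p≤∣p∣ _) (y-near n le)) (ℚ.≤-<-trans (p≤∣p∣ _) (≡.subst (ℚ._< η) (∣-∣-comm (seq x n) (seq x N)) (x-near n le)))) (ℚ.≮⇒≥ ¬lt))
      (solve 5 (λ x x₀ y y₀ η → (η :+ η :+ x₀) :- ((y :- y₀) :+ (x₀ :- x) :+ (y₀ :+ (η :+ η :+ η))) := x :- (y :+ η)) ≡.refl (seq x n) (seq x N) (seq y n) (seq y N) η))

  #>⇒≰ : ∀ {x y} → x #> y → ¬ (x ≤ᵣ y)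
  #>⇒≰ {x} {y} (η , 0<η , ev) x≤y =
    let _ , a , b = eventually-here (ev ⟨∧⟩ x≤y η 0<η) in ℚ.<-asym a b

  ≰⇒¬¬#> : ∀ {x y} → ¬ (x ≤ᵣ y) → ¬ ¬ (x #> y)
  ≰⇒¬¬#> {x} {y} x≰y ¬# = x≰y λ ε 0<ε → from (compare x y ε 0<ε)
    where
    from : ∀ {ε} → Eventually (λ n → seq x n ℚ.< seq y n ℚ.+ ε) ⊎ x #> y → Eventually (λ n → seq x n ℚ.< seq y n ℚ.+ ε)
    from (inj₁ ev) = ev
    from (inj₂ gt) = contradiction gt ¬#

  -- For each ε the decision made by `compare` suffices, because a gap would refute x ≤ y. This is
  -- what admits classical case distinctions in proofs of `≤`.
  ≤ᵣ-stable : ∀ {x y} → ¬ ¬ (x ≤ᵣ y) → x ≤ᵣ y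
  ≤ᵣ-stable {x} {y} ¬¬le ε 0<ε with compare x y ε 0<ε
  ... | inj₁ ev = ev
  ... | inj₂ gt = contradiction (#>⇒≰ {x} {y} gt) ¬¬le

  ≰ᵣ⇒≥ : ∀ {x y} → ¬ (x ≤ᵣ y) → y ≤ᵣ x
  ≰ᵣ⇒≥ {x} {y} x≰y = ≤ᵣ-stable {y} {x} λ y≰x → ≰⇒¬¬#> {x} {y} x≰y λ (η , 0<η , ev) →
    y≰x λ ε 0<ε → eventually-map (λ n lt → ℚ.<-trans (<-via (ℚ.+-mono-< lt 0<η) (solve 3 (λ x y η → (x :+ η) :- (y :+ η :+ con 0ℚ) := x :- y) ≡.refl (seq x n) (seq y n) η))
      (<-via 0<ε (solve 2 (λ x ε → ε :- con 0ℚ := (x :+ ε) :- x) ≡.refl (seq x n) ε))) ev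

  *ᵣ-pos : ∀ {x y} → ¬ (x ≤ᵣ 0ᵣ) → ¬ (y ≤ᵣ 0ᵣ) → ¬ (x *ᵣ y ≤ᵣ 0ᵣ)
  *ᵣ-pos {x} {y} hx hy xy≤0 = ≰⇒¬¬#> {x} {0ᵣ} hx λ (η , 0<η , evx) → ≰⇒¬¬#> {y} {0ᵣ} hy λ (θ , 0<θ , evy) →
    #>⇒≰ {x *ᵣ y} {0ᵣ} (η ℚ.* θ , *-0< 0<η 0<θ , eventually-map (λ n (a , b) →
      let a′ = ≡.subst (ℚ._< seq x n) (ℚ.+-identityˡ η) a
          b′ = ≡.subst (ℚ._< seq y n) (ℚ.+-identityˡ θ) b
      in ≡.subst (ℚ._< seq x n ℚ.* seq y n) (≡.sym (ℚ.+-identityˡ (η ℚ.* θ))) (ℚ.<-trans (ℚ.*-monoˡ-<-pos θ {{ℚ.positive 0<θ}} a′)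
           (ℚ.*-monoʳ-<-pos (seq x n) {{ℚ.positive (ℚ.<-trans 0<η a′)}} b′))) (evx ⟨∧⟩ evy)) xy≤0

  -- Approximations of nonnegative numbers may dip towards -η. With both factors below C the product
  -- still stays above -C η, and η is chosen with C η = ε.
  *ᵣ-nonneg : ∀ {x y} → 0ᵣ ≤ᵣ x → 0ᵣ ≤ᵣ y → 0ᵣ ≤ᵣ x *ᵣ y
  *ᵣ-nonneg {x} {y} hx hy ε 0<ε =
    let B , 0<B , hB = bounded x
        B′ , 0<B′ , hB′ = bounded y
        C = B ℚ.+ B′
        0<C = ≡.subst (ℚ._< C) (ℚ.+-identityˡ 0ℚ) (ℚ.+-mono-< 0<B 0<B′)
        η , 0<η , Cη = scale C ε 0<C 0<ε
    in eventually-map (λ n ((a , b) , c , d) → ≡.subst (λ ε → 0ℚ ℚ.< seq x n ℚ.* seq y n ℚ.+ ε) Cη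
         (product (seq x n) (seq y n) C η 0<C 0<η a b
           (ℚ.<-trans (ℚ.≤-<-trans (p≤∣p∣ _) c) (<-via 0<B′ (solve 2 (λ B B′ → B′ :- con 0ℚ := (B :+ B′) :- B) ≡.refl B B′)))
           (ℚ.<-trans (ℚ.≤-<-trans (p≤∣p∣ _) d) (<-via 0<B (solve 2 (λ B B′ → B :- con 0ℚ := (B :+ B′) :- B′) ≡.refl B B′)))))
       ((hx η 0<η ⟨∧⟩ hy η 0<η) ⟨∧⟩ (hB ⟨∧⟩ hB′))
    where
    half-product : ∀ a b C η → 0ℚ ℚ.≤ a → 0ℚ ℚ.< b ℚ.+ η → a ℚ.< C → 0ℚ ℚ.< η → 0ℚ ℚ.< a ℚ.* b ℚ.+ C ℚ.* η
    half-product a b C η 0≤a 0<b+η a<C 0<η = ℚ.≤-<-trans (*-0≤ 0≤a (ℚ.<⇒≤ 0<b+η))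
      (<-via (ℚ.*-monoˡ-<-pos η {{ℚ.positive 0<η}} a<C) (solve 4 (λ a b C η → C :* η :- a :* η := (a :* b :+ C :* η) :- a :* (b :+ η)) ≡.refl a b C η))
    product : ∀ a b C η → 0ℚ ℚ.< C → 0ℚ ℚ.< η → 0ℚ ℚ.< a ℚ.+ η → 0ℚ ℚ.< b ℚ.+ η → a ℚ.< C → b ℚ.< C → 0ℚ ℚ.< a ℚ.* b ℚ.+ C ℚ.* η
    product a b C η 0<C 0<η ha hb a<C b<C with ℚ.≤-total 0ℚ a | ℚ.≤-total 0ℚ b
    ... | inj₁ 0≤a | _        = half-product a b C η 0≤a hb a<C 0<η
    ... | inj₂ _   | inj₁ 0≤b = ≡.subst (λ z → 0ℚ ℚ.< z ℚ.+ C ℚ.* η) (ℚ.*-comm b a) (half-product b a C η 0≤b ha b<C 0<η)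
    ... | inj₂ a≤0 | inj₂ b≤0 = ≡.subst (ℚ._< a ℚ.* b ℚ.+ C ℚ.* η) (ℚ.+-identityˡ 0ℚ) (ℚ.+-mono-≤-<
          (ℚ.nonNegative⁻¹ (a ℚ.* b) {{ℚ.nonPos*nonPos⇒nonPos a {{ℚ.nonPositive a≤0}} b {{ℚ.nonPositive b≤0}}}}) (*-0< 0<C 0<η))

ℝ-orderedDomain : OrderedDomain
ℝ-orderedDomain = record
  { commutativeRing = record { isCommutativeRing = isCommutativeRing }
  ; _≤_ = _≤ᵣ_
  ; ≤-reflexive = λ {x} {y} → ≤ᵣ-reflexive {x} {y}
  ; ≤-trans = λ {x} {y} {z} → ≤ᵣ-trans {x} {y} {z}
  ; ≤-antisym = λ {x} {y} → ≤ᵣ-antisym {x} {y}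
  ; +-monoˡ-≤ = λ z {x} {y} → +ᵣ-monoˡ-≤ z {x} {y}
  ; *-nonneg = λ {x} {y} → *ᵣ-nonneg {x} {y}
  ; *-pos = λ {x} {y} → *ᵣ-pos {x} {y}
  ; ≤-stable = λ {x} {y} → ≤ᵣ-stable {x} {y}
  ; ≰⇒≥ = λ {x} {y} → ≰ᵣ⇒≥ {x} {y}
  }
  where open ℝ-Lemmas

ℚ-orderedDomain : OrderedDomain
ℚ-orderedDomain = record
  { commutativeRing = ℚ.+-*-commutativeRing
  ; _≤_ = ℚ._≤_
  ; ≤-reflexive = ℚ.≤-reflexive
  ; ≤-trans = ℚ.≤-trans
  ; ≤-antisym = ℚ.≤-antisym
  ; +-monoˡ-≤ = ℚ.+-monoˡ-≤
  ; *-nonneg = *-0≤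
  ; *-pos = λ 0<x 0<y xy≤0 → ℚ.<-irrefl ≡.refl (ℚ.<-≤-trans (*-0< (ℚ.≰⇒> 0<x) (ℚ.≰⇒> 0<y)) xy≤0)
  ; ≤-stable = λ {x} {y} → decidable-stable (x ℚ.≤? y)
  ; ≰⇒≥ = λ x≰y → ℚ.<⇒≤ (ℚ.≰⇒> x≰y)
  }
  where open ℚ-Lemmas

module ℚ-Domain = OrderedDomainProperties ℚ-orderedDomain

toℚᵘ-ι : ∀ j → ℚ.toℚᵘ (ℚ-Domain.ι j) ℚᵘ.≃ ℚᵘ.mkℚᵘ (+ j) 0
toℚᵘ-ι zero    = ℚᵘ.≃-refl
toℚᵘ-ι (suc j) = ℚᵘ.≃-trans (ℚ.toℚᵘ-homo-+ 1ℚ (ℚ-Domain.ι j)) (ℚᵘ.≃-trans (ℚᵘ.+-congʳ (ℚ.toℚᵘ 1ℚ) (toℚᵘ-ι j))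
  (ℚᵘ.*≡* (≡.cong (ℤ._* + 1) (≡.cong (λ i → + 1 ℤ.+ i) (ℤ.*-identityʳ (+ j))))))

archimedean : ∀ p → ∃[ j ] (p ℚ.≤ ℚ-Domain.ι j)
archimedean p@(ℚ.mkℚ num den-1 _) = j , ℚ.toℚᵘ-cancel-≤ (ℚᵘ.≤-trans (ℚᵘ.*≤* (numerator≤ num)) (ℚᵘ.≤-reflexive (ℚᵘ.≃-sym (toℚᵘ-ι j))))
  where
  j = ℤ.∣ num ∣
  numerator≤ : ∀ i → i ℤ.* + 1 ℤ.≤ + ℤ.∣ i ∣ ℤ.* + suc (den-1)
  numerator≤ i = ℤ.≤-trans (ℤ.≤-reflexive (ℤ.*-identityʳ i)) (ℤ.≤-trans (i≤∣i∣ i)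
    (ℤ.≤-trans (ℤ.+≤+ (ℕ.m≤m*n ℤ.∣ i ∣ (suc (den-1)))) (ℤ.≤-reflexive (ℤ.pos-* ℤ.∣ i ∣ (suc (den-1))))))
    where
    i≤∣i∣ : ∀ i → i ℤ.≤ + ℤ.∣ i ∣
    i≤∣i∣ (+ a)        = ℤ.≤-refl
    i≤∣i∣ (ℤ.-[1+ a ]) = ℤ.-≤+

module _ where
  open ℚ-Lemmas
  open ℚ-Domain using (ι; _^_; ^-nonneg; ι-nonneg)
  open ℚSolver.+-*-Solver

  -- Induction by (1 - s)(1 + (j + 1) s) ≤ 1 + j s, the difference being (j + 1) s². The resulting
  -- decay of order 1 / j is enough for an explicit Cauchy modulus.
  bernoulli : ∀ {s} → 0ℚ ℚ.≤ s → 0ℚ ℚ.≤ 1ℚ ℚ.- s → ∀ j → (1ℚ ℚ.- s) ^ j ℚ.* (1ℚ ℚ.+ ι j ℚ.* s) ℚ.≤ 1ℚ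
  bernoulli {s} 0≤s 0≤θ zero = ℚ.≤-reflexive (solve 1 (λ s → con 1ℚ :* (con 1ℚ :+ con 0ℚ :* s) := con 1ℚ) ≡.refl s)
  bernoulli {s} 0≤s 0≤θ (suc j) = ℚ.≤-trans
    (≤-via (*-0≤ (*-0≤ (*-0≤ 0≤s 0≤s) (ℚ.≤-trans (ι-nonneg j) (≤-via (ℚ.nonNegative⁻¹ 1ℚ) (solve 1 (λ i → con 1ℚ :- con 0ℚ := con 1ℚ :+ i :- i) ≡.refl (ι j))))) (^-nonneg 0≤θ j))
      (solve 3 (λ s i t → s :* s :* (con 1ℚ :+ i) :* t :- con 0ℚ := t :* (con 1ℚ :+ i :* s) :- (con 1ℚ :- s) :* t :* (con 1ℚ :+ (con 1ℚ :+ i) :* s)) ≡.refl s (ι j) ((1ℚ ℚ.- s) ^ j)))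
    (bernoulli 0≤s 0≤θ j)

  geometric : ∀ {s Q} → 0ℚ ℚ.< s → 0ℚ ℚ.≤ 1ℚ ℚ.- s → ∀ {ε} → 0ℚ ℚ.< ε → ∃[ j ] ((1ℚ ℚ.- s) ^ j ℚ.* Q ℚ.< ε)
  geometric {s} {Q} 0<s 0≤θ {ε} 0<ε = j , ℚ.≤-<-trans bound (<-via 0<η (≡.trans (solve 1 (λ η → η :- con 0ℚ := η :+ η :- η) ≡.refl η) (≡.cong (ℚ._- η) 2η)))
    where
    h = ℝ-Lemmas.half ε 0<ε
    η = proj₁ h
    0<η = proj₁ (proj₂ h)
    2η = proj₂ (proj₂ h)
    rec = reciprocal (s ℚ.* η) (*-0< 0<s 0<η)
    r = proj₁ rec
    -- This makes j at least Q / (s η), so that θʲ Q ≤ θʲ j s η ≤ η by `bernoulli`.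
    arch = archimedean (Q ℚ.* r)
    j = proj₁ arch
    θʲ = (1ℚ ℚ.- s) ^ j
    0≤θʲ = ^-nonneg 0≤θ j
    Q≤ : Q ℚ.≤ ι j ℚ.* (s ℚ.* η)
    Q≤ = ≡.subst (ℚ._≤ ι j ℚ.* (s ℚ.* η)) (≡.trans (solve 3 (λ Q r y → Q :* r :* y := Q :* (y :* r)) ≡.refl Q r (s ℚ.* η)) (≡.trans (≡.cong (Q ℚ.*_) (proj₂ (proj₂ rec))) (ℚ.*-identityʳ Q)))
      (ℚ.*-monoʳ-≤-nonNeg (s ℚ.* η) {{ℚ.nonNegative (ℚ.<⇒≤ (*-0< 0<s 0<η))}} (proj₂ arch))
    bound : θʲ ℚ.* Q ℚ.≤ η
    bound = ℚ.≤-trans (ℚ.*-monoˡ-≤-nonNeg θʲ {{ℚ.nonNegative 0≤θʲ}} Q≤)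
      (≤-via (ℚ.+-mono-≤ (*-0≤ 0≤θʲ (ℚ.<⇒≤ 0<η)) (ℚ.*-monoˡ-≤-nonNeg η {{ℚ.nonNegative (ℚ.<⇒≤ 0<η)}} (bernoulli (ℚ.<⇒≤ 0<s) 0≤θ j)))
        (solve 4 (λ t η i s → (t :* η :+ η :* con 1ℚ) :- (con 0ℚ :+ η :* (t :* (con 1ℚ :+ i :* s))) := η :- t :* (i :* (s :* η))) ≡.refl θʲ η (ι j) s))

module RealLimit where
  open ℚ-Lemmas
  open ℝ-Lemmas using (scale; ∣*∣<; 1ᵣ)
  open Defs using (_≈_)
  open ℚSolver.+-*-Solver

  -- Reciprocals are taken term by term. The uniform lower bound δ makes them Lipschitz with
  -- constant 1 / δ², so the sequence of reciprocals is again Cauchy.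
  inverseᵣ : ∀ x δ → 0ℚ ℚ.< δ → (∀ m → δ ℚ.≤ seq x m) → ∃[ y ] (x *ᵣ y ≈ 1ᵣ)
  inverseᵣ x δ 0<δ δ≤x = mkℝ y cauchy-y , ℝ-Lemmas.pointwise (x *ᵣ mkℝ y cauchy-y) 1ᵣ inv
    where
    rec : ∀ m → ∃[ r ] (0ℚ ℚ.< r × seq x m ℚ.* r ≡ 1ℚ)
    rec m = reciprocal (seq x m) (ℚ.<-≤-trans 0<δ (δ≤x m))
    y : ℕ → ℚ
    y m = proj₁ (rec m)
    0<y : ∀ m → 0ℚ ℚ.< y m
    0<y m = proj₁ (proj₂ (rec m))
    inv : ∀ m → seq x m ℚ.* y m ≡ 1ℚ
    inv m = proj₂ (proj₂ (rec m))
    δ⁻ = proj₁ (reciprocal δ 0<δ)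
    0<δ⁻ = proj₁ (proj₂ (reciprocal δ 0<δ))
    δδ⁻ = proj₂ (proj₂ (reciprocal δ 0<δ))
    y≤δ⁻ : ∀ m → y m ℚ.≤ δ⁻
    y≤δ⁻ m = ≡.subst₂ ℚ._≤_
      (≡.trans (solve 3 (λ d e y → d :* (e :* y) := (d :* e) :* y) ≡.refl δ δ⁻ (y m)) (≡.trans (≡.cong (ℚ._* y m) δδ⁻) (ℚ.*-identityˡ (y m))))
      (≡.trans (solve 3 (λ x e y → x :* (e :* y) := (x :* y) :* e) ≡.refl (seq x m) δ⁻ (y m)) (≡.trans (≡.cong (ℚ._* δ⁻) (inv m)) (ℚ.*-identityˡ δ⁻)))
      (ℚ.*-monoʳ-≤-nonNeg (δ⁻ ℚ.* y m) {{ℚ.nonNegative (*-0≤ (ℚ.<⇒≤ 0<δ⁻) (ℚ.<⇒≤ (0<y m)))}} (δ≤x m))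
    diff : ∀ m n → y m ℚ.- y n ≡ y m ℚ.* y n ℚ.* (seq x n ℚ.- seq x m)
    diff m n = ≡.sym (≡.trans (solve 4 (λ a b x z → a :* b :* (z :- x) := a :* (z :* b) :- b :* (x :* a)) ≡.refl (y m) (y n) (seq x m) (seq x n))
      (≡.trans (≡.cong₂ (λ p q → y m ℚ.* p ℚ.- y n ℚ.* q) (inv n) (inv m)) (≡.cong₂ ℚ._-_ (ℚ.*-identityʳ (y m)) (ℚ.*-identityʳ (y n)))))
    bnd = δ⁻ ℚ.* δ⁻ ℚ.+ 1ℚ
    0<bnd : 0ℚ ℚ.< bnd
    0<bnd = ℚ.+-mono-≤-< (*-0≤ (ℚ.<⇒≤ 0<δ⁻) (ℚ.<⇒≤ 0<δ⁻)) (ℚ.positive⁻¹ 1ℚ)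
    yy<bnd : ∀ m n → ∣ y m ℚ.* y n ∣ ℚ.< bnd
    yy<bnd m n = ℚ.≤-<-trans (ℚ.≤-trans (ℚ.≤-reflexive (ℚ.0≤p⇒∣p∣≡p (*-0≤ (ℚ.<⇒≤ (0<y m)) (ℚ.<⇒≤ (0<y n)))))
      (*-mono-≤ (ℚ.<⇒≤ (0<y m)) (ℚ.<⇒≤ 0<δ⁻) (y≤δ⁻ m) (y≤δ⁻ n)))
      (<-via (ℚ.positive⁻¹ 1ℚ) (solve 1 (λ d → con 1ℚ :- con 0ℚ := d :* d :+ con 1ℚ :- d :* d) ≡.refl δ⁻))
    cauchy-y : IsCauchy y
    cauchy-y ε 0<ε =
      let η , 0<η , bndη = scale bnd ε 0<bnd 0<ε
          N , h = cauchy x η 0<η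
      in N , λ m n N≤m N≤n → ≡.subst₂ ℚ._<_ (≡.cong ∣_∣ (≡.sym (diff m n))) bndη
           (∣*∣< (y m ℚ.* y n) (seq x n ℚ.- seq x m) bnd η (yy<bnd m n) 0<bnd (h n m N≤n N≤m))

module ℝ-Domain = OrderedDomainProperties ℝ-orderedDomain

seq-sum : ∀ {n} (g : Fin n → ℝ) m → seq (ℝ-Domain.sum g) m ≡ ℚ-Domain.sum (λ v → seq (g v) m)
seq-sum {zero}  g m = ≡.refl
seq-sum {suc n} g m = ≡.cong (seq (g zero) m ℚ.+_) (seq-sum (g ∘ suc) m)

seq-ι : ∀ a m → seq (ℝ-Domain.ι a) m ≡ ℚ-Domain.ι a
seq-ι zero    m = ≡.refl
seq-ι (suc a) m = ≡.cong (1ℚ ℚ.+_) (seq-ι a m)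

-- Perron vectors as limits of the iteration.

matrixApply : (K : OrderedDomain) → let open OrderedDomain K in ∀ {n} → (Fin n → Fin n → ℕ) → (Fin n → Carrier) → Fin n → Carrier
matrixApply K w f v = sum (λ u → ι (w v u) * f u)
  where open OrderedDomainProperties K

record PerronVector (K : OrderedDomain) {n} (w : Fin n → Fin n → ℕ) (I : Fin n → Set) : Set where
  open OrderedDomainProperties K
  field
    ρ        : Carrier
    f f⁻     : Fin n → Carrier
    vanish   : ∀ v → ¬ I v → f v ≈ 0#
    positive : ∀ v → I v → Pos (f v)
    inverse  : ∀ v → I v → f v * f⁻ v ≈ 1#
    eigen    : ∀ v → matrixApply K w f v ≈ ρ * f v

module PerronLimit {n : ℕ} (w : Fin n → Fin n → ℕ) (I : Fin n → Set) (I? : ∀ v → Dec (I v))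
  (φ : Fin n → ℕ → ℚ) (φ-cauchy : ∀ v → IsCauchy (φ v)) (φ-vanish : ∀ v → ¬ I v → ∀ m → φ v m ≡ 0ℚ)
  (δ₀ : ℚ) (0<δ₀ : 0ℚ ℚ.< δ₀) (δ₀≤φ : ∀ {v} → I v → ∀ m → δ₀ ℚ.≤ φ v m) where
  open ℚ-Lemmas
  open ℚSolver.+-*-Solver using (solve; _:=_; _:+_; _:*_; _:-_; con)

  T : (Fin n → ℚ) → Fin n → ℚ
  T x v = ℚ-Domain.sum (λ u → ℚ-Domain.ι (w v u) ℚ.* x u)

  module _ (φ-growth : ∀ v m → T (λ u → φ u m) v ≡ ℚ-Domain.sum (T (λ u → φ u m)) ℚ.* φ v (suc m)) where

    private
      F : Fin n → ℝ
      F v = mkℝ (φ v) (φ-cauchy v)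

      F⁻ : ∀ v → Dec (I v) → ℝ
      F⁻ v (yes Iv) = proj₁ (RealLimit.inverseᵣ (F v) δ₀ 0<δ₀ (δ₀≤φ Iv))
      F⁻ v (no _)   = 0ᵣ

      TF : Fin n → ℝ
      TF = matrixApply ℝ-orderedDomain w F

      seq-TF : ∀ v m → seq (TF v) m ≡ T (λ u → φ u m) v
      seq-TF v m = ≡.trans (seq-sum (λ u → ℝ-Domain.ι (w v u) *ᵣ F u) m)
        (ℚ-Domain.sum-cong-≋ (λ u → ≡.cong (ℚ._* φ u m) (seq-ι (w v u) m)))

      R : ℝ
      R = ℝ-Domain.sum TF

      seq-R : ∀ m → seq R m ≡ ℚ-Domain.sum (T (λ u → φ u m))
      seq-R m = ≡.trans (seq-sum TF m) (ℚ-Domain.sum-cong-≋ (λ v → seq-TF v m))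

      growth : ∀ v m → seq (TF v) m ≡ seq R m ℚ.* φ v (suc m)
      growth v m = ≡.trans (seq-TF v m) (≡.trans (φ-growth v m) (≡.cong (ℚ._* φ v (suc m)) (≡.sym (seq-R m))))

      -- At stage m the equation holds exactly with `φ v (suc m)`; replacing this by `φ v m` costs a
      -- Cauchy difference times the bounded `R`.
      eigenR : ∀ v → TF v Defs.≈ R *ᵣ F v
      eigenR v ε 0<ε =
        let B , 0<B , hB = ℝ-Lemmas.bounded R
            η , 0<η , Bη = ℝ-Lemmas.scale B ε 0<B 0<ε
            K , hK = φ-cauchy v η 0<η
        in eventually-map (λ m (bd , (close)) → ≡.subst₂ ℚ._<_
               (≡.cong ∣_∣ (≡.trans (solve 3 (λ r f′ f → r :* (f′ :- f) := r :* f′ :- r :* f) ≡.refl (seq R m) (φ v (suc m)) (φ v m)) (≡.cong (ℚ._- seq R m ℚ.* φ v m) (≡.sym (growth v m)))))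
               Bη (ℝ-Lemmas.∣*∣< (seq R m) (φ v (suc m) ℚ.- φ v m) B η bd 0<B close))
             (hB ⟨∧⟩ (K , λ m le → hK (suc m) m (ℕ.m≤n⇒m≤1+n le) le))

    perronVector : PerronVector ℝ-orderedDomain w I
    perronVector = record
      { ρ = R
      ; f = F
      ; f⁻ = λ v → F⁻ v (I? v)
      ; vanish = λ v ¬Iv → ℝ-Lemmas.pointwise (F v) 0ᵣ (φ-vanish v ¬Iv)
      ; positive = λ v Iv → ℝ-Lemmas.#>⇒≰ {F v} {0ᵣ} (pos v Iv)
      ; inverse = λ v Iv → inv v Iv (I? v)
      ; eigen = eigenR
      }
      where
      pos : ∀ v → I v → ℝ-Lemmas._#>_ (F v) 0ᵣ
      pos v Iv =
        let η , 0<η , 2η = ℝ-Lemmas.half δ₀ 0<δ₀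
        in η , 0<η , 0 , λ m _ → ℚ.<-≤-trans
             (<-via 0<η (≡.trans (solve 1 (λ η → η :- con 0ℚ := η :+ η :- (con 0ℚ :+ η)) ≡.refl η) (≡.cong (ℚ._- (0ℚ ℚ.+ η)) 2η))) (δ₀≤φ Iv m)
      inv : ∀ v → I v → (d : Dec (I v)) → F v *ᵣ F⁻ v d Defs.≈ ℝ-Lemmas.1ᵣ
      inv v Iv (yes Iv′) = proj₂ (RealLimit.inverseᵣ (F v) δ₀ 0<δ₀ (δ₀≤φ Iv′))
      inv v Iv (no ¬Iv)  = contradiction Iv ¬Iv

module Perron {n : ℕ} (w : Fin n → Fin n → ℕ) (I : Fin n → Set) (I? : ∀ v → Dec (I v)) (v₀ : Fin n) (I₀ : I v₀)
  (off : ∀ v u → ¬ I v → w v u ≡ 0) (loop : ∀ v → I v → 1 ℕ.≤ w v v)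
  (W : ℕ) (1≤W : 1 ℕ.≤ W) (w≤W : ∀ v u → w v u ℕ.≤ W) (M : ℕ) where
  open ℚ-Lemmas
  open ℚSolver.+-*-Solver using (solve; _:=_; _:*_)
  open Iteration ℚ-orderedDomain w I I? v₀ I₀
  open Contraction ℚ-orderedDomain I I? v₀ I₀ using (NonNeg; MixingOperator)

  module _ (mixing : ∀ {x} → NonNeg x → ∀ {u v} → I u → I v → x u ℚ.≤ iterate (suc M) x v) where

    private
      0<1 : 0ℚ ℚ.< 1ℚ
      0<1 = ℚ.positive⁻¹ 1ℚ

      1≤n : 1 ℕ.≤ n
      1≤n = 1≤size v₀
        where
        1≤size : ∀ {n} → Fin n → 1 ℕ.≤ n
        1≤size zero    = s≤s z≤n
        1≤size (suc _) = s≤s z≤n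

      bb = iterate-bounded 1≤n W 1≤W w≤W (suc M)
      b = proj₁ bb
      1≤b = proj₁ (proj₂ bb)

      c : ℚ
      c = ℚ-Domain.ι n

      1≤c : 1ℚ ℚ.≤ c
      1≤c = ℚ.≤-trans (ℚ.≤-reflexive (≡.sym (ℚ.+-identityʳ 1ℚ))) (ℚ-Domain.ι-mono 1≤n)

      0<c : 0ℚ ℚ.< c
      0<c = ℚ.<-≤-trans 0<1 1≤c

      0<b : 0ℚ ℚ.< b
      0<b = ℚ.<-≤-trans 0<1 1≤b

      rec = reciprocal (c ℚ.* b) (*-0< 0<c 0<b)
      s = proj₁ rec
      0<s = proj₁ (proj₂ rec)

      mixOp : MixingOperator (iterate (suc M)) c b s
      mixOp = mixingOperator off M mixing 1≤c b 1≤b (proj₂ (proj₂ bb)) s (ℚ.<⇒≤ 0<s) (proj₂ (proj₂ rec))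

      invert : ∀ a → ¬ (a ℚ.≤ 0ℚ) → ∃[ r ] (0ℚ ℚ.≤ r × a ℚ.* r ≡ 1ℚ)
      invert a 0<a = let r , 0<r , eq = reciprocal a (ℚ.≰⇒> 0<a) in r , ℚ.<⇒≤ 0<r , eq

      1-pos : ¬ (1ℚ ℚ.≤ 0ℚ)
      1-pos 1≤0 = ℚ.<-irrefl ≡.refl (ℚ.<-≤-trans 0<1 1≤0)

      module N = Normalised off loop M c b s mixOp ≡.refl invert 1-pos

      -- Starting one mixing step late makes the lower bound `δ₀` hold from m = 0 on, as `inverseᵣ`
      -- requires.
      φ : Fin n → ℕ → ℚ
      φ v m = N.f (suc M ℕ.+ m) v

      shift : ∀ j m → j ℕ.* suc M ℕ.≤ m → suc j ℕ.* suc M ℕ.+ (m ℕ.∸ j ℕ.* suc M) ≡ suc M ℕ.+ m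
      shift j m le = ≡.trans (ℕ.+-assoc (suc M) (j ℕ.* suc M) _) (≡.cong (suc M ℕ.+_) (ℕ.m+[n∸m]≡n le))

      φ-near : ∀ j m m′ → j ℕ.* suc M ℕ.≤ m → j ℕ.* suc M ℕ.≤ m′ → ∀ v → φ v m′ ℚ.- φ v m ℚ.≤ (1ℚ ℚ.- s) ℚ-Domain.^ j ℚ.* N.Q
      φ-near j m m′ le le′ v = ≡.subst₂ (λ k k′ → N.f k′ v ℚ.- N.f k v ℚ.≤ (1ℚ ℚ.- s) ℚ-Domain.^ j ℚ.* N.Q) (shift j m le) (shift j m′ le′)
        (N.near j (m ℕ.∸ j ℕ.* suc M) (m′ ℕ.∸ j ℕ.* suc M) v)

      φ-cauchy : ∀ v → IsCauchy (φ v)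
      φ-cauchy v ε 0<ε =
        let j , small = geometric {s} {N.Q} 0<s N.θ-nonneg 0<ε
        in j ℕ.* suc M , λ m m′ le le′ → -‿<⇒∣∣< (φ v m) (φ v m′)
             (ℚ.≤-<-trans (φ-near j m′ m le′ le v) small) (ℚ.≤-<-trans (φ-near j m m′ le le′ v) small)

      rδ = reciprocal (c ℚ.* b ℚ.* c) (*-0< (*-0< 0<c 0<b) 0<c)
      δ₀ = proj₁ rδ
      0<δ₀ = proj₁ (proj₂ rδ)

      δ₀≤φ : ∀ {v} → I v → ∀ m → δ₀ ℚ.≤ φ v m
      δ₀≤φ {v} Iv m = ≡.subst₂ ℚ._≤_ (ℚ.*-identityʳ δ₀)
        (≡.trans (solve 3 (λ d k f → d :* (k :* f) := (k :* d) :* f) ≡.refl δ₀ (c ℚ.* b ℚ.* c) (φ v m)) (≡.trans (≡.cong (ℚ._* φ v m) (proj₂ (proj₂ rδ))) (ℚ.*-identityˡ (φ v m))))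
        (ℚ.*-monoˡ-≤-nonNeg δ₀ {{ℚ.nonNegative (ℚ.<⇒≤ 0<δ₀)}} (N.lower m Iv))

    perronVector : PerronVector ℝ-orderedDomain w I
    perronVector = PerronLimit.perronVector w I I? φ φ-cauchy (λ v ¬Iv m → N.f-supported (suc M ℕ.+ m) v ¬Iv) δ₀ 0<δ₀ δ₀≤φ
      (λ v m → ≡.trans (N.growth (suc M ℕ.+ m) v) (≡.cong (λ k → ℚ-Domain.sum (T (N.f (suc M ℕ.+ m))) ℚ.* N.f k v) (≡.sym (ℕ.+-suc (suc M) m))))

-- Rooted trees.

module Walks {n : ℕ} (G : Graph n) where

  Adj-sym : ∀ {u v} → Adj G u v → Adj G v u
  Adj-sym {u} {v} = ≡.trans (symmetric G v u)

  Adj-irrefl : ∀ {v} → ¬ Adj G v v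
  Adj-irrefl {v} a with () ← ≡.trans (≡.sym a) (loopless G v)

  walk-cons : ∀ {u v w ℓ} → Adj G u v → Walk G v w ℓ → Walk G u w (suc ℓ)
  walk-cons a stay       = step stay a
  walk-cons a (step w b) = step (walk-cons a w) b

  walk-uncons : ∀ {u w ℓ} → Walk G u w (suc ℓ) → ∃[ v ] (Adj G u v × Walk G v w ℓ)
  walk-uncons (step stay a)         = _ , a , stay
  walk-uncons (step w@(step _ _) a) = let v , b , w′ = walk-uncons w in v , b , step w′ a

  walk? : ∀ u v ℓ → Dec (Walk G u v ℓ)
  walk? u v zero    = map′ (λ { ≡.refl → stay }) (λ { stay → ≡.refl }) (u Fin.≟ v)
  walk? u w (suc ℓ) = map′ (λ (v , w′ , a) → step w′ a) (λ { (step w′ a) → _ , w′ , a })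
    (Fin.any? λ v → walk? u v ℓ ×-dec (adj G v w Bool.≟ true))

  least : ∀ {P : ℕ → Set} → (∀ i → Dec (P i)) → ∀ N → P N → ∃[ i ] (P i × (∀ j → P j → i ℕ.≤ j))
  least P? N PN with P? 0
  ... | yes P0 = 0 , P0 , λ _ _ → z≤n
  least P? zero    PN | no ¬P0 = contradiction PN ¬P0
  least {P} P? (suc N) PN | no ¬P0 = let i , Pi , min = least (P? ∘ suc) N PN in
    suc i , Pi , λ { zero P0 → contradiction P0 ¬P0 ; (suc j) Pj → s≤s (min j Pj) }

  -- In a finite graph the existence of a walk of given length is decidable, so the length provided
  -- by connectedness can be minimised by search.
  distances : Connected G → ∀ r → ∃[ h ] (∀ v → IsDist G v r (h v))
  distances conn r = (λ v → proj₁ (dist v)) , (λ v → proj₂ (dist v))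
    where
    dist : ∀ v → ∃[ ℓ ] IsDist G v r ℓ
    dist v = let ℓ , w = conn v r in least (walk? v r) ℓ w

module _ {A : Set} {R : A → A → Set} where

  linked-∷ʳ : ∀ xs {a b} → Linked R (xs ∷ʳ a) → R a b → Linked R ((xs ∷ʳ a) ∷ʳ b)
  linked-∷ʳ []           [-]      r = r ∷ [-]
  linked-∷ʳ (x ∷ [])     (l ∷ ls) r = l ∷ linked-∷ʳ [] ls r
  linked-∷ʳ (x ∷ y ∷ xs) (l ∷ ls) r = l ∷ linked-∷ʳ (y ∷ xs) ls r

-- P r is a junk value.
record Rooting {n : ℕ} (G : Graph n) (r : Fin n) : Set where
  field
    h        : Fin n → ℕ
    P        : Fin n → Fin n
    h-root   : h r ≡ 0
    h-parent : ∀ {v} → v ≢ r → h v ≡ suc (h (P v))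
    P-adj    : ∀ {v} → v ≢ r → Adj G v (P v)
    edge     : ∀ {u v} → Adj G u v → (u ≢ r × P u ≡ v) ⊎ (v ≢ r × P v ≡ u)

module RootTree {n : ℕ} (G : Graph n) (acyclic : Acyclic G) (r : Fin n) (h : Fin n → ℕ) (h-dist : ∀ v → IsDist G v r (h v)) where
  open Walks G

  h-root : h r ≡ 0
  h-root = ℕ.n≤0⇒n≡0 (proj₂ (h-dist r) 0 stay)

  h≡0⇒root : ∀ {v} → h v ≡ 0 → v ≡ r
  h≡0⇒root {v} eq with stay ← ≡.subst (Walk G v r) eq (proj₁ (h-dist v)) = ≡.refl

  h-edge : ∀ {u v} → Adj G u v → h u ℕ.≤ suc (h v)
  h-edge {u} {v} a = proj₂ (h-dist u) _ (walk-cons a (proj₁ (h-dist v)))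

  ancestor : ∀ v → v ≢ r → ∃[ u ] (Adj G v u × h v ≡ suc (h u))
  ancestor v v≢r = go (h v) ≡.refl
    where
    go : ∀ ℓ → h v ≡ ℓ → ∃[ u ] (Adj G v u × h v ≡ suc (h u))
    go zero    eq = contradiction (h≡0⇒root eq) v≢r
    go (suc ℓ) eq = let u , a , w = walk-uncons (≡.subst (Walk G v r) eq (proj₁ (h-dist v))) in
      u , a , ℕ.≤-antisym (h-edge a) (ℕ.≤-trans (s≤s (proj₂ (h-dist u) ℓ w)) (ℕ.≤-reflexive (≡.sym eq)))

  parentOf : ∀ v → Dec (v ≡ r) → Fin n
  parentOf v (yes _)  = r
  parentOf v (no v≢r) = proj₁ (ancestor v v≢r)

  P : Fin n → Fin n
  P v = parentOf v (v Fin.≟ r)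

  P-spec : ∀ {v} → v ≢ r → Adj G v (P v) × h v ≡ suc (h (P v))
  P-spec {v} v≢r with v Fin.≟ r
  ... | yes v≡r = contradiction v≡r v≢r
  ... | no v≢r′ = proj₂ (ancestor v v≢r′)

  -- The inner vertices are closer to the root than u. This field, `below`, keeps the path simple
  -- when it is prolonged at both ends away from the root.
  record Arc (u v : Fin n) : Set where
    field
      mid    : List (Fin n)
      1≤mid  : 1 ℕ.≤ length mid
      linked : Linked (Adj G) (u ∷ (mid ∷ʳ v))
      unique : Unique (u ∷ (mid ∷ʳ v))
      below  : All (λ x → h x ℕ.< h u) mid

  -- Two vertices of equal height are joined through their nearest common
  -- ancestor; with an edge between them, or a common child, this closes a cycle.
  arc : ∀ ℓ u v → h u ≡ ℓ → h v ≡ ℓ → u ≢ v → Arc u v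
  arc zero    u v hu hv u≢v = contradiction (≡.trans (h≡0⇒root hu) (≡.sym (h≡0⇒root hv))) u≢v
  arc (suc ℓ) u v hu hv u≢v = join (P u Fin.≟ P v)
    where
    nonroot : ∀ {w} → h w ≡ suc ℓ → w ≢ r
    nonroot hw ≡.refl with () ← ≡.trans (≡.sym h-root) hw
    u≢r = nonroot hu
    v≢r = nonroot hv
    hPu : h (P u) ≡ ℓ
    hPu = ℕ.suc-injective (≡.trans (≡.sym (proj₂ (P-spec u≢r))) hu)
    hPv : h (P v) ≡ ℓ
    hPv = ℕ.suc-injective (≡.trans (≡.sym (proj₂ (P-spec v≢r))) hv)
    hu≡hv = ≡.trans hu (≡.sym hv)
    close : ∀ mid → 1 ℕ.≤ length mid → Linked (Adj G) (u ∷ (mid ∷ʳ v)) → Unique mid → All (λ x → h x ℕ.< h u) mid → Arc u v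
    close mid 1≤ lk un below = record
      { mid = mid ; 1≤mid = 1≤ ; linked = lk ; below = below
      ; unique = All.++⁺ (All.map (λ lt eq → ℕ.<-irrefl (≡.cong h (≡.sym eq)) lt) below) (u≢v ∷ [])
               ∷ AllPairs.++⁺ un ([] ∷ []) (All.map (λ lt → (λ eq → ℕ.<-irrefl (≡.trans (≡.cong h eq) (≡.sym hu≡hv)) lt) ∷ []) below)
      }
    lower : ∀ {x} → h x ≡ ℓ → h x ℕ.< h u
    lower hx = ℕ.≤-reflexive (≡.trans (≡.cong suc hx) (≡.sym hu))
    join : Dec (P u ≡ P v) → Arc u v
    join (yes eq) = close (P u ∷ []) (s≤s z≤n)
      (proj₁ (P-spec u≢r) ∷ (≡.subst (λ w → Adj G w v) (≡.sym eq) (Adj-sym (proj₁ (P-spec v≢r))) ∷ [-]))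
      ([] ∷ []) (lower hPu ∷ [])
    join (no ne) = close (P u ∷ (mid ∷ʳ P v)) (s≤s z≤n)
      (proj₁ (P-spec u≢r) ∷ linked-∷ʳ (P u ∷ mid) linked (Adj-sym (proj₁ (P-spec v≢r))))
      unique
      (lower hPu ∷ All.++⁺ (All.map (λ lt → ℕ.<-trans lt (lower hPu)) below) (lower hPv ∷ []))
      where open Arc (arc ℓ (P u) (P v) hPu hPv ne)

  length-∷ʳ : ∀ (xs : List (Fin n)) {a} → 1 ℕ.≤ length xs → 2 ℕ.≤ length (xs ∷ʳ a)
  length-∷ʳ xs {a} 1≤ = ≡.subst (2 ℕ.≤_) (≡.sym (≡.trans (List.length-++ xs) (ℕ.+-comm (length xs) 1))) (s≤s 1≤)

  no-level-edge : ∀ {u v} → Adj G u v → h u ≢ h v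
  no-level-edge {u} {v} a eq = acyclic u (mid ∷ʳ v) (length-∷ʳ mid 1≤mid , unique , linked-∷ʳ (u ∷ mid) linked (Adj-sym a))
    where
    u≢v : u ≢ v
    u≢v ≡.refl = Adj-irrefl a
    open Arc (arc (h u) u v ≡.refl (≡.sym eq) u≢v)

  unique-parent : ∀ {x u v} → Adj G x u → Adj G x v → h x ≡ suc (h u) → h x ≡ suc (h v) → u ≡ v
  unique-parent {x} {u} {v} a b hu hv = Fin-stable (u Fin.≟ v)
    where
    hv≡hu : h v ≡ h u
    hv≡hu = ℕ.suc-injective (≡.trans (≡.sym hv) hu)
    Fin-stable : Dec (u ≡ v) → u ≡ v
    Fin-stable (yes eq) = eq
    Fin-stable (no u≢v) = contradiction
      ( ℕ.≤-trans (length-∷ʳ mid 1≤mid) (ℕ.n≤1+n _)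
      , ((below-x (ℕ.≤-reflexive (≡.sym hu)) ∷ All.++⁺ (All.map (λ lt → below-x (ℕ.<-trans lt (ℕ.≤-reflexive (≡.sym hu)))) below) (below-x (ℕ.≤-reflexive (≡.sym hv)) ∷ [])) ∷ unique)
      , (a ∷ linked-∷ʳ (u ∷ mid) linked (Adj-sym b)))
      (acyclic x (u ∷ (mid ∷ʳ v)))
      where
      open Arc (arc (h u) u v ≡.refl hv≡hu u≢v)
      below-x : ∀ {y} → h y ℕ.< h x → x ≢ y
      below-x lt ≡.refl = ℕ.<-irrefl ≡.refl lt

  rooting : Rooting G r
  rooting = record
    { h = h ; P = P ; h-root = h-root ; h-parent = λ v≢r → proj₂ (P-spec v≢r) ; P-adj = λ v≢r → proj₁ (P-spec v≢r) ; edge = edge }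
    where
    up : ∀ {u v} → Adj G u v → h v ℕ.< h u → u ≢ r × P u ≡ v
    up {u} {v} a lt = u≢r , unique-parent (proj₁ (P-spec u≢r)) a (proj₂ (P-spec u≢r)) (ℕ.≤-antisym (h-edge a) lt)
      where
      u≢r : u ≢ r
      u≢r ≡.refl with () ← ≡.subst (h v ℕ.<_) h-root lt
    edge : ∀ {u v} → Adj G u v → (u ≢ r × P u ≡ v) ⊎ (v ≢ r × P v ≡ u)
    edge {u} {v} a with ℕ.<-cmp (h u) (h v)
    ... | tri< lt _ _ = inj₂ (up (Adj-sym a) lt)
    ... | tri≈ _ eq _ = contradiction eq (no-level-edge a)
    ... | tri> _ _ gt = inj₁ (up a gt)

-- Counting, ranking and labelling of vertices.

b2n : Bool → ℕ
b2n true  = 1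
b2n false = 0

b2n≤1 : ∀ b → b2n b ℕ.≤ 1
b2n≤1 true  = ℕ.≤-refl
b2n≤1 false = z≤n

b2n-injective : ∀ {a b} → b2n a ≡ b2n b → a ≡ b
b2n-injective {true}  {true}  _ = ≡.refl
b2n-injective {false} {false} _ = ≡.refl

module Counting where
  open NatSums using (sum)

  sum-mono : ∀ {n} {s t : Fin n → ℕ} → (∀ i → s i ℕ.≤ t i) → sum s ℕ.≤ sum t
  sum-mono {zero}  h = z≤n
  sum-mono {suc n} h = ℕ.+-mono-≤ (h zero) (sum-mono (h ∘ suc))

  sum-mono-< : ∀ {n} {s t : Fin n → ℕ} → (∀ i → s i ℕ.≤ t i) → ∀ i → s i ℕ.< t i → sum s ℕ.< sum t
  sum-mono-< h zero    lt = ℕ.+-mono-<-≤ lt (sum-mono (h ∘ suc))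
  sum-mono-< h (suc i) lt = ℕ.+-mono-≤-< (h zero) (sum-mono-< (h ∘ suc) i lt)

  term≤ : ∀ {n} (t : Fin n → ℕ) i → t i ℕ.≤ sum t
  term≤ t zero    = ℕ.m≤m+n _ _
  term≤ t (suc i) = ℕ.≤-trans (term≤ (t ∘ suc) i) (ℕ.m≤n+m _ _)

  sum-const : ∀ n a → sum {n} (λ _ → a) ≡ n ℕ.* a
  sum-const zero    a = ≡.refl
  sum-const (suc n) a = ≡.cong (a ℕ.+_) (sum-const n a)

  sum-zero⇒ : ∀ {n} {t : Fin n → ℕ} → sum t ≡ 0 → ∀ i → t i ≡ 0
  sum-zero⇒ {suc n} {t} eq zero    = ℕ.m+n≡0⇒m≡0 (t zero) eq
  sum-zero⇒ {suc n} {t} eq (suc i) = sum-zero⇒ (ℕ.m+n≡0⇒n≡0 (t zero) eq) i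

  card-tabulate : ∀ {n} (b : Fin n → Bool) → card (Vec.tabulate b) ≡ sum (b2n ∘ b)
  card-tabulate {zero}  b = ≡.refl
  card-tabulate {suc n} b with b zero
  ... | true  = ≡.cong suc (card-tabulate (b ∘ suc))
  ... | false = card-tabulate (b ∘ suc)

  C-δ : ∀ n a → a ℕ.< n → C n (δ a) ≡ 1
  C-δ (suc n) zero    _ = ≡.cong suc (≡.trans (sum-const n 0) (ℕ.*-zeroʳ n))
  C-δ (suc n) (suc a) (s≤s a<n) = C-δ n a a<n

module _ {n : ℕ} (f : Fin n → Fin n) (inj : Injective _≡_ _≡_ f) where

  injective⇒surjective : ∀ i → ∃[ v ] (f v ≡ i)
  injective⇒surjective i with Fin.any? (λ v → f v Fin.≟ i)
  ... | yes hit = hit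
  ... | no miss = contradiction (squeeze i f inj (λ v eq → miss (v , eq))) λ ()
    where
    squeeze : ∀ {n} (i : Fin n) (f : Fin n → Fin n) → Injective _≡_ _≡_ f → (∀ v → f v ≢ i) → 1 ℕ.≤ 0
    squeeze {suc n} i f inj miss = contradiction
      (Fin.injective⇒≤ {f = λ v → Fin.punchOut (miss v ∘ ≡.sym)} (λ eq → inj (Fin.punchOut-injective (miss _ ∘ ≡.sym) (miss _ ∘ ≡.sym) eq)))
      ℕ.1+n≰n

  injective⇒permutation : Permutation′ n
  injective⇒permutation = permutation f (proj₁ ∘ injective⇒surjective) (proj₂ ∘ injective⇒surjective)
    (λ v → inj (proj₂ (injective⇒surjective (f v))))

module Ranking {n : ℕ} {_≺_ : Rel (Fin n) 0ℓ} (sto : IsStrictTotalOrder _≡_ _≺_) where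
  open NatSums using (sum)
  open Counting
  open IsStrictTotalOrder sto using (compare; _<?_) renaming (trans to ≺-trans; irrefl to ≺-irrefl)

  private
    below : Fin n → Fin n → ℕ
    below v u = b2n ⌊ u <? v ⌋

    below-yes : ∀ {u v} → u ≺ v → below v u ≡ 1
    below-yes {u} {v} u≺v with u <? v
    ... | yes _  = ≡.refl
    ... | no u⊀v = contradiction u≺v u⊀v

    below-no : ∀ {u v} → ¬ (u ≺ v) → below v u ≡ 0
    below-no {u} {v} u⊀v with u <? v
    ... | yes u≺v = contradiction u≺v u⊀v
    ... | no _    = ≡.refl

    below≤1 : ∀ v u → below v u ℕ.≤ 1
    below≤1 v u with u <? v
    ... | yes _ = ℕ.≤-refl
    ... | no _  = z≤n

    rankℕ : Fin n → ℕ
    rankℕ v = sum (below v)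

    self : ∀ v → below v v ≡ 0
    self v = below-no (≺-irrefl ≡.refl)

    rank<n : ∀ v → rankℕ v ℕ.< n
    rank<n v = ≡.subst (rankℕ v ℕ.<_) (≡.trans (sum-const n 1) (ℕ.*-identityʳ n))
      (sum-mono-< (below≤1 v) v (ℕ.≤-reflexive (≡.cong suc (self v))))

    rank-mono : ∀ {u v} → u ≺ v → rankℕ u ℕ.< rankℕ v
    rank-mono {u} {v} u≺v = sum-mono-< le u (ℕ.≤-reflexive (≡.trans (≡.cong suc (self u)) (≡.sym (below-yes u≺v))))
      where
      le : ∀ x → below u x ℕ.≤ below v x
      le x with x <? u
      ... | yes x≺u = ℕ.≤-reflexive (≡.sym (below-yes (≺-trans x≺u u≺v)))
      ... | no _    = z≤n

    rank : Fin n → Fin n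
    rank v = Fin.fromℕ< (rank<n v)

    toℕ-rank : ∀ v → toℕ (rank v) ≡ rankℕ v
    toℕ-rank v = Fin.toℕ-fromℕ< (rank<n v)

    rank-injective : Injective _≡_ _≡_ rank
    rank-injective {u} {v} eq with compare u v
    ... | tri≈ _ u≡v _ = u≡v
    ... | tri< u≺v _ _ = contradiction (≡.trans (≡.sym (toℕ-rank u)) (≡.trans (≡.cong toℕ eq) (toℕ-rank v))) (ℕ.<⇒≢ (rank-mono u≺v))
    ... | tri> _ _ v≺u = contradiction (≡.trans (≡.sym (toℕ-rank v)) (≡.trans (≡.cong toℕ (≡.sym eq)) (toℕ-rank u))) (ℕ.<⇒≢ (rank-mono v≺u))

    π : Permutation′ n
    π = injective⇒permutation rank rank-injective

  enumeration : Permutation′ n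
  enumeration = Perm.flip π

  enumeration-increasing : ∀ {i j} → toℕ i ℕ.< toℕ j → (enumeration ⟨$⟩ʳ i) ≺ (enumeration ⟨$⟩ʳ j)
  enumeration-increasing {i} {j} i<j with compare (enumeration ⟨$⟩ʳ i) (enumeration ⟨$⟩ʳ j)
  ... | tri< lt _ _ = lt
  ... | tri≈ _ eq _ = contradiction i<j (ℕ.<-irrefl (≡.cong toℕ (≡.trans (≡.sym (Perm.inverseʳ π)) (≡.trans (≡.cong rank eq) (Perm.inverseʳ π)))))
  ... | tri> _ _ gt = contradiction i<j (ℕ.<-asym (≡.subst₂ ℕ._<_ (back j) (back i) (rank-mono gt)))
    where
    back : ∀ k → rankℕ (enumeration ⟨$⟩ʳ k) ≡ toℕ k
    back k = ≡.trans (≡.sym (toℕ-rank _)) (≡.cong toℕ (Perm.inverseʳ π {k}))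

-- A numbering with the root at 0 and parents p x for x < N. As `edges` adds both orientations,
-- `spec` also rules out that two vertices are parents of each other.
record Labelling {N : ℕ} (G : Graph (suc N)) : Set where
  field
    σ    : Permutation′ (suc N)
    p    : ℕ → ℕ
    p≤N  : ∀ x → x ℕ.< N → p x ℕ.≤ N
    spec : ∀ i j → b2n (adj G (σ ⟨$⟩ʳ i) (σ ⟨$⟩ʳ j)) ≡ edges p (toℕ i) (toℕ j)

  loopless′ : ∀ x → x ℕ.< N → p x ≢ suc x
  loopless′ x x<N eq = contradiction (≡.trans (≡.sym zero-loop) one) λ ()
    where
    i : Fin (suc N)
    i = Fin.fromℕ< (s≤s x<N)
    i≡ : toℕ i ≡ suc x
    i≡ = Fin.toℕ-fromℕ< (s≤s x<N)
    zero-loop : ch p (suc x) (suc x) ≡ 0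
    zero-loop = ℕ.m+n≡0⇒m≡0 (ch p (suc x) (suc x)) (≡.trans (≡.cong₂ (edges p) (≡.sym i≡) (≡.sym i≡)) (≡.trans (≡.sym (spec i i)) (≡.cong b2n (loopless G _))))
    one : ch p (suc x) (suc x) ≡ 1
    one = ≡.trans (≡.cong (λ a → δ a (suc x)) eq) (δ-refl (suc x))

  open NatSums using (sum; sum-permute; sum-cong-≗; ∑-distrib-+; ∑-comm)
  open Counting

  children : ℕ → ℕ
  children i = C N (λ x → δ (p x) i)

  degree-σ : ∀ i → degree G (σ ⟨$⟩ʳ i) ≡ C (suc N) (ch p (toℕ i)) ℕ.+ children (toℕ i)
  degree-σ i = ≡.trans (card-tabulate (adj G (σ ⟨$⟩ʳ i))) (≡.trans (sum-permute (λ u → b2n (adj G (σ ⟨$⟩ʳ i) u)) σ)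
    (≡.trans (sum-cong-≗ {suc N} (spec i)) (∑-distrib-+ {suc N} (λ j → ch p (toℕ i) (toℕ j)) (λ j → ch p (toℕ j) (toℕ i)))))

  degree-root : degree G (σ ⟨$⟩ʳ zero) ≡ children 0
  degree-root = ≡.trans (degree-σ zero) (≡.cong (ℕ._+ children 0) (≡.trans (sum-const (suc N) 0) (ℕ.*-zeroʳ (suc N))))

  degree-suc : ∀ i → degree G (σ ⟨$⟩ʳ suc i) ≡ suc (children (suc (toℕ i)))
  degree-suc i = ≡.trans (degree-σ (suc i)) (≡.cong (ℕ._+ children (suc (toℕ i))) (C-δ (suc N) (p (toℕ i)) (s≤s (p≤N (toℕ i) (Fin.toℕ<n i)))))

  children-total : C (suc N) children ≡ N
  children-total = ≡.trans (∑-comm {suc N} {N} (λ i x → δ (p (toℕ x)) (toℕ i)))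
    (≡.trans (C-cong N (λ x x<N → C-δ (suc N) (p x) (s≤s (p≤N x x<N)))) (≡.trans (sum-const N 1) (ℕ.*-identityʳ N)))

  handshake : sum (degree G) ≡ N ℕ.+ N
  handshake = ≡.trans (sum-permute (degree G) σ) (≡.trans (≡.cong₂ ℕ._+_ degree-root
    (≡.trans (sum-cong-≗ {N} degree-suc) (∑-distrib-+ {N} (λ _ → 1) (λ i → children (suc (toℕ i))))))
    (≡.trans (≡.cong (λ k → children 0 ℕ.+ (k ℕ.+ rest)) (≡.trans (sum-const N 1) (ℕ.*-identityʳ N)))
      (≡.trans (≡.trans (≡.sym (ℕ.+-assoc (children 0) N rest)) (≡.cong (ℕ._+ rest) (ℕ.+-comm (children 0) N)))
        (≡.trans (ℕ.+-assoc N (children 0) rest) (≡.cong (N ℕ.+_) children-total)))))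
    where rest = C N (λ i → children (suc i))

  count-children : ∀ t → count≤ N p (suc t) ≡ count≤ N p t ℕ.+ children (suc t)
  count-children t = ≡.trans (C-cong N (λ x _ → split (p x) t)) (∑-distrib-+ {N} (λ x → ⟦ p (toℕ x) ≤ t ⟧) (λ x → δ (p (toℕ x)) (suc t)))
    where
    split : ∀ a t → ⟦ a ≤ suc t ⟧ ≡ ⟦ a ≤ t ⟧ ℕ.+ δ a (suc t)
    split zero          t       = ≡.refl
    split (suc zero)    zero    = ≡.refl
    split (suc (suc a)) zero    = ≡.refl
    split (suc a)       (suc t) = split a t

  count-root : count≤ N p 0 ≡ children 0
  count-root = C-cong N (λ x _ → split (p x))
    where
    split : ∀ a → ⟦ a ≤ 0 ⟧ ≡ δ a 0
    split zero    = ≡.refl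
    split (suc a) = ≡.refl

module LabelRooting {N : ℕ} {G : Graph (suc N)} {r : Fin (suc N)} (rt : Rooting G r) (σ : Permutation′ (suc N)) (σ0 : σ ⟨$⟩ʳ zero ≡ r) where
  open Rooting rt

  private
    clamp : ℕ → Fin (suc N)
    clamp i = Fin.fromℕ< (s≤s (ℕ.m⊓n≤n i N))

    clamp-toℕ : ∀ i → clamp (toℕ i) ≡ i
    clamp-toℕ i = Fin.toℕ-injective (≡.trans (Fin.toℕ-fromℕ< _) (ℕ.m≤n⇒m⊓n≡m (ℕ.≤-pred (Fin.toℕ<n i))))

  p : ℕ → ℕ
  p x = toℕ (σ ⟨$⟩ˡ P (σ ⟨$⟩ʳ clamp (suc x)))

  σ-injective : ∀ {i j} → σ ⟨$⟩ʳ i ≡ σ ⟨$⟩ʳ j → i ≡ j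
  σ-injective eq = ≡.trans (≡.sym (Perm.inverseˡ σ)) (≡.trans (≡.cong (σ ⟨$⟩ˡ_) eq) (Perm.inverseˡ σ))

  p-parent : ∀ (x : Fin N) → p (toℕ x) ≡ toℕ (σ ⟨$⟩ˡ P (σ ⟨$⟩ʳ suc x))
  p-parent x = ≡.cong (λ i → toℕ (σ ⟨$⟩ˡ P (σ ⟨$⟩ʳ i))) (clamp-toℕ (suc x))

  nonroot : ∀ x → σ ⟨$⟩ʳ suc x ≢ r
  nonroot x eq with () ← σ-injective (≡.trans eq (≡.sym σ0))

  IsParent : Fin (suc N) → Fin (suc N) → Set
  IsParent i j = σ ⟨$⟩ʳ i ≢ r × P (σ ⟨$⟩ʳ i) ≡ σ ⟨$⟩ʳ j

  ch-yes : ∀ i j → IsParent i j → ch p (toℕ i) (toℕ j) ≡ 1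
  ch-yes zero    j (nr , _)  = contradiction σ0 nr
  ch-yes (suc x) j (_ , eq) = ≡.trans (≡.cong (λ a → δ a (toℕ j)) (≡.trans (p-parent x) (≡.cong toℕ (≡.trans (≡.cong (σ ⟨$⟩ˡ_) eq) (Perm.inverseˡ σ))))) (δ-refl (toℕ j))

  ch-no : ∀ i j → ¬ IsParent i j → ch p (toℕ i) (toℕ j) ≡ 0
  ch-no zero    j _ = ≡.refl
  ch-no (suc x) j ¬ip = δ-≢ λ eq → ¬ip (nonroot x , ≡.trans (≡.sym (Perm.inverseʳ σ)) (≡.cong (σ ⟨$⟩ʳ_) (Fin.toℕ-injective (≡.trans (≡.sym (p-parent x)) eq))))

  asym : ∀ i j → IsParent i j → ¬ IsParent j i
  asym i j (i≢r , eq) (j≢r , eq′) = ℕ.<-irrefl ≡.refl (ℕ.<-trans (lt i≢r eq) (lt j≢r eq′))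
    where
    lt : ∀ {u v} → u ≢ r → P u ≡ v → h v ℕ.< h u
    lt u≢r ≡.refl = ℕ.≤-reflexive (≡.sym (h-parent u≢r))

  labelling : Labelling G
  labelling = record
    { σ = σ ; p = p
    ; p≤N = λ x _ → ℕ.≤-pred (Fin.toℕ<n (σ ⟨$⟩ˡ P (σ ⟨$⟩ʳ clamp (suc x))))
    ; spec = λ i j → spec i j (adj G (σ ⟨$⟩ʳ i) (σ ⟨$⟩ʳ j)) ≡.refl }
    where
    spec : ∀ i j b → adj G (σ ⟨$⟩ʳ i) (σ ⟨$⟩ʳ j) ≡ b → b2n b ≡ edges p (toℕ i) (toℕ j)
    spec i j true a with edge a
    ... | inj₁ ip = ≡.sym (≡.cong₂ ℕ._+_ (ch-yes i j ip) (ch-no j i (asym i j ip)))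
    ... | inj₂ ip = ≡.sym (≡.cong₂ ℕ._+_ (ch-no i j (asym j i ip)) (ch-yes j i ip))
    spec i j false na = ≡.sym (≡.cong₂ ℕ._+_ (ch-no i j (none na)) (ch-no j i (none (≡.trans (symmetric G _ _) na))))
      where
      none : ∀ {i j} → adj G (σ ⟨$⟩ʳ i) (σ ⟨$⟩ʳ j) ≡ false → ¬ IsParent i j
      none {i} {j} na (nr , eq) with () ← ≡.trans (≡.sym (≡.subst (Adj G (σ ⟨$⟩ʳ i)) eq (P-adj nr))) na

module ListSums (M : CommutativeMonoid 0ℓ 0ℓ) where
  open CommutativeMonoid M
  open CommutativeMonoidSum M using (sum)

  -- Connects the list `interiors` with sums over all vertices; a vertex left out contributes the
  -- unit.
  foldr-catMaybes : ∀ {A B : Set} {n} (g : A → Carrier) (m : B → Maybe A) (t : Fin n → B) →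
    List.foldr _∙_ ε (List.map g (List.mapMaybe m (List.tabulate t))) ≈ sum (λ i → maybe′ g ε (m (t i)))
  foldr-catMaybes {n = zero}  g m t = refl
  foldr-catMaybes {n = suc n} g m t with m (t zero)
  ... | just a  = ∙-congˡ (foldr-catMaybes g m (t ∘ suc))
  ... | nothing = trans (foldr-catMaybes g m (t ∘ suc)) (sym (identityˡ _))

module InteriorSums {n : ℕ} (G : Graph n) where
  open NatSums using (sum; sum-cong-≗; ∑-distrib-+)
  open Counting

  isInterior : Fin n → ℕ
  isInterior v = b2n ⌊ interior? G v ⌋

  isBoundary : Fin n → ℕ
  isBoundary v = b2n (not ⌊ interior? G v ⌋)

  select : ∀ {C : Set} (g : V₀ G → C) (ε : C) v → Dec (Interior G v) → C
  select g ε v (yes i) = g (v , i)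
  select g ε v (no _)  = ε

  maybe-select : ∀ {C : Set} (g : V₀ G → C) ε v → maybe′ g ε (Maybe.map (v ,_) (dec⇒maybe (interior? G v))) ≡ select g ε v (interior? G v)
  maybe-select g ε v with interior? G v
  ... | yes i = ≡.refl
  ... | no _  = ≡.refl

  sum-interiors : (g : V₀ G → ℕ) → List.foldr ℕ._+_ 0 (List.map g (interiors G)) ≡ sum (λ v → select g 0 v (interior? G v))
  sum-interiors g = ≡.trans (ListSums.foldr-catMaybes ℕ.+-0-commutativeMonoid {n = n} g (λ v → Maybe.map (v ,_) (dec⇒maybe (interior? G v))) (λ v → v)) (sum-cong-≗ {n} (maybe-select g 0))

  length-interiors : length (interiors G) ≡ sum isInterior
  length-interiors = ≡.trans (len (interiors G)) (≡.trans (sum-interiors (λ _ → 1)) (sum-cong-≗ pointwise))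
    where
    len : ∀ {A : Set} (xs : List A) → length xs ≡ List.foldr ℕ._+_ 0 (List.map (λ _ → 1) xs)
    len []       = ≡.refl
    len (x ∷ xs) = ≡.cong suc (len xs)
    pointwise : ∀ v → select (λ _ → 1) 0 v (interior? G v) ≡ isInterior v
    pointwise v with interior? G v
    ... | yes _ = ≡.refl
    ... | no _  = ≡.refl

  sum-partition : sum isInterior ℕ.+ sum isBoundary ≡ n
  sum-partition = ≡.trans (≡.sym (∑-distrib-+ isInterior isBoundary)) (≡.trans (sum-cong-≗ one) (≡.trans (sum-const n 1) (ℕ.*-identityʳ n)))
    where
    one : ∀ v → isInterior v ℕ.+ isBoundary v ≡ 1
    one v with interior? G v
    ... | yes _ = ≡.refl
    ... | no _  = ≡.refl

  degree-partition : (∀ v → Boundary G v ⊎ Interior G v) → interiorDegreeSum G ℕ.+ sum isBoundary ≡ sum (degree G)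
  degree-partition bi = ≡.trans (≡.cong (ℕ._+ sum isBoundary) (sum-interiors (degree G ∘ proj₁)))
    (≡.trans (≡.sym (∑-distrib-+ (λ v → select (degree G ∘ proj₁) 0 v (interior? G v)) isBoundary)) (sum-cong-≗ each))
    where
    each : ∀ v → select (degree G ∘ proj₁) 0 v (interior? G v) ℕ.+ isBoundary v ≡ degree G v
    each v with interior? G v | bi v
    ... | yes _ | _      = ℕ.+-identityʳ _
    ... | no _  | inj₁ b = ≡.sym b
    ... | no ¬i | inj₂ i = contradiction i ¬i

  degree-bound : ∀ d → (∀ v → Interior G v → d ℕ.≤ degree G v) → length (interiors G) ℕ.* d ℕ.≤ interiorDegreeSum G
  degree-bound d d≤ = ℕ.≤-trans (ℕ.≤-reflexive (≡.cong (ℕ._* d) length-interiors))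
    (ℕ.≤-trans (ℕ.≤-reflexive (scale isInterior d)) (ℕ.≤-trans (sum-mono each) (ℕ.≤-reflexive (≡.sym (sum-interiors (degree G ∘ proj₁))))))
    where
    scale : ∀ {n} (t : Fin n → ℕ) d → sum t ℕ.* d ≡ sum (λ i → t i ℕ.* d)
    scale {zero}  t d = ≡.refl
    scale {suc n} t d = ≡.trans (ℕ.*-distribʳ-+ d (t zero) _) (≡.cong (t zero ℕ.* d ℕ.+_) (scale (t ∘ suc) d))
    each : ∀ v → isInterior v ℕ.* d ℕ.≤ select (degree G ∘ proj₁) 0 v (interior? G v)
    each v with interior? G v
    ... | yes i = ℕ.≤-trans (ℕ.≤-reflexive (ℕ.+-identityʳ d)) (d≤ v i)
    ... | no _  = z≤n

module TreeRooting {n : ℕ} {G : Graph n} (tree : IsTree G) (r : Fin n) where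
  dists : ∃[ h ] (∀ v → IsDist G v r (h v))
  dists = Walks.distances G (proj₁ tree) r

  rootAt : Rooting G r
  rootAt = RootTree.rooting G (proj₂ tree) r (proj₁ dists) (proj₂ dists)

-- All degrees add up to 2 (n - 1), counted with an arbitrary root, and every boundary vertex
-- accounts for 1 of this sum.
degree-sum : ∀ {d N k} (G : Graph (suc N)) → 𝒯 d (suc N) k G → interiorDegreeSum G ℕ.+ 2 ≡ suc N ℕ.+ k
degree-sum {d} {N} {k} G t = ℕ.+-cancelʳ-≡ b _ _ (begin
  IDS ℕ.+ 2 ℕ.+ b             ≡⟨ swap IDS 2 b ⟩
  IDS ℕ.+ b ℕ.+ 2             ≡⟨ ≡.cong (ℕ._+ 2) (≡.trans (degree-partition boundary⊎interior) handshake) ⟩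
  N ℕ.+ N ℕ.+ 2               ≡⟨ ≡.trans (ℕ.+-comm (N ℕ.+ N) 2) (≡.cong suc (≡.sym (ℕ.+-suc N N))) ⟩
  suc N ℕ.+ suc N             ≡⟨ ≡.cong (suc N ℕ.+_) (≡.trans (≡.sym sum-partition) (≡.cong (ℕ._+ b) (≡.trans (≡.sym length-interiors) interior-count))) ⟩
  suc N ℕ.+ (k ℕ.+ b)         ≡⟨ ℕ.+-assoc (suc N) k b ⟨
  suc N ℕ.+ k ℕ.+ b           ∎)
  where
  open ≡.≡-Reasoning
  open 𝒯 t
  open IsTreeWithBoundary isTreeWithBoundary
  open InteriorSums G
  open Labelling (LabelRooting.labelling (TreeRooting.rootAt tree zero) Perm.id ≡.refl) using (handshake)
  IDS = interiorDegreeSum G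
  b = NatSums.sum isBoundary
  swap : ∀ x y z → x ℕ.+ y ℕ.+ z ≡ x ℕ.+ z ℕ.+ y
  swap x y z = ≡.trans (ℕ.+-assoc x y z) (≡.trans (≡.cong (x ℕ.+_) (ℕ.+-comm y z)) (≡.sym (ℕ.+-assoc x z y)))

-- The interior degrees are at least d and sum to n + k - 2, which leaves a surplus D ≥ 0. It
-- depends on n, k and d alone, so one spiral tree serves the whole class.
size-bound : ∀ {e N κ} (G : Graph (suc N)) → 𝒯 (suc (suc e)) (suc N) (suc κ) G → ∃[ D ] (N ≡ Spiral.m κ e 0 κ ℕ.+ D)
size-bound {e} {N} {κ} G t = N ℕ.∸ M , ≡.sym (ℕ.m+[n∸m]≡n M≤N)
  where
  open 𝒯 t
  M = Spiral.m κ e 0 κ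
  2κ≤ : suc κ ℕ.* suc (suc e) ℕ.+ 2 ℕ.≤ suc N ℕ.+ suc κ
  2κ≤ = ℕ.≤-trans (ℕ.+-monoˡ-≤ 2 (≡.subst (λ k → k ℕ.* suc (suc e) ℕ.≤ interiorDegreeSum G) interior-count (InteriorSums.degree-bound G _ interior-degree)))
    (ℕ.≤-reflexive (degree-sum G t))
  M≤N : M ℕ.≤ N
  M≤N = ℕ.≤-pred (ℕ.+-cancelʳ-≤ (suc κ) (suc M) (suc N) (ℕ.≤-trans (ℕ.≤-reflexive eq) 2κ≤))
    where
    eq : suc M ℕ.+ suc κ ≡ suc κ ℕ.* suc (suc e) ℕ.+ 2
    eq = ≡.trans (≡.cong (2 ℕ.+_) (≡.trans (ℕ.+-comm (suc κ ℕ.* suc e) (suc κ)) (≡.sym (ℕ.*-suc (suc κ) (suc e))))) (ℕ.+-comm 2 (suc κ ℕ.* suc (suc e)))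

-- Ground states of trees.

graphLaplacian : (K : OrderedDomain) → let open OrderedDomain K in ∀ {n} (G : Graph n) → (Fin n → Carrier) → Fin n → Carrier
graphLaplacian K G f v = sum (λ u → ι (b2n (adj G v u)) * (f v - f u))
  where open OrderedDomainProperties K

record GraphGroundState (K : OrderedDomain) {n} (G : Graph n) : Set where
  open OrderedDomainProperties K
  field
    μ        : Carrier
    f f⁻     : Fin n → Carrier
    vanish   : ∀ v → ¬ Interior G v → f v ≈ 0#
    positive : ∀ v → Interior G v → Pos (f v)
    inverse  : ∀ v → Interior G v → f v * f⁻ v ≈ 1#
    eigen    : ∀ v → Interior G v → graphLaplacian K G f v ≈ μ * f v

module LaplacianExpansion (K : OrderedDomain) {n : ℕ} (G : Graph n) where
  open NatSums using (sum)
  open Counting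
  open OrderedDomainProperties K hiding (sum)
  open OrderedDomainProperties K using () renaming (sum to ∑)

  ι-sum : ∀ {m} (t : Fin m → ℕ) → ι (sum t) ≈ ∑ (ι ∘ t)
  ι-sum {zero}  t = refl
  ι-sum {suc m} t = trans (ι-+ (t zero) _) (+-congˡ (ι-sum (t ∘ suc)))

  ∑-δ : ∀ {m} (v : Fin m) c (g : Fin m → Carrier) → ∑ (λ u → ι (δ (toℕ v) (toℕ u) ℕ.* c) * g u) ≈ ι c * g v
  ∑-δ zero    c g = trans (+-cong (*-congʳ (reflexive (≡.cong ι (ℕ.*-identityˡ c)))) (sum-zero (λ u → ι0* (g (suc u))))) (+-identityʳ _)
  ∑-δ (suc v) c g = trans (+-cong (ι0* (g zero)) (∑-δ v c (g ∘ suc))) (+-identityˡ _)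

  laplacian-expand : ∀ f v → graphLaplacian K G f v ≈ ι (degree G v) * f v - ∑ (λ u → ι (b2n (adj G v u)) * f u)
  laplacian-expand f v = trans (sum-cong-≋ (λ u → solve 3 (λ a x y → a :* (x :- y) := a :* x :- a :* y) refl (ι (b2n (adj G v u))) (f v) (f u)))
    (trans (sum-sub (λ u → ι (b2n (adj G v u)) * f v) (λ u → ι (b2n (adj G v u)) * f u))
      (+-congʳ (trans (sym (*-distribʳ-sum (f v) (λ u → ι (b2n (adj G v u)))))
        (*-congʳ (trans (sym (ι-sum (λ u → b2n (adj G v u)))) (reflexive (≡.cong ι (≡.sym (card-tabulate (adj G v))))))))))


module LazyWalk {n : ℕ} (G : Graph n) where
  open NatSums using (sum)
  open Counting

  -- Interior rows are those of n · 1 - (D - A): the shift by n makes all entries nonnegative and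
  -- the diagonal positive, and an eigenvalue ρ becomes n - ρ for the Laplacian. Zero rows at the
  -- boundary impose the Dirichlet condition.
  weight : ∀ v → Dec (Interior G v) → Fin n → ℕ
  weight v (yes _) u = b2n (adj G v u) ℕ.+ δ (toℕ v) (toℕ u) ℕ.* (n ℕ.∸ degree G v)
  weight v (no _)  u = 0

  w : Fin n → Fin n → ℕ
  w v = weight v (interior? G v)

  off : ∀ v u → ¬ Interior G v → w v u ≡ 0
  off v u ¬i with interior? G v
  ... | yes i = contradiction i ¬i
  ... | no _  = ≡.refl

  degree<n : ∀ v → degree G v ℕ.< n
  degree<n v = ≡.subst₂ ℕ._<_ (≡.sym (card-tabulate (adj G v))) (≡.trans (sum-const n 1) (ℕ.*-identityʳ n))
    (sum-mono-< (λ u → b2n≤1 (adj G v u)) v (ℕ.≤-reflexive (≡.cong (suc ∘ b2n) (loopless G v))))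

  loop : ∀ v → Interior G v → 1 ℕ.≤ w v v
  loop v i with interior? G v
  ... | yes _ = ℕ.≤-trans (ℕ.m<n⇒0<n∸m (degree<n v)) (ℕ.≤-trans (ℕ.≤-reflexive (≡.trans (≡.sym (ℕ.*-identityˡ _)) (≡.cong (ℕ._* (n ℕ.∸ degree G v)) (≡.sym (δ-refl (toℕ v))))))
                  (ℕ.m≤n+m _ (b2n (adj G v v))))
  ... | no ¬i = contradiction i ¬i

  link : ∀ {v u} → Interior G v → Adj G v u → 1 ℕ.≤ w v u
  link {v} {u} i a with interior? G v
  ... | yes _ = ℕ.≤-trans (ℕ.≤-reflexive (≡.sym (≡.cong b2n a))) (ℕ.m≤m+n (b2n (adj G v u)) _)
  ... | no ¬i = contradiction i ¬i

  w≤ : ∀ v u → w v u ℕ.≤ suc n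
  w≤ v u with interior? G v
  ... | no _  = z≤n
  ... | yes _ = ℕ.+-mono-≤ (b2n≤1 (adj G v u)) (ℕ.≤-trans (ℕ.*-mono-≤ (δ≤1 (toℕ v) (toℕ u)) (ℕ.m∸n≤m n (degree G v))) (ℕ.≤-reflexive (ℕ.*-identityˡ n)))
    where
    δ≤1 : ∀ a b → δ a b ℕ.≤ 1
    δ≤1 zero    zero    = ℕ.≤-refl
    δ≤1 zero    (suc b) = z≤n
    δ≤1 (suc a) zero    = z≤n
    δ≤1 (suc a) (suc b) = δ≤1 a b

  module ToGroundState (K : OrderedDomain) (pv : PerronVector K w (Interior G)) where
    open OrderedDomainProperties K hiding (sum)
    open OrderedDomainProperties K using () renaming (sum to ∑)
    open PerronVector pv
    open LaplacianExpansion K G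

    apply-interior : ∀ v → Interior G v → matrixApply K w f v ≈ ∑ (λ u → ι (b2n (adj G v u)) * f u) + ι (n ℕ.∸ degree G v) * f v
    apply-interior v i with interior? G v
    ... | no ¬i = contradiction i ¬i
    ... | yes _ = trans (sum-cong-≋ (λ u → trans (*-congʳ (ι-+ (b2n (adj G v u)) _)) (distribʳ (f u) _ _)))
      (trans (∑-distrib-+ (λ u → ι (b2n (adj G v u)) * f u) (λ u → ι (δ (toℕ v) (toℕ u) ℕ.* (n ℕ.∸ degree G v)) * f u))
        (+-congˡ (∑-δ v (n ℕ.∸ degree G v) f)))

    groundState : GraphGroundState K G
    groundState = record
      { μ = ι n - ρ ; f = f ; f⁻ = f⁻ ; vanish = vanish ; positive = positive ; inverse = inverse ; eigen = eig }
      where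
      eig : ∀ v → Interior G v → graphLaplacian K G f v ≈ (ι n - ρ) * f v
      eig v i = begin-equality
        graphLaplacian K G f v                                    ≈⟨ laplacian-expand f v ⟩
        ι (degree G v) * f v - A                                  ≈⟨ solve 4 (λ d x c a → d :* x :- a := (d :+ c) :* x :- (a :+ c :* x)) refl (ι (degree G v)) (f v) (ι (n ℕ.∸ degree G v)) A ⟩
        (ι (degree G v) + ι (n ℕ.∸ degree G v)) * f v - (A + ι (n ℕ.∸ degree G v) * f v)
          ≈⟨ +-cong (*-congʳ (trans (sym (ι-+ (degree G v) _)) (reflexive (≡.cong ι (ℕ.m+[n∸m]≡n (ℕ.<⇒≤ (degree<n v))))))) (-‿cong (trans (sym (apply-interior v i)) (eigen v))) ⟩
        ι n * f v - ρ * f v                                       ≈⟨ solve 3 (λ a r x → a :* x :- r :* x := (a :- r) :* x) refl (ι n) ρ (f v) ⟩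
        (ι n - ρ) * f v                                           ∎
        where A = ∑ (λ u → ι (b2n (adj G v u)) * f u)

module TreePerron {n : ℕ} (G : Graph n) (r : Fin n) (r-interior : Interior G r) (rt : Rooting G r) where
  open LazyWalk G
  open NatSums using (sum)
  open Counting
  open Rooting rt
  open Walks G using (Adj-sym)

  sum-two : ∀ {m} (t : Fin m → ℕ) {a b} → a ≢ b → t a ℕ.+ t b ℕ.≤ sum t
  sum-two t {zero}  {zero}  a≢b = contradiction ≡.refl a≢b
  sum-two t {zero}  {suc b} a≢b = ℕ.+-monoʳ-≤ (t zero) (term≤ (t ∘ suc) b)
  sum-two t {suc a} {zero}  a≢b = ℕ.≤-trans (ℕ.≤-reflexive (ℕ.+-comm (t (suc a)) (t zero))) (sum-two t {zero} {suc a} (a≢b ∘ ≡.sym))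
  sum-two t {suc a} {suc b} a≢b = ℕ.≤-trans (sum-two (t ∘ suc) (a≢b ∘ ≡.cong suc)) (ℕ.m≤n+m _ _)

  two-neighbours : ∀ {v a b} → Adj G v a → Adj G v b → a ≢ b → Interior G v
  two-neighbours {v} {a} {b} va vb a≢b = ≡.subst₂ ℕ._≤_ (≡.cong₂ ℕ._+_ (≡.cong b2n va) (≡.cong b2n vb)) (≡.sym (card-tabulate (adj G v)))
    (sum-two (λ u → b2n (adj G v u)) a≢b)

  -- A parent other than the root has two distinct neighbours, its child and its own parent. Hence
  -- walks between interior vertices through the root stay where the rows of `w` are nonzero.
  parent-interior : ∀ {v} → v ≢ r → Interior G (P v)
  parent-interior {v} v≢r with P v Fin.≟ r
  ... | yes eq = ≡.subst (Interior G) (≡.sym eq) r-interior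
  ... | no Pv≢r = two-neighbours (Adj-sym (P-adj v≢r)) (P-adj Pv≢r)
        (λ eq → ℕ.<-irrefl (≡.cong h (≡.sym eq)) (ℕ.≤-trans (ℕ.n≤1+n _) (ℕ.≤-reflexive (≡.sym (≡.trans (h-parent v≢r) (≡.cong suc (h-parent Pv≢r)))))))

  open Iteration ℚ-orderedDomain w (Interior G) (interior? G) r r-interior
  open Contraction ℚ-orderedDomain (Interior G) (interior? G) r r-interior using (NonNeg)

  root : ∀ v → h v ≡ 0 → v ≡ r
  root v hv with v Fin.≟ r
  ... | yes eq = eq
  ... | no v≢r with () ← ≡.trans (≡.sym hv) (h-parent v≢r)

  up : ∀ ℓ u → h u ≡ ℓ → Interior G u → ∀ {x} → NonNeg x → x u ℚ.≤ iterate ℓ x r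
  up zero    u hu iu {x} x≥0 = ℚ.≤-reflexive (≡.cong x (root u hu))
  up (suc ℓ) u hu iu {x} x≥0 = ℚ.≤-trans (entry≤T off x≥0 (link (parent-interior u≢r) (Adj-sym (P-adj u≢r))))
    (ℚ.≤-trans (up ℓ (P u) (ℕ.suc-injective (≡.trans (≡.sym (h-parent u≢r)) hu)) (parent-interior u≢r) (T-nonneg x≥0))
      (ℚ.≤-reflexive (≡.cong (λ y → y r) (≡.trans (≡.sym (iterate-+ ℓ 1 x)) (≡.cong (λ k → iterate k x) (ℕ.+-comm ℓ 1))))))
    where
    u≢r : u ≢ r
    u≢r ≡.refl with () ← ≡.trans (≡.sym h-root) hu

  down : ∀ ℓ v → h v ≡ ℓ → Interior G v → ∀ {x} → NonNeg x → x r ℚ.≤ iterate ℓ x v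
  down zero    v hv iv {x} x≥0 = ℚ.≤-reflexive (≡.cong x (≡.sym (root v hv)))
  down (suc ℓ) v hv iv {x} x≥0 = ℚ.≤-trans (down ℓ (P v) (ℕ.suc-injective (≡.trans (≡.sym (h-parent v≢r)) hv)) (parent-interior v≢r) x≥0)
    (entry≤T off (iterate-nonneg ℓ x≥0) (link iv (P-adj v≢r)))
    where
    v≢r : v ≢ r
    v≢r ≡.refl with () ← ≡.trans (≡.sym h-root) hv

  pad : ∀ j v → Interior G v → ∀ {x} → NonNeg x → x v ℚ.≤ iterate j x v
  pad zero    v iv x≥0 = ℚ.≤-refl
  pad (suc j) v iv x≥0 = ℚ.≤-trans (pad j v iv x≥0) (entry≤T off (iterate-nonneg j x≥0) (loop v iv))

  M : ℕ
  M = sum h ℕ.+ sum h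

  -- A walk leads from u up to the root, down to v, and then waits on the self-loop at v until its
  -- length is `suc M`, a common length for all pairs. Every step has weight at least 1.
  mixing : ∀ {x} → NonNeg x → ∀ {u v} → Interior G u → Interior G v → x u ℚ.≤ iterate (suc M) x v
  mixing {x} x≥0 {u} {v} iu iv = ℚ.≤-trans (up (h u) u ≡.refl iu x≥0) (ℚ.≤-trans (down (h v) v ≡.refl iv (iterate-nonneg (h u) x≥0))
    (ℚ.≤-trans (pad j v iv (iterate-nonneg (h v) (iterate-nonneg (h u) x≥0)))
      (ℚ.≤-reflexive (≡.cong (λ y → y v) (≡.trans (≡.cong (iterate j) (≡.sym (iterate-+ (h v) (h u) x))) (≡.trans (≡.sym (iterate-+ j (h v ℕ.+ h u) x)) (≡.cong (λ k → iterate k x) j+≡)))))))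
    where
    j = suc M ℕ.∸ (h v ℕ.+ h u)
    j+≡ : j ℕ.+ (h v ℕ.+ h u) ≡ suc M
    j+≡ = ℕ.m∸n+n≡m (ℕ.m≤n⇒m≤1+n (ℕ.+-mono-≤ (term≤ h v) (term≤ h u)))

  groundState : GraphGroundState ℝ-orderedDomain G
  groundState = ToGroundState.groundState ℝ-orderedDomain
    (Perron.perronVector w (Interior G) (interior? G) r r-interior off loop (suc n) (s≤s z≤n) w≤ M mixing)

tree-groundState : ∀ {n} (G : Graph n) → IsTreeWithBoundary G → GraphGroundState ℝ-orderedDomain G
tree-groundState G twb = TreePerron.groundState G (proj₁ V₀-nonempty) (proj₂ V₀-nonempty) (TreeRooting.rootAt tree (proj₁ V₀-nonempty))
  where open IsTreeWithBoundary twb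

module Coordinates (K : OrderedDomain) {N : ℕ} (G : Graph (suc N)) (lab : Labelling G) where
  open OrderedDomainProperties K
  open NatIndexedSums K
  open Energy K N
  open Labelling lab

  private
    extend : (Fin (suc N) → Carrier) → ∀ i → Dec (i ℕ.< suc N) → Carrier
    extend g i (yes lt) = g (Fin.fromℕ< lt)
    extend g i (no _)   = 0#

  coord : (Fin (suc N) → Carrier) → ℕ → Carrier
  coord f i = extend (λ j → f (σ ⟨$⟩ʳ j)) i (i ℕ.<? suc N)

  coord-toℕ : ∀ f (i : Fin (suc N)) → coord f (toℕ i) ≡ f (σ ⟨$⟩ʳ i)
  coord-toℕ f i with toℕ i ℕ.<? suc N
  ... | yes lt = ≡.cong (λ j → f (σ ⟨$⟩ʳ j)) (Fin.fromℕ<-toℕ i lt)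
  ... | no ≮   = contradiction (Fin.toℕ<n i) ≮

  coord-out : ∀ f {i} → N ℕ.< i → coord f i ≡ 0#
  coord-out f {i} N<i with i ℕ.<? suc N
  ... | yes lt = contradiction (ℕ.≤-trans lt N<i) (ℕ.<-irrefl ≡.refl)
  ... | no _   = ≡.refl

  index : ∀ {i} → i ℕ.≤ N → ∃[ j ] (toℕ {suc N} j ≡ i)
  index i≤N = Fin.fromℕ< (s≤s i≤N) , Fin.toℕ-fromℕ< (s≤s i≤N)

  L-coord : ∀ f i → L p (coord f) (toℕ i) ≈ graphLaplacian K G f (σ ⟨$⟩ʳ i)
  L-coord f i = trans
    (sum-cong-≋ {suc N} (λ j → *-cong (reflexive (≡.cong ι (≡.sym (spec i j)))) (reflexive (≡.cong₂ _-_ (coord-toℕ f i) (coord-toℕ f j)))))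
    (sym (sum-permute (λ u → ι (b2n (adj G (σ ⟨$⟩ʳ i) u)) * (f (σ ⟨$⟩ʳ i) - f u)) σ))

  I : ℕ → Set
  I i = Σ (i ℕ.< suc N) λ lt → Interior G (σ ⟨$⟩ʳ Fin.fromℕ< lt)

  I? : ∀ i → Dec (I i)
  I? i with i ℕ.<? suc N
  ... | no ≮   = no (≮ ∘ proj₁)
  ... | yes lt with interior? G (σ ⟨$⟩ʳ Fin.fromℕ< lt)
  ...   | yes int = yes (lt , int)
  ...   | no ¬int = no λ (lt′ , int) → ¬int int

  I-toℕ : ∀ i → Interior G (σ ⟨$⟩ʳ i) → I (toℕ i)
  I-toℕ i int = Fin.toℕ<n i , ≡.subst (λ j → Interior G (σ ⟨$⟩ʳ j)) (≡.sym (Fin.fromℕ<-toℕ i _)) int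

  I⇒ : ∀ {i} → I i → ∃[ j ] (toℕ {suc N} j ≡ i × Interior G (σ ⟨$⟩ʳ j))
  I⇒ (lt , int) = Fin.fromℕ< lt , Fin.toℕ-fromℕ< lt , int

  coord-vanish : ∀ {f} → (∀ v → ¬ Interior G v → f v ≈ 0#) → ∀ i → ¬ I i → coord f i ≈ 0#
  coord-vanish {f} h i ¬I with i ℕ.<? suc N
  ... | yes lt = h _ (λ int → ¬I (lt , int))
  ... | no _   = refl

  eigen-coord : ∀ {f ν} → (∀ v → Interior G v → graphLaplacian K G f v ≈ ν * f v) → ∀ i → I i → L p (coord f) i ≈ ν * coord f i
  eigen-coord {f} {ν} h i Ii with j , ≡.refl , int ← I⇒ Ii = trans (L-coord f j) (trans (h _ int) (*-congˡ (reflexive (≡.sym (coord-toℕ f j)))))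

  rayleigh-quotient : ∀ {f ν} → (∀ v → ¬ Interior G v → f v ≈ 0#) → (∀ v → Interior G v → graphLaplacian K G f v ≈ ν * f v) →
    E p (coord f) ≈ ν * ‖ coord f ‖²
  rayleigh-quotient {f} {ν} van eig = trans (sym (green p p≤N F)) (trans (S-cong (suc N) (λ i _ → each i (I? i))) (S-*ˡ (suc N) ν (λ i → F i * F i)))
    where
    F = coord f
    each : ∀ i → Dec (I i) → F i * L p F i ≈ ν * (F i * F i)
    each i (yes Ii) = trans (*-congˡ (eigen-coord eig i Ii)) (solve 2 (λ x n → x :* (n :* x) := n :* (x :* x)) refl (F i) ν)
    each i (no ¬Ii) = trans (*-congʳ F≈0) (trans (zeroˡ _) (sym (trans (*-congˡ (trans (*-congʳ F≈0) (zeroˡ _))) (zeroʳ ν))))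
      where F≈0 = coord-vanish van i ¬Ii

  norm-pos : ∀ f v → ¬ (f v ≈ 0#) → Pos ‖ coord f ‖²
  norm-pos f v f≉0 norm≤0 = f≉0 (trans (reflexive (≡.trans (≡.cong f (≡.sym (Perm.inverseʳ σ))) (≡.sym (coord-toℕ f i))))
    (square-≤0 (≤-trans (term≤S (suc N) (λ j _ → square-nonneg (coord f j)) (toℕ i) (Fin.toℕ<n i)) norm≤0)))
    where i = σ ⟨$⟩ˡ v

  module _ (gs : GraphGroundState K G) where
    open GraphGroundState gs

    groundState : GroundState p I μ (coord f) (coord f⁻)
    groundState = record
      { I? = I?
      ; vanish = coord-vanish vanish
      ; positive = λ i Ii → pos (I⇒ Ii)
      ; inverse = λ i Ii → inv (I⇒ Ii)
      ; eigen = λ i _ → eigen-coord eigen i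
      }
      where
      pos : ∀ {i} → ∃[ j ] (toℕ {suc N} j ≡ i × Interior G (σ ⟨$⟩ʳ j)) → Pos (coord f i)
      pos (j , ≡.refl , int) = ≡.subst Pos (≡.sym (coord-toℕ f j)) (positive _ int)
      inv : ∀ {i} → ∃[ j ] (toℕ {suc N} j ≡ i × Interior G (σ ⟨$⟩ʳ j)) → coord f i * coord f⁻ i ≈ 1#
      inv (j , ≡.refl , int) = trans (*-cong (reflexive (coord-toℕ f j)) (reflexive (coord-toℕ f⁻ j))) (inverse _ int)

    -- Jacobi's inequality for an arbitrary eigenfunction reads μ ‖g‖² ≤ E g = ν ‖g‖², and the norm
    -- of g is positive.
    smallest : ∀ {ν g} → (∀ v → ¬ Interior G v → g v ≈ 0#) → (∀ v → Interior G v → graphLaplacian K G g v ≈ ν * g v) →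
      ∀ v → ¬ (g v ≈ 0#) → μ ≤ ν
    smallest {ν} {g} van eig v g≉0 = *-cancelˡ-≤ (norm-pos g v g≉0) (≤-resp (*-comm _ _) (*-comm _ _)
      (≤-trans (Jacobi.rayleigh p p≤N groundState (coord g) (coord-vanish van)) (≤-reflexive (rayleigh-quotient van eig))))

-- Sorted labellings.

-- Breaking ties by parents is what makes the parent function monotone in the
-- equality case.
module ValueOrder (K : OrderedDomain) {n : ℕ} {G : Graph n} {r : Fin n} (rt : Rooting G r)
  (f : Fin n → OrderedDomain.Carrier K) (f≤? : ∀ u v → Dec (OrderedDomain._≤_ K (f u) (f v)))
  (f-max : ∀ v → OrderedDomain._≤_ K (f v) (f r)) where
  open OrderedDomainProperties K
  open Rooting rt

  Tie : Fin n → Fin n → Set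
  Tie u v = f u ≤ f v × f v ≤ f u

  Tie-trans : ∀ {u v w} → Tie u v → Tie v w → Tie u w
  Tie-trans (a , b) (c , d) = ≤-trans a c , ≤-trans d b

  data _≺_ : Fin n → Fin n → Set where
    larger      : ∀ {u v} → ¬ (f u ≤ f v) → u ≺ v
    root-first  : ∀ {u v} → Tie u v → u ≡ r → v ≢ r → u ≺ v
    by-parent   : ∀ {u v} → Tie u v → u ≢ r → v ≢ r → P u ≺ P v → u ≺ v
    by-index    : ∀ {u v} → Tie u v → u ≢ r → v ≢ r → P u ≡ P v → toℕ u ℕ.< toℕ v → u ≺ v

  ≺-irrefl : ∀ {u v} → u ≡ v → ¬ (u ≺ v)
  ≺-irrefl ≡.refl (larger gt)             = gt ≤-refl
  ≺-irrefl ≡.refl (root-first _ eq ne)    = ne eq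
  ≺-irrefl ≡.refl (by-parent _ _ _ lt)    = ≺-irrefl ≡.refl lt
  ≺-irrefl ≡.refl (by-index _ _ _ _ lt)   = ℕ.<-irrefl ≡.refl lt

  ≺⇒≥ : ∀ {u v} → u ≺ v → f v ≤ f u
  ≺⇒≥ (larger gt)                 = ≰⇒≥ gt
  ≺⇒≥ (root-first (_ , ge) _ _)   = ge
  ≺⇒≥ (by-parent (_ , ge) _ _ _)  = ge
  ≺⇒≥ (by-index (_ , ge) _ _ _ _) = ge

  ≺-trans : ∀ {u v w} → u ≺ v → v ≺ w → u ≺ w
  ≺-trans (larger gt) vw = larger λ le → gt (≤-trans le (≺⇒≥ vw))
  ≺-trans uv (larger gt) = larger λ le → gt (≤-trans (≺⇒≥ uv) le)
  ≺-trans (root-first _ _ v≢r) (root-first _ v≡r _) = contradiction v≡r v≢r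
  ≺-trans (root-first t u≡r _) (by-parent t′ _ w≢r _) = root-first (Tie-trans t t′) u≡r w≢r
  ≺-trans (root-first t u≡r _) (by-index t′ _ w≢r _ _) = root-first (Tie-trans t t′) u≡r w≢r
  ≺-trans (by-parent _ _ v≢r _) (root-first _ v≡r _) = contradiction v≡r v≢r
  ≺-trans (by-parent t u≢r _ lt) (by-parent t′ _ w≢r lt′) = by-parent (Tie-trans t t′) u≢r w≢r (≺-trans lt lt′)
  ≺-trans {u} (by-parent t u≢r _ lt) (by-index t′ _ w≢r eq _) = by-parent (Tie-trans t t′) u≢r w≢r (≡.subst (P u ≺_) eq lt)
  ≺-trans (by-index _ _ v≢r _ _) (root-first _ v≡r _) = contradiction v≡r v≢r
  ≺-trans {w = w} (by-index t u≢r _ eq _) (by-parent t′ _ w≢r lt) = by-parent (Tie-trans t t′) u≢r w≢r (≡.subst (_≺ P w) (≡.sym eq) lt)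
  ≺-trans (by-index t u≢r _ eq lt) (by-index t′ _ w≢r eq′ lt′) = by-index (Tie-trans t t′) u≢r w≢r (≡.trans eq eq′) (ℕ.<-trans lt lt′)

  -- Recursion on the height of u: tied vertices other than the root are referred to their parents,
  -- and only siblings are compared by index.
  ≺-connex : ∀ ℓ u v → h u ≡ ℓ → u ≢ v → u ≺ v ⊎ v ≺ u
  ≺-connex ℓ u v hu u≢v with f≤? u v | f≤? v u
  ... | no gt | _     = inj₁ (larger gt)
  ... | yes _ | no gt = inj₂ (larger gt)
  ... | yes le | yes ge = tied (u Fin.≟ r) (v Fin.≟ r) ℓ hu
    where
    t : Tie u v
    t = le , ge
    t′ : Tie v u
    t′ = ge , le
    tied : Dec (u ≡ r) → Dec (v ≡ r) → ∀ ℓ → h u ≡ ℓ → u ≺ v ⊎ v ≺ u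
    tied (yes u≡r) _         _ _ = inj₁ (root-first t u≡r (λ v≡r → u≢v (≡.trans u≡r (≡.sym v≡r))))
    tied (no u≢r)  (yes v≡r) _ _ = inj₂ (root-first t′ v≡r u≢r)
    tied (no u≢r)  (no v≢r)  zero    hu with () ← ≡.trans (≡.sym hu) (h-parent u≢r)
    tied (no u≢r)  (no v≢r)  (suc ℓ) hu with P u Fin.≟ P v
    ... | yes eq with ℕ.<-cmp (toℕ u) (toℕ v)
    ...   | tri< lt _ _ = inj₁ (by-index t u≢r v≢r eq lt)
    ...   | tri≈ _ eq′ _ = contradiction (Fin.toℕ-injective eq′) u≢v
    ...   | tri> _ _ gt = inj₂ (by-index t′ v≢r u≢r (≡.sym eq) gt)
    tied (no u≢r)  (no v≢r)  (suc ℓ) hu | no ne with ≺-connex ℓ (P u) (P v) (ℕ.suc-injective (≡.trans (≡.sym (h-parent u≢r)) hu)) ne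
    ...   | inj₁ lt = inj₁ (by-parent t u≢r v≢r lt)
    ...   | inj₂ gt = inj₂ (by-parent t′ v≢r u≢r gt)

  isStrictTotalOrder : IsStrictTotalOrder _≡_ _≺_
  isStrictTotalOrder = record
    { isStrictPartialOrder = record
      { isEquivalence = ≡.isEquivalence ; irrefl = ≺-irrefl ; trans = ≺-trans ; <-resp-≈ = ≡.resp₂ _≺_ }
    ; compare = cmp }
    where
    asym : ∀ {u v} → u ≺ v → ¬ (v ≺ u)
    asym lt gt = ≺-irrefl ≡.refl (≺-trans lt gt)
    cmp : ∀ u v → Tri (u ≺ v) (u ≡ v) (v ≺ u)
    cmp u v with u Fin.≟ v
    ... | yes eq = tri≈ (≺-irrefl eq) eq (≺-irrefl (≡.sym eq))
    ... | no ne with ≺-connex (h u) u v ≡.refl ne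
    ...   | inj₁ lt = tri< lt ne (asym lt)
    ...   | inj₂ gt = tri> (asym gt) ne gt

  ≺-root : ∀ {v} → v ≢ r → r ≺ v
  ≺-root {v} v≢r with f≤? r v
  ... | yes le = root-first (le , f-max v) ≡.refl v≢r
  ... | no gt  = larger gt

argmax : (K : OrderedDomain) → let open OrderedDomain K in ∀ {n} (f : Fin (suc n) → Carrier) → (∀ u v → Dec (f u ≤ f v)) →
  ∃[ r ] (∀ v → f v ≤ f r)
argmax K {zero}  f f≤? = zero , λ { zero → OrderedDomain.≤-reflexive K (OrderedDomain.refl K) }
argmax K {suc n} f f≤? with argmax K (f ∘ suc) (λ u v → f≤? (suc u) (suc v))
... | r , max with f≤? zero (suc r)
...   | yes le = suc r , λ { zero → le ; (suc v) → max v }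
...   | no gt  = zero , λ { zero → OrderedDomain.≤-reflexive K (OrderedDomain.refl K) ; (suc v) → OrderedDomain.≤-trans K (max v) (OrderedDomain.≰⇒≥ K gt) }

record SortedLabelling (K : OrderedDomain) {N : ℕ} (H : Graph (suc N)) (f : Fin (suc N) → OrderedDomain.Carrier K) : Set where
  open OrderedDomain K using (_≤_)
  field
    lab : Labelling H
  open Labelling lab public
  field
    sorted : ∀ {i j} → toℕ i ℕ.< toℕ j → f (σ ⟨$⟩ʳ j) ≤ f (σ ⟨$⟩ʳ i)
    ties   : ∀ (a b : Fin N) → toℕ a ℕ.< toℕ b → f (σ ⟨$⟩ʳ suc a) ≤ f (σ ⟨$⟩ʳ suc b) → p (toℕ a) ℕ.≤ p (toℕ b)

module Sorting (K : OrderedDomain) {N : ℕ} (H : Graph (suc N)) (f : Fin (suc N) → OrderedDomain.Carrier K)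
  (f≤? : ∀ u v → Dec (OrderedDomain._≤_ K (f u) (f v)))
  (r : Fin (suc N)) (f-max : ∀ v → OrderedDomain._≤_ K (f v) (f r)) (rt : Rooting H r) where
  open OrderedDomainProperties K
  open Rooting rt
  open ValueOrder K rt f f≤? f-max

  module _ (τ : Permutation′ (suc N)) (τ-increasing : ∀ {i j} → toℕ i ℕ.< toℕ j → (τ ⟨$⟩ʳ i) ≺ (τ ⟨$⟩ʳ j)) where

    τ-reflects : ∀ {i j} → (τ ⟨$⟩ʳ i) ≺ (τ ⟨$⟩ʳ j) → toℕ i ℕ.< toℕ j
    τ-reflects {i} {j} lt with ℕ.<-cmp (toℕ i) (toℕ j)
    ... | tri< i<j _ _ = i<j
    ... | tri≈ _ eq _ = contradiction lt (≺-irrefl (≡.cong (τ ⟨$⟩ʳ_) (Fin.toℕ-injective eq)))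
    ... | tri> _ _ j<i = contradiction (≺-trans lt (τ-increasing j<i)) (≺-irrefl ≡.refl)

    τ0≡r : τ ⟨$⟩ʳ zero ≡ r
    τ0≡r with (τ ⟨$⟩ʳ zero) Fin.≟ r
    ... | yes eq = eq
    ... | no ne  = contradiction (τ-reflects {τ ⟨$⟩ˡ r} {zero} (≡.subst (_≺ (τ ⟨$⟩ʳ zero)) (≡.sym (Perm.inverseʳ τ)) (≺-root ne))) λ ()

    open LabelRooting rt τ τ0≡r using (labelling; p; p-parent; nonroot)

    order-ties : ∀ (a b : Fin N) → f (τ ⟨$⟩ʳ suc a) ≤ f (τ ⟨$⟩ʳ suc b) → (τ ⟨$⟩ʳ suc a) ≺ (τ ⟨$⟩ʳ suc b) → p (toℕ a) ℕ.≤ p (toℕ b)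
    order-ties a b tie (larger gt) = contradiction tie gt
    order-ties a b tie (root-first _ eq _) = contradiction eq (nonroot a)
    order-ties a b tie (by-parent _ _ _ lt) = ≡.subst₂ ℕ._≤_ (≡.sym (p-parent a)) (≡.sym (p-parent b))
      (ℕ.<⇒≤ (τ-reflects (≡.subst₂ _≺_ (≡.sym (Perm.inverseʳ τ)) (≡.sym (Perm.inverseʳ τ)) lt)))
    order-ties a b tie (by-index _ _ _ eq _) = ℕ.≤-reflexive (≡.trans (p-parent a) (≡.trans (≡.cong (λ u → toℕ (τ ⟨$⟩ˡ u)) eq) (≡.sym (p-parent b))))

    sortedBy : SortedLabelling K H f
    sortedBy = record
      { lab = labelling
      ; sorted = λ i<j → ≺⇒≥ (τ-increasing i<j)
      ; ties = λ a b a<b tie → order-ties a b tie (τ-increasing {suc a} {suc b} (s≤s a<b))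
      }

  sortedLabelling : SortedLabelling K H f
  sortedLabelling = sortedBy (Ranking.enumeration isStrictTotalOrder) (Ranking.enumeration-increasing isStrictTotalOrder)

sort-tree : (K : OrderedDomain) → ∀ {N} (H : Graph (suc N)) → IsTree H → ∀ f →
  (∀ u v → Dec (OrderedDomain._≤_ K (f u) (f v))) → SortedLabelling K H f
sort-tree K H tree f f≤? = let r , max = argmax K f f≤? in
  Sorting.sortedLabelling K H f f≤? r max (TreeRooting.rootAt tree r)

module SortedTree (K : OrderedDomain) (κ e D : ℕ) (H : Graph (suc (Spiral.N κ e D)))
  (t : 𝒯 (suc (suc e)) (suc (Spiral.N κ e D)) (suc κ) H) (gs : GraphGroundState K H)
  (sl : SortedLabelling K H (GraphGroundState.f gs)) where
  open OrderedDomainProperties K hiding (sum)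
  open Spiral κ e D
  open 𝒯 t
  open IsTreeWithBoundary isTreeWithBoundary
  open GraphGroundState gs
  open SortedLabelling sl
  open Coordinates K H lab
  open Rearrangement K κ e D using (Descending)

  F : ℕ → Carrier
  F = coord f

  f-nonneg : ∀ v → 0# ≤ f v
  f-nonneg v with interior? H v
  ... | yes i = Pos⇒0≤ (positive v i)
  ... | no ¬i = ≤-reflexive (sym (vanish v ¬i))

  F-at : ∀ {i} (i≤N : i ℕ.≤ N) → F i ≡ f (σ ⟨$⟩ʳ proj₁ (index i≤N))
  F-at i≤N = ≡.trans (≡.cong F (≡.sym (proj₂ (index i≤N)))) (coord-toℕ f (proj₁ (index i≤N)))

  F-descending : Descending F
  F-descending i = case (suc i ℕ.≤? N)
    where
    nonneg : Dec (i ℕ.≤ N) → 0# ≤ F i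
    nonneg (yes i≤N) = ≤-resp refl (reflexive (≡.sym (F-at i≤N))) (f-nonneg _)
    nonneg (no i≰N)  = ≤-reflexive (reflexive (≡.sym (coord-out f (ℕ.≰⇒> i≰N))))
    case : Dec (suc i ℕ.≤ N) → F (suc i) ≤ F i
    case (no i≥N)  = ≤-resp (reflexive (≡.sym (coord-out f (ℕ.≰⇒> i≥N)))) refl (nonneg (i ℕ.≤? N))
    case (yes i<N) = ≤-resp (reflexive (≡.sym (F-at i<N))) (reflexive (≡.sym (F-at (ℕ.<⇒≤ i<N))))
      (sorted (≡.subst₂ ℕ._<_ (≡.sym (proj₂ (index (ℕ.<⇒≤ i<N)))) (≡.sym (proj₂ (index i<N))) ℕ.≤-refl))

  F-ties : ∀ {x y} → x ℕ.< y → y ℕ.< N → F (suc x) ≤ F (suc y) → p x ℕ.≤ p y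
  F-ties {x} {y} x<y y<N tie = ≡.subst₂ (λ a b → p a ℕ.≤ p b) a≡ b≡ (ties a b (≡.subst₂ ℕ._<_ (≡.sym a≡) (≡.sym b≡) x<y)
    (≤-resp (reflexive (≡.trans (≡.cong (F ∘ suc) (≡.sym a≡)) (coord-toℕ f (suc a)))) (reflexive (≡.trans (≡.cong (F ∘ suc) (≡.sym b≡)) (coord-toℕ f (suc b)))) tie))
    where
    a b : Fin N
    a = Fin.fromℕ< (ℕ.<-trans x<y y<N)
    b = Fin.fromℕ< y<N
    a≡ : toℕ a ≡ x
    a≡ = Fin.toℕ-fromℕ< (ℕ.<-trans x<y y<N)
    b≡ : toℕ b ≡ y
    b≡ = Fin.toℕ-fromℕ< y<N

module InteriorFirst (κ e D : ℕ) (H : Graph (suc (Spiral.N κ e D)))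
  (t : 𝒯 (suc (suc e)) (suc (Spiral.N κ e D)) (suc κ) H) (lab : Labelling H)
  (closed : ∀ {i j} → toℕ i ℕ.< toℕ j → Interior H (Labelling.σ lab ⟨$⟩ʳ j) → Interior H (Labelling.σ lab ⟨$⟩ʳ i)) where
  open Spiral κ e D
  open 𝒯 t
  open IsTreeWithBoundary isTreeWithBoundary
  open Labelling lab
  open InteriorSums H
  open NatSums using (sum-permute; sum-cong-≗)
  open Counting

  private
    extend : ∀ i → Dec (i ℕ.< suc N) → ℕ
    extend i (yes lt) = isBoundary (σ ⟨$⟩ʳ Fin.fromℕ< lt)
    extend i (no _)   = 1

    -- Zero at interior and one at boundary vertices. By `closed` it is monotone, so
    -- `monotone-initial` at threshold 0 identifies the κ + 1 interior vertices with the indices 0,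
    -- ..., κ.
    code : ℕ → ℕ
    code i = extend i (i ℕ.<? suc N)

    code-toℕ : ∀ (i : Fin (suc N)) → code (toℕ i) ≡ isBoundary (σ ⟨$⟩ʳ i)
    code-toℕ i = at (toℕ i ℕ.<? suc N)
      where
      at : (d : Dec (toℕ i ℕ.< suc N)) → extend (toℕ i) d ≡ isBoundary (σ ⟨$⟩ʳ i)
      at (yes lt) = ≡.cong (λ j → isBoundary (σ ⟨$⟩ʳ j)) (Fin.fromℕ<-toℕ i lt)
      at (no ≮)   = contradiction (Fin.toℕ<n i) ≮

    interior-0 : ∀ v → Interior H v → isBoundary v ≡ 0
    interior-0 v int with interior? H v
    ... | yes _   = ≡.refl
    ... | no ¬int = contradiction int ¬int

    boundary-1 : ∀ v → ¬ Interior H v → isBoundary v ≡ 1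
    boundary-1 v ¬int with interior? H v
    ... | yes int = contradiction int ¬int
    ... | no _    = ≡.refl

    ≤0-interior : ∀ v → isBoundary v ℕ.≤ 0 → Interior H v
    ≤0-interior v le with interior? H v
    ... | yes int = int

    total : count≤ (suc N) code 0 ≡ suc κ
    total = ≡.trans (sum-cong-≗ {suc N} (λ i → ≡.trans (≡.cong (λ b → ⟦ b ≤ 0 ⟧) (code-toℕ i)) (flip (σ ⟨$⟩ʳ i))))
      (≡.trans (≡.sym (sum-permute isInterior σ)) (≡.trans (≡.sym length-interiors) interior-count))
      where
      flip : ∀ v → ⟦ isBoundary v ≤ 0 ⟧ ≡ isInterior v
      flip v with interior? H v
      ... | yes _ = ≡.refl
      ... | no _  = ≡.refl

    mono : Monotone (suc N) code
    mono {x} {y} x<y y<n = ≡.subst₂ (λ a b → code a ℕ.≤ code b) i≡ j≡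
      (≡.subst₂ ℕ._≤_ (≡.sym (code-toℕ i)) (≡.sym (code-toℕ j)) (cmp (interior? H (σ ⟨$⟩ʳ j))))
      where
      i j : Fin (suc N)
      i = Fin.fromℕ< (ℕ.<-trans x<y y<n)
      j = Fin.fromℕ< y<n
      i≡ : toℕ i ≡ x
      i≡ = Fin.toℕ-fromℕ< (ℕ.<-trans x<y y<n)
      j≡ : toℕ j ≡ y
      j≡ = Fin.toℕ-fromℕ< y<n
      cmp : Dec (Interior H (σ ⟨$⟩ʳ j)) → isBoundary (σ ⟨$⟩ʳ i) ℕ.≤ isBoundary (σ ⟨$⟩ʳ j)
      cmp (yes int) = ℕ.≤-trans (ℕ.≤-reflexive (interior-0 _ (closed (≡.subst₂ ℕ._<_ (≡.sym i≡) (≡.sym j≡) x<y) int))) z≤n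
      cmp (no ¬int) = ℕ.≤-trans (b2n≤1 _) (ℕ.≤-reflexive (≡.sym (boundary-1 _ ¬int)))

    initial : ∀ i → (toℕ i ℕ.< suc κ → Interior H (σ ⟨$⟩ʳ i)) × (suc κ ℕ.≤ toℕ i → ¬ Interior H (σ ⟨$⟩ʳ i))
    initial i =
        (λ lt → ≤0-interior _ (≡.subst (ℕ._≤ 0) (code-toℕ i) (proj₁ both (≡.subst (toℕ i ℕ.<_) (≡.sym total) lt))))
      , (λ le int → ℕ.<⇒≱ (≡.subst (0 ℕ.<_) (code-toℕ i) (proj₂ both (≡.subst (ℕ._≤ toℕ i) (≡.sym total) le))) (ℕ.≤-reflexive (interior-0 _ int)))
      where both = monotone-initial (suc N) code 0 mono (toℕ i) (Fin.toℕ<n i)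

  ≤κ⇒interior : ∀ i → toℕ i ℕ.≤ κ → Interior H (σ ⟨$⟩ʳ i)
  ≤κ⇒interior i le = proj₁ (initial i) (s≤s le)

  interior⇒≤κ : ∀ i → Interior H (σ ⟨$⟩ʳ i) → toℕ i ℕ.≤ κ
  interior⇒≤κ i int = ℕ.≮⇒≥ (λ lt → proj₂ (initial i) lt int)

  -- The only edge of a boundary vertex other than the root leads to its parent.
  children-boundary : ∀ j → κ ℕ.< j → j ℕ.≤ N → children j ≡ 0
  children-boundary (suc j) κ<j j≤N = ℕ.suc-injective (≡.trans (≡.sym (≡.trans (degree-suc i) (≡.cong (λ a → ℕ.suc (children (ℕ.suc a))) i≡))) (leaf (boundary⊎interior _)))
    where
    i : Fin N
    i = Fin.fromℕ< j≤N
    i≡ : toℕ i ≡ j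
    i≡ = Fin.toℕ-fromℕ< j≤N
    leaf : Boundary H (σ ⟨$⟩ʳ suc i) ⊎ Interior H (σ ⟨$⟩ʳ suc i) → degree H (σ ⟨$⟩ʳ suc i) ≡ 1
    leaf (inj₁ b)   = b
    leaf (inj₂ int) = contradiction (interior⇒≤κ (suc i) int) (ℕ.<⇒≱ (≡.subst (κ ℕ.<_) (≡.cong suc (≡.sym i≡)) κ<j))

  p≤κ : ∀ x → x ℕ.< N → p x ℕ.≤ κ
  p≤κ x x<N = ℕ.≮⇒≥ λ κ<px → contradiction
    (≡.trans (≡.sym (δ-refl (p x))) (≡.trans (≡.cong (λ y → δ (p y) (p x)) (≡.sym (Fin.toℕ-fromℕ< x<N)))
      (sum-zero⇒ {N} {λ y → δ (p (toℕ y)) (p x)} (children-boundary (p x) κ<px (p≤N x x<N)) (Fin.fromℕ< x<N)))) λ ()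

  children-degree : ∀ i → suc i ℕ.≤ κ → ∃[ v ] (Interior H v × degree H v ≡ suc (children (suc i)) × toℕ (σ ⟨$⟩ˡ v) ≡ suc i)
  children-degree i i<κ = σ ⟨$⟩ʳ suc j , ≤κ⇒interior (suc j) (≡.subst (ℕ._≤ κ) (≡.cong suc (≡.sym j≡)) i<κ)
    , ≡.trans (degree-suc j) (≡.cong (λ a → ℕ.suc (children (ℕ.suc a))) j≡) , ≡.trans (≡.cong toℕ (Perm.inverseˡ σ)) (≡.cong suc j≡)
    where
    i<N : i ℕ.< N
    i<N = ℕ.≤-trans i<κ κ≤N
    j : Fin N
    j = Fin.fromℕ< i<N
    j≡ : toℕ j ≡ i
    j≡ = Fin.toℕ-fromℕ< i<N

  dominating : Dominating p
  dominating = record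
    { p≤κ = p≤κ
    ; m₀≤count = ℕ.≤-trans (ℕ.≤-reflexive (≡.cong suc (ℕ.+-identityʳ q)))
        (ℕ.≤-trans (interior-degree _ (≤κ⇒interior zero z≤n)) (ℕ.≤-reflexive (≡.trans degree-root (≡.sym count-root))))
    ; count-suc = λ t t<κ → ℕ.≤-trans (ℕ.+-monoʳ-≤ (count≤ N p t) (q≤ t t<κ)) (ℕ.≤-reflexive (≡.sym (count-children t)))
    }
    where
    q≤ : ∀ t → t ℕ.< κ → q ℕ.≤ children (suc t)
    q≤ t t<κ = let v , int , deg , _ = children-degree t t<κ in ℕ.≤-pred (ℕ.≤-trans (interior-degree v int) (ℕ.≤-reflexive deg))

record SpiralIso (κ e D : ℕ) (G : Graph (suc (Spiral.N κ e D))) : Set where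
  open Spiral κ e D
  field
    σ    : Permutation′ (suc N)
    spec : ∀ i j → b2n (adj G (σ ⟨$⟩ʳ i) (σ ⟨$⟩ʳ j)) ≡ edges p* (toℕ i) (toℕ j)

  labelling : Labelling G
  labelling = record { σ = σ ; p = p* ; p≤N = λ x _ → ℕ.≤-trans (p*≤κ x) κ≤N ; spec = spec }

ch-cong : ∀ {N p p′} → (∀ x → x ℕ.< N → p x ≡ p′ x) → ∀ i j → i ℕ.≤ N → ch p i j ≡ ch p′ i j
ch-cong eq zero    j _   = ≡.refl
ch-cong eq (suc x) j x<N = ≡.cong (λ a → δ a j) (eq x x<N)

toSpiralIso : ∀ {κ e D} {G : Graph (suc (Spiral.N κ e D))} (lab : Labelling G) →
  (∀ x → x ℕ.< Spiral.N κ e D → Labelling.p lab x ≡ Spiral.p* κ e D x) → SpiralIso κ e D G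
toSpiralIso {κ} {e} {D} lab eq = record
  { σ = σ
  ; spec = λ i j → ≡.trans (spec i j) (≡.cong₂ ℕ._+_ (ch-cong eq (toℕ i) (toℕ j) (ℕ.≤-pred (Fin.toℕ<n i))) (ch-cong eq (toℕ j) (toℕ i) (ℕ.≤-pred (Fin.toℕ<n j))))
  }
  where open Labelling lab

module SpiralDegrees (κ e D : ℕ) {G : Graph (suc (Spiral.N κ e D))} (iso : SpiralIso κ e D G) where
  open Spiral κ e D
  open SpiralIso iso using (labelling; σ)
  open Labelling labelling using (children; count-children; count-root; degree-root; degree-suc)
  open Counting

  count-all : count≤ N p* κ ≡ N
  count-all = ≡.trans (C-cong N (λ x _ → ⟦≤⟧-yes (p*≤κ x))) (≡.trans (sum-const N 1) (ℕ.*-identityʳ N))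

  surplus-at : ∀ i → i ℕ.≤ κ → ∃[ s ] (count≤ N p* i ≡ m i ℕ.+ s × (i ℕ.< κ → s ≡ 0) × (i ≡ κ → s ≡ D))
  surplus-at i i≤κ with ℕ.m≤n⇒m<n∨m≡n i≤κ
  ... | inj₁ i<κ = 0 , ≡.trans (count-p* i<κ) (≡.sym (ℕ.+-identityʳ (m i))) , (λ _ → ≡.refl) , λ i≡κ → contradiction i<κ (ℕ.<-irrefl i≡κ)
  ... | inj₂ ≡.refl = D , count-all , (λ i<κ → contradiction i<κ (ℕ.<-irrefl ≡.refl)) , λ _ → ≡.refl

  degree-spiral : ∀ i → toℕ i ℕ.≤ κ → ∃[ s ] (degree G (σ ⟨$⟩ʳ i) ≡ suc q ℕ.+ s × (toℕ i ℕ.< κ → s ≡ 0) × (toℕ i ≡ κ → s ≡ D))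
  degree-spiral zero i≤κ = let s , eq , lo , hi = surplus-at 0 i≤κ in
    s , ≡.trans degree-root (≡.trans (≡.sym count-root) (≡.trans eq (≡.cong (λ a → suc a ℕ.+ s) (ℕ.+-identityʳ q)))) , lo , hi
  degree-spiral (suc i) i<κ = let s , eq , lo , hi = surplus-at (suc (toℕ i)) i<κ in
    s , ≡.trans (degree-suc i) (≡.cong suc (ℕ.+-cancelˡ-≡ (m (toℕ i)) _ _ (≡.trans (≡.cong (ℕ._+ children (suc (toℕ i))) (≡.sym (count-p* i<κ)))
      (≡.trans (≡.sym (count-children (toℕ i))) (≡.trans eq (≡.trans (≡.cong (ℕ._+ s) (m-suc (toℕ i))) (ℕ.+-assoc (m (toℕ i)) q s))))))) , lo , hi

  degree-leaf : ∀ i → κ ℕ.< toℕ i → degree G (σ ⟨$⟩ʳ i) ≡ 1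
  degree-leaf (suc i) κ<i = ≡.trans (degree-suc i) (≡.cong suc (≡.trans (C-cong N (λ x _ → δ-≢ (λ eq → ℕ.<⇒≱ κ<i (≡.subst (ℕ._≤ κ) eq (p*≤κ x))))) (≡.trans (sum-const N 0) (ℕ.*-zeroʳ N))))

  interior⇒≤κ : ∀ i → Interior G (σ ⟨$⟩ʳ i) → toℕ i ℕ.≤ κ
  interior⇒≤κ i int = ℕ.≮⇒≥ λ lt → contradiction (≡.subst (2 ℕ.≤_) (degree-leaf i lt) int) λ { (s≤s ()) }

  ≤κ⇒interior : ∀ i → toℕ i ℕ.≤ κ → Interior G (σ ⟨$⟩ʳ i)
  ≤κ⇒interior i le = let s , eq , _ = degree-spiral i le in ≡.subst (2 ℕ.≤_) (≡.sym eq) (s≤s (s≤s z≤n))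

-- Comparison of a tree of the class with the spiral tree.

module Comparison (K : OrderedDomain) (κ e D : ℕ)
  (G : Graph (suc (Spiral.N κ e D))) (iso : SpiralIso κ e D G) (gsG : GraphGroundState K G)
  (H : Graph (suc (Spiral.N κ e D))) (t : 𝒯 (suc (suc e)) (suc (Spiral.N κ e D)) (suc κ) H) (gsH : GraphGroundState K H)
  (sl : SortedLabelling K H (GraphGroundState.f gsH))
  (f≤? : ∀ u v → Dec (OrderedDomain._≤_ K (GraphGroundState.f gsH u) (GraphGroundState.f gsH v))) where
  open OrderedDomainProperties K
  open Spiral κ e D
  open Energy K N
  open Rearrangement K κ e D
  open SpiralTies K κ e D using (μ-pos)
  open SortedTree K κ e D H t gsH sl
  open SortedLabelling sl using (lab; sorted; p)
  module GG = GraphGroundState gsG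
  module GH = GraphGroundState gsH
  module CG = Coordinates K G (SpiralIso.labelling iso)
  module CH = Coordinates K H lab
  open SpiralDegrees κ e D iso using () renaming (≤κ⇒interior to G-≤κ⇒interior)

  private
    closed : ∀ {i j} → toℕ i ℕ.< toℕ j → Interior H (Labelling.σ lab ⟨$⟩ʳ j) → Interior H (Labelling.σ lab ⟨$⟩ʳ i)
    closed {i} {j} i<j int = case (interior? H (Labelling.σ lab ⟨$⟩ʳ i))
      where
      case : Dec (Interior H (Labelling.σ lab ⟨$⟩ʳ i)) → Interior H (Labelling.σ lab ⟨$⟩ʳ i)
      case (yes inti) = inti
      case (no ¬inti) = contradiction (≤-trans (sorted i<j) (≤-reflexive (GH.vanish _ ¬inti))) (GH.positive _ int)

  open InteriorFirst κ e D H t lab closed using (≤κ⇒interior; interior⇒≤κ; dominating)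

  F-zero : ∀ i → κ ℕ.< i → F i ≈ 0#
  F-zero i κ<i = CH.coord-vanish GH.vanish i (λ Ii → out (CH.I⇒ Ii))
    where
    out : ∃[ j ] (toℕ {suc N} j ≡ i × Interior H (Labelling.σ lab ⟨$⟩ʳ j)) → _
    out (j , ≡.refl , int) = ℕ.<⇒≱ κ<i (interior⇒≤κ j int)

  F-pos : ∀ i → i ℕ.≤ κ → Pos (F i)
  F-pos i i≤κ = at (CH.index (ℕ.≤-trans i≤κ κ≤N)) 
    where
    at : ∃[ j ] (toℕ {suc N} j ≡ i) → Pos (F i)
    at (j , ≡.refl) = ≡.subst Pos (≡.sym (CH.coord-toℕ GH.f j)) (GH.positive _ (≤κ⇒interior j i≤κ))

  F-vanishG : ∀ i → ¬ CG.I i → F i ≈ 0#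
  F-vanishG i ¬I = F-zero i (ℕ.≰⇒> λ i≤κ → ¬I (inside i≤κ (CG.index (ℕ.≤-trans i≤κ κ≤N))))
    where
    inside : i ℕ.≤ κ → ∃[ j ] (toℕ {suc N} j ≡ i) → CG.I i
    inside i≤κ (j , ≡.refl) = CG.I-toℕ j (G-≤κ⇒interior j i≤κ)

  energyH : E p F ≈ GH.μ * ‖ F ‖²
  energyH = CH.rayleigh-quotient GH.vanish GH.eigen

  module JG = Jacobi p* (λ x _ → ℕ.≤-trans (p*≤κ x) κ≤N) (CG.groundState gsG)

  norm-F-pos : Pos ‖ F ‖²
  norm-F-pos = CH.norm-pos GH.f v (λ eq → GH.positive v int (≤-reflexive eq))
    where
    v = Labelling.σ lab ⟨$⟩ʳ zero
    int = ≤κ⇒interior zero z≤n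

  energyG≤ : GG.μ * ‖ F ‖² ≤ E p* F
  energyG≤ = JG.rayleigh F F-vanishG

  E*≤E : E p* F ≤ E p F
  E*≤E = rearrangement F F-descending p dominating

  -- F is admissible on the spiral tree because both trees have their interior at the indices 0,
  -- ..., κ. The norm ‖F‖² is common to both ends of the chain of energies and cancels.
  μ≤ : GG.μ ≤ GH.μ
  μ≤ = *-cancelˡ-≤ norm-F-pos (≤-resp (*-comm _ _) (*-comm _ _) (≤-trans energyG≤ (≤-trans E*≤E (≤-reflexive energyH))))

  module _ (μH≤μG : GH.μ ≤ GG.μ) where

    μ-norm : GH.μ * ‖ F ‖² ≤ GG.μ * ‖ F ‖²
    μ-norm = ≤-resp (*-comm _ _) (*-comm _ _) (*-monoˡ-≤ (Pos⇒0≤ norm-F-pos) μH≤μG)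

    tightG : E p* F ≤ GG.μ * ‖ F ‖²
    tightG = ≤-trans E*≤E (≤-trans (≤-reflexive energyH) μ-norm)

    eigenG : ∀ i → i ℕ.≤ κ → L p* F i ≈ GG.μ * F i
    eigenG i i≤κ = JG.tight⇒eigen F F-vanishG tightG i (ℕ.≤-trans i≤κ κ≤N) (inside (CG.index (ℕ.≤-trans i≤κ κ≤N)))
      where
      inside : ∃[ j ] (toℕ {suc N} j ≡ i) → CG.I i
      inside (j , ≡.refl) = CG.I-toℕ j (G-≤κ⇒interior j i≤κ)

    F≤? : ∀ s u → Dec (F s ≤ F u)
    F≤? s u = cmp (value s (s ℕ.≤? κ)) (value u (u ℕ.≤? κ))
      where
      Value : ℕ → Set
      Value i = (∃[ v ] (F i ≡ GH.f v × Pos (F i))) ⊎ (F i ≈ 0#)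
      value : ∀ i → Dec (i ℕ.≤ κ) → Value i
      value i (no i≰κ)  = inj₂ (F-zero i (ℕ.≰⇒> i≰κ))
      value i (yes i≤κ) = at (CH.index (ℕ.≤-trans i≤κ κ≤N))
        where
        at : ∃[ j ] (toℕ {suc N} j ≡ i) → Value i
        at (j , ≡.refl) = inj₁ (_ , CH.coord-toℕ GH.f j , F-pos i i≤κ)
      cmp : Value s → Value u → Dec (F s ≤ F u)
      cmp (inj₁ (v , eq , _)) (inj₁ (v′ , eq′ , _)) = ≡.subst₂ (λ a b → Dec (a ≤ b)) (≡.sym eq) (≡.sym eq′) (f≤? v v′)
      cmp (inj₁ (_ , _ , pos)) (inj₂ zero≈) = no λ le → pos (≤-trans le (≤-reflexive zero≈))
      cmp (inj₂ zero≈) (inj₁ (_ , _ , pos)) = yes (≤-trans (≤-reflexive zero≈) (Pos⇒0≤ pos))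
      cmp (inj₂ zero≈) (inj₂ zero≈′) = yes (≤-reflexive (trans zero≈ (sym zero≈′)))

    rigidity : SpiralIso κ e D H
    rigidity = toSpiralIso lab (Rigidity.rigid K κ e D F F-descending F-zero F-pos F≤? GG.μ
      (μ-pos F F-descending F-zero F-pos GG.μ eigenG (≤-antisym energyG≤ tightG))
      eigenG p dominating (Labelling.loopless′ lab) F-ties (≤-trans (≤-reflexive energyH) (≤-trans μ-norm energyG≤)))

-- Every SLO*-tree with one exceptional degree is the spiral tree.

module SLO⇒Spiral (κ e D : ℕ) (G : Graph (suc (Spiral.N κ e D)))
  (t : 𝒯 (suc (suc e)) (suc (Spiral.N κ e D)) (suc κ) G)
  {v₀ : Fin (suc (Spiral.N κ e D))} {_≺_ : Rel (Fin (suc (Spiral.N κ e D))) 0ℓ} (slo : IsSLO* G v₀ _≺_)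
  (exceptional : OneExceptionalDegree G (suc (suc e))) where
  open Spiral κ e D
  open 𝒯 t
  open IsTreeWithBoundary isTreeWithBoundary
  open IsSLO* slo
  open IsSLO isSLO using (isStrictTotalOrder; h-dist; S1; S2; S3) renaming (h to height)
  open IsStrictTotalOrder isStrictTotalOrder using (asym; irrefl)
  open RootTree G (proj₂ tree) v₀ height h-dist using (h≡0⇒root; h-root; rooting)
  open Walks G using (Adj-sym)

  module _ (τ : Permutation′ (suc N)) (τ-increasing : ∀ {i j} → toℕ i ℕ.< toℕ j → (τ ⟨$⟩ʳ i) ≺ (τ ⟨$⟩ʳ j))
    (rt : Rooting G v₀) (rt-h : ∀ v → Rooting.h rt v ≡ height v) where
    open Rooting rt hiding (h-root)

    τ0≡v₀ : τ ⟨$⟩ʳ zero ≡ v₀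
    τ0≡v₀ = at (τ ⟨$⟩ˡ v₀) (Perm.inverseʳ τ)
      where
      at : ∀ i → τ ⟨$⟩ʳ i ≡ v₀ → τ ⟨$⟩ʳ zero ≡ v₀
      at zero    eq = eq
      at (suc i) eq = h≡0⇒root (ℕ.n≤0⇒n≡0 (≡.subst (height (τ ⟨$⟩ʳ zero) ℕ.≤_) h-root
        (S1 (≡.subst ((τ ⟨$⟩ʳ zero) ≺_) eq (τ-increasing {zero} {suc i} (s≤s z≤n))))))

    open LabelRooting rt τ τ0≡v₀ using (labelling; p; p-parent; nonroot)
    open Labelling labelling using (children; degree-root; count-root; count-children)

    closed : ∀ {i j} → toℕ i ℕ.< toℕ j → Interior G (τ ⟨$⟩ʳ j) → Interior G (τ ⟨$⟩ʳ i)
    closed {i} i<j int with boundary⊎interior (τ ⟨$⟩ʳ i)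
    ... | inj₂ int′ = int′
    ... | inj₁ b    = contradiction (≡.subst (2 ℕ.≤_) (S3 (τ-increasing i<j) b) int) λ { (s≤s ()) }

    open InteriorFirst κ e D G t labelling closed using (≤κ⇒interior; p≤κ; children-degree)

    child : ∀ (x : Fin N) → let u = τ ⟨$⟩ʳ suc x in Adj G (P u) u × height u ≡ suc (height (P u))
    child x = Adj-sym (P-adj (nonroot x)) , ≡.trans (≡.sym (rt-h _)) (≡.trans (h-parent (nonroot x)) (≡.cong suc (rt-h _)))

    -- If the parents were inverted, `S2` would invert the children as well.
    monotone-Fin : ∀ (a b : Fin N) → toℕ a ℕ.< toℕ b → p (toℕ a) ℕ.≤ p (toℕ b)
    monotone-Fin a b a<b = ℕ.≮⇒≥ λ pb<pa → asym (τ-increasing {suc a} {suc b} (s≤s a<b))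
      (S2 (≡.subst₂ _≺_ (Perm.inverseʳ τ) (Perm.inverseʳ τ) (τ-increasing (≡.subst₂ ℕ._<_ (p-parent b) (p-parent a) pb<pa))) (child b) (child a))

    monotone : Monotone N p
    monotone {x} {y} x<y y<N = ≡.subst₂ (λ a b → p a ℕ.≤ p b) (Fin.toℕ-fromℕ< x<N) (Fin.toℕ-fromℕ< y<N)
      (monotone-Fin (Fin.fromℕ< x<N) (Fin.fromℕ< y<N) (≡.subst₂ ℕ._<_ (≡.sym (Fin.toℕ-fromℕ< x<N)) (≡.sym (Fin.toℕ-fromℕ< y<N)) x<y))
      where x<N = ℕ.<-trans x<y y<N

    -- If the exceptional vertex has an index below κ, `S4` bounds its degree by that of the vertex
    -- at κ, which is d; so its degree is d all the same.
    small-degree : ∀ i → toℕ i ℕ.< κ → degree G (τ ⟨$⟩ʳ i) ≡ suc q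
    small-degree i i<κ = case ((τ ⟨$⟩ʳ i) Fin.≟ proj₁ exceptional)
      where
      int : Interior G (τ ⟨$⟩ʳ i)
      int = ≤κ⇒interior i (ℕ.<⇒≤ i<κ)
      rest : ∀ w → Interior G w → w ≢ proj₁ exceptional → degree G w ≡ suc q
      rest = proj₂ (proj₂ (proj₂ exceptional))
      l : Fin (suc N)
      l = Fin.fromℕ< (s≤s κ≤N)
      l≡ : toℕ l ≡ κ
      l≡ = Fin.toℕ-fromℕ< (s≤s κ≤N)
      i≺l : (τ ⟨$⟩ʳ i) ≺ (τ ⟨$⟩ʳ l)
      i≺l = τ-increasing (≡.subst (toℕ i ℕ.<_) (≡.sym l≡) i<κ)
      intl : Interior G (τ ⟨$⟩ʳ l)
      intl = ≤κ⇒interior l (ℕ.≤-reflexive l≡)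
      case : Dec ((τ ⟨$⟩ʳ i) ≡ proj₁ exceptional) → degree G (τ ⟨$⟩ʳ i) ≡ suc q
      case (no ne)  = rest _ int ne
      case (yes eq) = ℕ.≤-antisym (ℕ.≤-trans (S4 int intl i≺l) (ℕ.≤-reflexive (rest _ intl λ eq′ → irrefl (≡.trans eq (≡.sym eq′)) i≺l)))
        (interior-degree _ int)

    counts : ∀ t → t ℕ.< κ → count≤ N p t ≡ m t
    counts zero    t<κ = ≡.trans count-root (≡.trans (≡.sym degree-root) (≡.trans (small-degree zero t<κ) (≡.cong suc (≡.sym (ℕ.+-identityʳ q)))))
    counts (suc t) t<κ = ≡.trans (count-children t) (≡.trans (≡.cong₂ ℕ._+_ (counts t (ℕ.<-trans (ℕ.n<1+n t) t<κ)) child-count) (≡.sym (m-suc t)))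
      where
      child-count : children (suc t) ≡ q
      child-count = let v , _ , deg , idx = children-degree t (ℕ.<⇒≤ t<κ) in
        ℕ.suc-injective (≡.trans (≡.sym deg) (≡.trans (≡.cong (degree G) (≡.sym (Perm.inverseʳ τ))) (small-degree (τ ⟨$⟩ˡ v) (≡.subst (ℕ._< κ) (≡.sym idx) t<κ))))

    spiralBy : SpiralIso κ e D G
    spiralBy = toSpiralIso labelling (SpiralUnique.spiral-unique κ e D p p≤κ counts monotone)

  spiral : SpiralIso κ e D G
  spiral = spiralBy (Ranking.enumeration isStrictTotalOrder) (Ranking.enumeration-increasing isStrictTotalOrder) rooting (λ _ → ≡.refl)

-- The spiral tree is an SLO*-tree.

module SpiralDepth (κ e D : ℕ) where
  open Spiral κ e D

  p*≤ : ∀ x → p* x ℕ.≤ x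
  p*≤ x = ℕ.≤-trans (ℕ.m⊓n≤n κ _) (ℕ.≤-trans (ℕ.m/n≤m (x ℕ.∸ 1) q) (ℕ.m∸n≤m x 1))

  p*-reflects : ∀ {x y} → p* x ℕ.< p* y → x ℕ.< y
  p*-reflects lt = ℕ.≰⇒> λ y≤x → ℕ.<⇒≱ lt (p*-monotone y≤x)

  private
    -- The first argument is fuel, since the recursion through `p*` is not structural. As p* x ≤ x,
    -- all fuels of at least i agree on the depth of i.
    depthᶠ : ℕ → ℕ → ℕ
    depthᶠ _       zero    = 0
    depthᶠ zero    (suc x) = 0
    depthᶠ (suc k) (suc x) = suc (depthᶠ k (p* x))

    stable : ∀ k l i → i ℕ.≤ k → i ℕ.≤ l → depthᶠ k i ≡ depthᶠ l i
    stable k       l       zero    _ _ = ≡.refl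
    stable (suc k) (suc l) (suc x) (s≤s x≤k) (s≤s x≤l) = ≡.cong suc (stable k l (p* x) (ℕ.≤-trans (p*≤ x) x≤k) (ℕ.≤-trans (p*≤ x) x≤l))

    depthᶠ-mono : ∀ k {i j} → i ℕ.≤ j → j ℕ.≤ k → depthᶠ k i ℕ.≤ depthᶠ k j
    depthᶠ-mono k       z≤n       _         = z≤n
    depthᶠ-mono (suc k) (s≤s i≤j) (s≤s j≤k) = s≤s (depthᶠ-mono k (p*-monotone i≤j) (ℕ.≤-trans (p*≤ _) j≤k))

  depth : ℕ → ℕ
  depth i = depthᶠ i i

  depth-suc : ∀ x → depth (suc x) ≡ suc (depth (p* x))
  depth-suc x = ≡.cong suc (stable x (p* x) (p* x) (p*≤ x) ℕ.≤-refl)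

  depth-mono : ∀ {i j} → i ℕ.≤ j → depth i ℕ.≤ depth j
  depth-mono {i} {j} i≤j = ≡.subst (ℕ._≤ depth j) (stable j i i i≤j ℕ.≤-refl) (depthᶠ-mono j i≤j ℕ.≤-refl)

  edges-cases : ∀ i j → edges p* i j ≡ 1 → (∃[ x ] (i ≡ suc x × p* x ≡ j)) ⊎ (∃[ x ] (j ≡ suc x × p* x ≡ i))
  edges-cases zero    zero    ()
  edges-cases zero    (suc y) eq = inj₂ (y , ≡.refl , δ≡1⇒≡ (p* y) 0 eq)
  edges-cases (suc x) j       eq with p* x ℕ.≟ j
  ... | yes px≡j = inj₁ (x , ≡.refl , px≡j)
  edges-cases (suc x) zero    eq | no px≢j = contradiction (≡.trans (≡.sym eq) (≡.trans (ℕ.+-identityʳ _) (δ-≢ px≢j))) λ ()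
  edges-cases (suc x) (suc y) eq | no px≢j = inj₂ (y , ≡.refl , δ≡1⇒≡ (p* y) (suc x) (≡.trans (≡.cong (ℕ._+ δ (p* y) (suc x)) (≡.sym (δ-≢ px≢j))) eq))

module Spiral⇒SLO (κ e D : ℕ) (G : Graph (suc (Spiral.N κ e D))) (iso : SpiralIso κ e D G) where
  open Spiral κ e D
  open SpiralIso iso
  open SpiralDegrees κ e D iso
  open SpiralDepth κ e D
  open Walks G

  idx : Fin (suc N) → ℕ
  idx v = toℕ (σ ⟨$⟩ˡ v)

  idx-σ : ∀ i → idx (σ ⟨$⟩ʳ i) ≡ toℕ i
  idx-σ i = ≡.cong toℕ (Perm.inverseˡ σ)

  idx-injective : ∀ {u v} → idx u ≡ idx v → u ≡ v
  idx-injective eq = ≡.trans (≡.sym (Perm.inverseʳ σ)) (≡.trans (≡.cong (σ ⟨$⟩ʳ_) (Fin.toℕ-injective eq)) (Perm.inverseʳ σ))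

  at : ∀ {i} → i ℕ.≤ N → ∃[ v ] (idx v ≡ i)
  at i≤N = σ ⟨$⟩ʳ Fin.fromℕ< (s≤s i≤N) , ≡.trans (idx-σ _) (Fin.toℕ-fromℕ< (s≤s i≤N))

  adj-idx : ∀ u v → b2n (adj G u v) ≡ edges p* (idx u) (idx v)
  adj-idx u v = ≡.trans (≡.cong₂ (λ a b → b2n (adj G a b)) (≡.sym (Perm.inverseʳ σ)) (≡.sym (Perm.inverseʳ σ))) (spec (σ ⟨$⟩ˡ u) (σ ⟨$⟩ˡ v))

  adj-cases : ∀ {u v} → Adj G u v → (∃[ x ] (idx u ≡ suc x × p* x ≡ idx v)) ⊎ (∃[ x ] (idx v ≡ suc x × p* x ≡ idx u))
  adj-cases {u} {v} a = edges-cases (idx u) (idx v) (≡.trans (≡.sym (adj-idx u v)) (≡.cong b2n a))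

  parent-adj : ∀ {u v x} → idx u ≡ suc x → idx v ≡ p* x → Adj G u v
  parent-adj {u} {v} {x} iu iv = b2n-injective (≡.trans (≡.trans (adj-idx u v) (≡.cong₂ (edges p*) iu iv))
    (≡.trans (≡.cong₂ ℕ._+_ (δ-refl (p* x)) (no-back (p* x) (p*≤ x))) ≡.refl))
    where
    no-back : ∀ j → j ℕ.≤ x → ch p* j (suc x) ≡ 0
    no-back zero    _   = ≡.refl
    no-back (suc y) y<x = δ-≢ λ eq → ℕ.<⇒≱ (s≤s (ℕ.≤-trans (p*≤ y) (ℕ.<⇒≤ y<x))) (ℕ.≤-reflexive (≡.sym eq))

  v₀ : Fin (suc N)
  v₀ = σ ⟨$⟩ʳ zero

  height : Fin (suc N) → ℕ
  height v = depth (idx v)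

  walk-down : ∀ k v → idx v ℕ.≤ k → Walk G v v₀ (height v)
  walk-down k v le = go k (idx v) le v ≡.refl
    where
    go : ∀ k i → i ℕ.≤ k → ∀ v → idx v ≡ i → Walk G v v₀ (depth i)
    go k       zero    _         v eq = ≡.subst (λ u → Walk G v u 0) (idx-injective (≡.trans eq (≡.sym (idx-σ zero)))) stay
    go (suc k) (suc x) (s≤s x≤k) v eq = ≡.subst (Walk G v v₀) (≡.sym (depth-suc x))
      (let u , iu = at (ℕ.≤-trans (p*≤κ x) κ≤N) in walk-cons (parent-adj eq iu) (go k (p* x) (ℕ.≤-trans (p*≤ x) x≤k) u iu))

  height-edge : ∀ {u v} → Adj G u v → height u ℕ.≤ suc (height v)
  height-edge {u} {v} a with adj-cases a
  ... | inj₁ (x , iu , iv) = ℕ.≤-reflexive (≡.trans (≡.cong depth iu) (≡.trans (depth-suc x) (≡.cong (suc ∘ depth) iv)))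
  ... | inj₂ (x , iv , iu) = ℕ.≤-trans (ℕ.≤-trans (ℕ.n≤1+n _) (ℕ.≤-reflexive (≡.sym (≡.trans (≡.cong depth iv) (≡.trans (depth-suc x) (≡.cong (suc ∘ depth) iu)))))) (ℕ.n≤1+n _)

  height-min : ∀ ℓ v → Walk G v v₀ ℓ → height v ℕ.≤ ℓ
  height-min zero    v stay = ℕ.≤-reflexive (≡.cong depth (idx-σ zero))
  height-min (suc ℓ) v w = let u , a , w′ = walk-uncons w in ℕ.≤-trans (height-edge a) (s≤s (height-min ℓ u w′))

  height-dist : ∀ v → IsDist G v v₀ (height v)
  height-dist v = walk-down (idx v) v ℕ.≤-refl , λ ℓ → height-min ℓ v

  _≺_ : Rel (Fin (suc N)) 0ℓ
  u ≺ v = idx u ℕ.< idx v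

  isStrictTotalOrder : IsStrictTotalOrder _≡_ _≺_
  isStrictTotalOrder = record
    { isStrictPartialOrder = record
      { isEquivalence = ≡.isEquivalence ; irrefl = λ { ≡.refl → ℕ.<-irrefl ≡.refl } ; trans = ℕ.<-trans
      ; <-resp-≈ = (λ { ≡.refl lt → lt }) , (λ { ≡.refl lt → lt }) }
    ; compare = cmp }
    where
    cmp : ∀ u v → Tri (u ≺ v) (u ≡ v) (v ≺ u)
    cmp u v with ℕ.<-cmp (idx u) (idx v)
    ... | tri< lt ne gt = tri< lt (ne ∘ ≡.cong idx) gt
    ... | tri≈ lt eq gt = tri≈ lt (idx-injective eq) gt
    ... | tri> lt ne gt = tri> lt (ne ∘ ≡.cong idx) gt

  child-index : ∀ {v w} → Adj G v w → height w ≡ suc (height v) → ∃[ x ] (idx w ≡ suc x × p* x ≡ idx v)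
  child-index {v} {w} a hw with adj-cases a
  ... | inj₂ c = c
  ... | inj₁ (x , iv , iw) = contradiction (s≤s (ℕ.n≤1+n (height w))) (ℕ.<-irrefl (≡.trans hw (≡.cong suc up)))
    where
    up : height v ≡ suc (height w)
    up = ≡.trans (≡.cong depth iv) (≡.trans (depth-suc x) (≡.cong (suc ∘ depth) iw))

  boundary-index : ∀ {v} → Boundary G v → κ ℕ.< idx v
  boundary-index {v} b = ℕ.≰⇒> λ le → contradiction (≡.subst (2 ℕ.≤_) b (≡.subst (Interior G) (Perm.inverseʳ σ) (≤κ⇒interior (σ ⟨$⟩ˡ v) le))) λ { (s≤s ()) }

  interior-index : ∀ {v} → Interior G v → idx v ℕ.≤ κ
  interior-index {v} int = interior⇒≤κ (σ ⟨$⟩ˡ v) (≡.subst (Interior G) (≡.sym (Perm.inverseʳ σ)) int)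

  degree-index : ∀ {v} → Interior G v → ∃[ s ] (degree G v ≡ suc q ℕ.+ s × (idx v ℕ.< κ → s ≡ 0) × (idx v ≡ κ → s ≡ D))
  degree-index {v} int = let s , eq , lo , hi = degree-spiral (σ ⟨$⟩ˡ v) (interior-index int) in
    s , ≡.trans (≡.cong (degree G) (≡.sym (Perm.inverseʳ σ))) eq , lo , hi

  isSLO* : IsSLO* G v₀ _≺_
  isSLO* = record
    { isSLO = record
      { isStrictTotalOrder = isStrictTotalOrder
      ; h = height
      ; h-dist = height-dist
      ; S1 = λ lt → depth-mono (ℕ.<⇒≤ lt)
      ; S2 = λ {v₁} {v₂} {w₁} {w₂} lt (a₁ , h₁) (a₂ , h₂) → s2 lt (child-index a₁ h₁) (child-index a₂ h₂)
      ; S3 = λ {v} {w} lt b → ≡.subst (Boundary G) (Perm.inverseʳ σ) (degree-leaf (σ ⟨$⟩ˡ w) (ℕ.<-trans (boundary-index b) lt))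
      }
    -- As v precedes the interior vertex w, its index is below κ and its degree is exactly d.
    ; S4 = λ {v} {w} iv iw lt →
        let s , eq , lo , _ = degree-index iv
            s′ , eq′ , _ = degree-index iw
        in ≡.subst₂ ℕ._≤_ (≡.sym (≡.trans eq (≡.trans (≡.cong (suc q ℕ.+_) (lo (ℕ.<-≤-trans lt (interior-index iw)))) (ℕ.+-identityʳ (suc q))))) (≡.sym eq′) (ℕ.m≤m+n (suc q) s′)
    }
    where
    s2 : ∀ {v₁ v₂ w₁ w₂} → idx v₁ ℕ.< idx v₂ → ∃[ x ] (idx w₁ ≡ suc x × p* x ≡ idx v₁) → ∃[ x ] (idx w₂ ≡ suc x × p* x ≡ idx v₂) → idx w₁ ℕ.< idx w₂
    s2 lt (x , w≡ , p≡) (x′ , w≡′ , p≡′) = ≡.subst₂ ℕ._<_ (≡.sym w≡) (≡.sym w≡′) (s≤s (p*-reflects (≡.subst₂ ℕ._<_ (≡.sym p≡) (≡.sym p≡′) lt)))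

  module _ (t : 𝒯 (suc (suc e)) (suc N) (suc κ) G) where
    open 𝒯 t
    open InteriorSums G
    open NatSums using (sum; sum-cong-≗; ∑-distrib-+)
    open Counting

    -- The interior degrees sum to n + k - 2, which by the choice of `N` is (κ + 1) d + D.
    excess : sum (λ v → select (λ v → degree G (proj₁ v) ℕ.∸ suc q) 0 v (interior? G v)) ≡ D
    excess = ℕ.+-cancelʳ-≡ (suc κ ℕ.* suc q) X D (ℕ.+-cancelʳ-≡ 2 _ _ (begin
      X ℕ.+ suc κ ℕ.* suc q ℕ.+ 2                       ≡⟨ ≡.cong (ℕ._+ 2) total ⟩
      interiorDegreeSum G ℕ.+ 2                         ≡⟨ degree-sum G t ⟩
      suc N ℕ.+ suc κ                                   ≡⟨ arithmetic ⟩
      D ℕ.+ suc κ ℕ.* suc q ℕ.+ 2                       ∎))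
      where
      open ≡.≡-Reasoning
      X = sum (λ v → select (λ v → degree G (proj₁ v) ℕ.∸ suc q) 0 v (interior? G v))
      scaled : suc κ ℕ.* suc q ≡ sum (λ v → select (λ _ → suc q) 0 v (interior? G v))
      scaled = ≡.trans (≡.cong (ℕ._* suc q) (≡.sym interior-count)) (≡.trans (len (interiors G)) (sum-interiors (λ _ → suc q)))
        where
        len : ∀ {A : Set} (xs : List A) → length xs ℕ.* suc q ≡ List.foldr ℕ._+_ 0 (List.map (λ _ → suc q) xs)
        len []       = ≡.refl
        len (x ∷ xs) = ≡.cong (suc q ℕ.+_) (len xs)
      total : X ℕ.+ suc κ ℕ.* suc q ≡ interiorDegreeSum G
      total = ≡.trans (≡.cong (X ℕ.+_) scaled) (≡.trans (≡.sym (∑-distrib-+ (λ v → select (λ v → degree G (proj₁ v) ℕ.∸ suc q) 0 v (interior? G v)) (λ v → select (λ _ → suc q) 0 v (interior? G v))))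
        (≡.trans (sum-cong-≗ each) (≡.sym (sum-interiors (degree G ∘ proj₁)))))
        where
        each : ∀ v → select (λ v → degree G (proj₁ v) ℕ.∸ suc q) 0 v (interior? G v) ℕ.+ select (λ _ → suc q) 0 v (interior? G v) ≡ select (degree G ∘ proj₁) 0 v (interior? G v)
        each v with interior? G v
        ... | yes i = ℕ.m∸n+n≡m (interior-degree v i)
        ... | no _  = ≡.refl
      arithmetic : suc N ℕ.+ suc κ ≡ D ℕ.+ suc κ ℕ.* suc q ℕ.+ 2
      arithmetic = ≡.trans (ℕ.+-comm (suc N) (suc κ)) (≡.trans (≡.sym (ℕ.+-assoc (suc κ) (2 ℕ.+ suc κ ℕ.* q) D))
        (≡.trans (ℕ.+-comm (suc κ ℕ.+ (2 ℕ.+ suc κ ℕ.* q)) D) (≡.trans (≡.cong (D ℕ.+_) (≡.trans (≡.cong (suc κ ℕ.+_) (ℕ.+-comm 2 (suc κ ℕ.* q)))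
          (≡.trans (≡.sym (ℕ.+-assoc (suc κ) (suc κ ℕ.* q) 2)) (≡.cong (ℕ._+ 2) (≡.sym (ℕ.*-suc (suc κ) q)))))) (≡.sym (ℕ.+-assoc D (suc κ ℕ.* suc q) 2)))))

    oneExceptional : OneExceptionalDegree G (suc q)
    oneExceptional = v , int , ≡.trans (proj₁ (proj₂ deg)) (≡.cong (suc q ℕ.+_) (≡.trans (proj₂ (proj₂ (proj₂ deg)) idx≡) (≡.sym (≡.trans (sum-interiors _) excess))))
      , λ w iw w≢v → let s , eq , lo , _ = degree-index iw in
          ≡.trans eq (≡.trans (≡.cong (suc q ℕ.+_) (lo (ℕ.≤∧≢⇒< (interior-index iw) (λ iw≡κ → w≢v (idx-injective (≡.trans iw≡κ (≡.sym idx≡))))))) (ℕ.+-identityʳ (suc q)))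
      where
      v = proj₁ (at κ≤N)
      idx≡ : idx v ≡ κ
      idx≡ = proj₂ (at κ≤N)
      int : Interior G v
      int = ≡.subst (Interior G) (Perm.inverseʳ σ) (≤κ⇒interior (σ ⟨$⟩ˡ v) (ℕ.≤-reflexive idx≡))
      deg = degree-index int

    spiral-SLO* : IsSLO*Tree G × OneExceptionalDegree G (suc q)
    spiral-SLO* = (isTreeWithBoundary , v₀ , _≺_ , isSLO*) , oneExceptional

-- The spiral tree belongs to the class.

module ListEnds {A : Set} where

  lastOf : A → List A → A
  lastOf a []       = a
  lastOf a (x ∷ xs) = lastOf x xs

  penultimate : A → A → List A → A
  penultimate a b []       = a
  penultimate a b (x ∷ xs) = penultimate b x xs

  lastOf-∷ʳ : ∀ a xs z → lastOf a (xs ∷ʳ z) ≡ z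
  lastOf-∷ʳ a []       z = ≡.refl
  lastOf-∷ʳ a (x ∷ xs) z = lastOf-∷ʳ x xs z

  linked-end : ∀ {R : A → A → Set} {a b xs} → Linked R (a ∷ b ∷ xs) → R (penultimate a b xs) (lastOf b xs)
  linked-end {xs = []}     (r ∷ _)  = r
  linked-end {xs = x ∷ xs} (_ ∷ rs) = linked-end rs

  penultimate-All : ∀ {P : A → Set} a b xs z → All P (b ∷ xs) → P (penultimate a b (xs ∷ʳ z))
  penultimate-All a b []       z (pb ∷ _)  = pb
  penultimate-All a b (x ∷ xs) z (_ ∷ pxs) = penultimate-All b x xs z pxs

  data NonBacktracking : List A → Set where
    short : ∀ {a b} → NonBacktracking (a ∷ b ∷ [])
    _∷_   : ∀ {a b c xs} → a ≢ c → NonBacktracking (b ∷ c ∷ xs) → NonBacktracking (a ∷ b ∷ c ∷ xs)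

  -- The final triple of a closed unique path does not turn back because the
  -- path has at least three vertices.
  nonBacktracking : ∀ {a b xs z} → Unique (a ∷ b ∷ xs) → All (λ c → c ≢ z) (b ∷ xs) → (xs ≡ [] → a ≢ z) → NonBacktracking (a ∷ b ∷ (xs ∷ʳ z))
  nonBacktracking {xs = []}     u            nz      az = az ≡.refl ∷ short
  nonBacktracking {xs = x ∷ xs} ((_ ∷ a≢x ∷ _) ∷ u) (bz ∷ nz) az = a≢x ∷ nonBacktracking u nz (λ _ → bz)

module SpiralTree (κ e D : ℕ) (G : Graph (suc (Spiral.N κ e D))) (iso : SpiralIso κ e D G) where
  open Spiral κ e D
  open SpiralIso iso using (σ)
  open SpiralDegrees κ e D iso
  open SpiralDepth κ e D
  open Spiral⇒SLO κ e D G iso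
  open Walks G
  open ListEnds
  open InteriorSums G
  open NatSums using (sum-permute; sum-cong-≗)

  lower-unique : ∀ {u v w} → Adj G u v → Adj G u w → idx v ℕ.< idx u → idx w ℕ.< idx u → v ≡ w
  lower-unique {u} a b v<u w<u = let x , ux , vx = lower a v<u ; y , uy , wy = lower b w<u in
    idx-injective (≡.trans (≡.sym vx) (≡.trans (≡.cong p* (ℕ.suc-injective (≡.trans (≡.sym ux) uy))) wy))
    where
    lower : ∀ {v} → Adj G u v → idx v ℕ.< idx u → ∃[ x ] (idx u ≡ suc x × p* x ≡ idx v)
    lower a v<u with adj-cases a
    ... | inj₁ c = c
    ... | inj₂ (x , vx , ux) = contradiction (ℕ.<-trans v<u (≡.subst₂ ℕ._<_ ux (≡.sym vx) (s≤s (p*≤ x)))) (ℕ.<-irrefl ≡.refl)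

  up-or-down : ∀ {u v} → Adj G u v → idx u ℕ.< idx v ⊎ idx v ℕ.< idx u
  up-or-down {u} {v} a with ℕ.<-cmp (idx u) (idx v)
  ... | tri< lt _ _ = inj₁ lt
  ... | tri≈ _ eq _ = contradiction (≡.subst (Adj G u) (≡.sym (idx-injective eq)) a) Adj-irrefl
  ... | tri> _ _ gt = inj₂ gt

  -- A non-backtracking path that goes up once keeps going up, because a vertex
  -- has only one lower neighbour.
  ascend : ∀ {a b} xs → Linked (Adj G) (a ∷ b ∷ xs) → NonBacktracking (a ∷ b ∷ xs) → idx a ℕ.< idx b →
    idx a ℕ.< idx (lastOf b xs) × idx (penultimate a b xs) ℕ.< idx (lastOf b xs)
  ascend []       l            nb       a<b = a<b , a<b
  ascend {a} {b} (c ∷ xs) (ab ∷ l@(bc ∷ _)) (a≢c ∷ nb) a<b with up-or-down bc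
  ... | inj₁ b<c = let b<last , pen = ascend xs l nb b<c in ℕ.<-trans a<b b<last , pen
  ... | inj₂ c<b = contradiction (lower-unique (Adj-sym ab) bc a<b c<b) a≢c

  -- A path that begins downwards either descends to its end or turns upwards at some point; from
  -- there `ascend` applies and the last step rises.
  descend : ∀ {a b} xs → Linked (Adj G) (a ∷ b ∷ xs) → NonBacktracking (a ∷ b ∷ xs) → idx b ℕ.< idx a →
    idx (lastOf b xs) ℕ.< idx a ⊎ idx (penultimate a b xs) ℕ.< idx (lastOf b xs)
  descend []       l            nb       b<a = inj₁ b<a
  descend (c ∷ xs) (ab ∷ l@(bc ∷ _)) (_ ∷ nb) b<a with up-or-down bc
  ... | inj₁ b<c = inj₂ (proj₂ (ascend xs l nb b<c))
  ... | inj₂ c<b with descend xs l nb c<b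
  ...   | inj₁ last<b = inj₁ (ℕ.<-trans last<b b<a)
  ...   | inj₂ pen    = inj₂ pen

  -- A cycle that leaves u upwards can never come back to u. One that leaves downwards must return
  -- by a rising step, so its second and its last vertex are both lower neighbours of u and
  -- coincide, although the cycle repeats no vertex.
  acyclic : Acyclic G
  acyclic u (v ∷ [])     (s≤s () , _)
  acyclic u (v ∷ w ∷ xs) (_ , uniq@((u≢v ∷ u≢rest) ∷ (v≢rest ∷ _)) , l@(uv ∷ l′)) = turn (up-or-down uv)
    where
    ends : lastOf v ((w ∷ xs) ∷ʳ u) ≡ u
    ends = lastOf-∷ʳ v (w ∷ xs) u
    nb : NonBacktracking (u ∷ v ∷ ((w ∷ xs) ∷ʳ u))
    nb = nonBacktracking uniq ((u≢v ∘ ≡.sym) ∷ All.map (λ ne → ne ∘ ≡.sym) u≢rest) λ ()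
    pen : Fin (suc N)
    pen = penultimate u v ((w ∷ xs) ∷ʳ u)
    pen-adj : Adj G u pen
    pen-adj = Adj-sym (≡.subst (Adj G pen) ends (linked-end l))
    turn : idx u ℕ.< idx v ⊎ idx v ℕ.< idx u → _
    turn (inj₁ u<v) = ℕ.<-irrefl (≡.cong idx (≡.sym ends)) (proj₁ (ascend ((w ∷ xs) ∷ʳ u) l nb u<v))
    turn (inj₂ v<u) with descend ((w ∷ xs) ∷ʳ u) l nb v<u
    ... | inj₁ last<u = ℕ.<-irrefl (≡.cong idx ends) last<u
    ... | inj₂ pen<last = penultimate-All v w xs u v≢rest (lower-unique uv pen-adj v<u (≡.subst (λ z → idx pen ℕ.< idx z) ends pen<last))

  walk-++ : ∀ {u v w k l} → Walk G u v k → Walk G v w l → Walk G u w (l ℕ.+ k)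
  walk-++ p stay       = p
  walk-++ p (step q a) = step (walk-++ p q) a

  walk-reverse : ∀ {u v k} → Walk G u v k → Walk G v u k
  walk-reverse stay       = stay
  walk-reverse (step w a) = walk-cons (Adj-sym a) (walk-reverse w)

  connected : Connected G
  connected u v = _ , walk-++ (proj₁ (height-dist u)) (walk-reverse (proj₁ (height-dist v)))

  σ-cases : ∀ {P : Fin (suc N) → Set} → (∀ i → P (σ ⟨$⟩ʳ i)) → ∀ v → P v
  σ-cases {P} h v = ≡.subst P (Perm.inverseʳ σ) (h (σ ⟨$⟩ˡ v))

  κ<N : κ ℕ.< N
  κ<N = ℕ.≤-trans (t<m κ) (ℕ.m≤m+n (m κ) D)

  isTreeWithBoundary : IsTreeWithBoundary G
  isTreeWithBoundary = record
    { tree = connected , acyclic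
    ; boundary⊎interior = σ-cases split
    ; ∂V-nonempty = σ ⟨$⟩ʳ Fin.fromℕ< ℕ.≤-refl , degree-leaf _ (≡.subst (κ ℕ.<_) (≡.sym (Fin.toℕ-fromℕ< ℕ.≤-refl)) κ<N)
    ; V₀-nonempty = σ ⟨$⟩ʳ zero , ≤κ⇒interior zero z≤n
    }
    where
    split : ∀ i → Boundary G (σ ⟨$⟩ʳ i) ⊎ Interior G (σ ⟨$⟩ʳ i)
    split i with toℕ i ℕ.≤? κ
    ... | yes le = inj₂ (≤κ⇒interior i le)
    ... | no ≰   = inj₁ (degree-leaf i (ℕ.≰⇒> ≰))

  inClass : 𝒯 (suc (suc e)) (suc N) (suc κ) G
  inClass = record
    { isTreeWithBoundary = isTreeWithBoundary
    ; interior-count = ≡.trans length-interiors (≡.trans (sum-permute isInterior σ) (≡.trans (sum-cong-≗ {suc N} each) (C-initial (s≤s κ≤N))))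
    ; interior-degree = λ v int → let s , eq , _ = degree-index int in ≡.subst (suc q ℕ.≤_) (≡.sym eq) (ℕ.m≤m+n (suc q) s)
    }
    where
    each : ∀ i → isInterior (σ ⟨$⟩ʳ i) ≡ ⟦ suc (toℕ i) ≤ suc κ ⟧
    each i with interior? G (σ ⟨$⟩ʳ i)
    ... | yes int = ≡.sym (⟦≤⟧-yes (s≤s (interior⇒≤κ i int)))
    ... | no ¬int = ≡.sym (⟦≤⟧-no (s≤s (ℕ.≰⇒> (¬int ∘ ≤κ⇒interior i))))

module SpiralGraph (κ e D : ℕ) where
  open Spiral κ e D
  open SpiralDepth κ e D using (p*≤)

  isChild : ℕ → ℕ → Bool
  isChild zero    j = false
  isChild (suc x) j = p* x ℕ.≡ᵇ j

  b2n-≡ᵇ : ∀ a b → b2n (a ℕ.≡ᵇ b) ≡ δ a b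
  b2n-≡ᵇ zero    zero    = ≡.refl
  b2n-≡ᵇ zero    (suc b) = ≡.refl
  b2n-≡ᵇ (suc a) zero    = ≡.refl
  b2n-≡ᵇ (suc a) (suc b) = b2n-≡ᵇ a b

  isChild-ch : ∀ i j → b2n (isChild i j) ≡ ch p* i j
  isChild-ch zero    j = ≡.refl
  isChild-ch (suc x) j = b2n-≡ᵇ (p* x) j

  isChild-< : ∀ i j → isChild i j ≡ true → j ℕ.< i
  isChild-< (suc x) j eq = s≤s (≡.subst (ℕ._≤ x) (δ≡1⇒≡ (p* x) j (≡.trans (≡.sym (b2n-≡ᵇ (p* x) j)) (≡.cong b2n eq))) (p*≤ x))

  -- A parent has a smaller index than its child, so at most one orientation holds and the
  -- disjunction becomes the sum in `edges`.
  exclusive : ∀ i j → b2n (isChild i j ∨ isChild j i) ≡ b2n (isChild i j) ℕ.+ b2n (isChild j i)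
  exclusive i j with isChild i j in eq | isChild j i in eq′
  ... | true  | true  = contradiction (isChild-< i j eq) (ℕ.<-asym (isChild-< j i eq′))
  ... | true  | false = ≡.refl
  ... | false | _     = ≡.refl

  spiralGraph : Graph (suc N)
  spiralGraph = record
    { adj = λ u v → isChild (toℕ u) (toℕ v) ∨ isChild (toℕ v) (toℕ u)
    ; symmetric = λ u v → Bool.∨-comm (isChild (toℕ u) (toℕ v)) (isChild (toℕ v) (toℕ u))
    ; loopless = λ v → no-loop (toℕ v)
    }
    where
    no-loop : ∀ i → isChild i i ∨ isChild i i ≡ false
    no-loop i with isChild i i in eq
    ... | true  = contradiction (isChild-< i i eq) (ℕ.<-irrefl ≡.refl)
    ... | false = ≡.refl

  spiralGraph-iso : SpiralIso κ e D spiralGraph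
  spiralGraph-iso = record
    { σ = Perm.id
    ; spec = λ i j → ≡.trans (exclusive (toℕ i) (toℕ j)) (≡.cong₂ ℕ._+_ (isChild-ch (toℕ i) (toℕ j)) (isChild-ch (toℕ j) (toℕ i))) }

  spiralGraph∈𝒯 : 𝒯 (suc (suc e)) (suc N) (suc κ) spiralGraph
  spiralGraph∈𝒯 = SpiralTree.inClass κ e D spiralGraph spiralGraph-iso

-- Eigenvalues of the Dirichlet operator.

LaplacianEntries : (K : OrderedDomain) → ∀ {n} (G : Graph n) → (V₀ G → V₀ G → OrderedDomain.Carrier K) → Set
LaplacianEntries K G entry = ∀ u v → entry u v ≈ ι (δ (toℕ (proj₁ u)) (toℕ (proj₁ v)) ℕ.* degree G (proj₁ u)) - ι (b2n (adj G (proj₁ u) (proj₁ v)))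
  where open OrderedDomainProperties K

module InteriorLaplacian (K : OrderedDomain) {n : ℕ} (G : Graph n) where
  open OrderedDomainProperties K
  open LaplacianExpansion K G
  open InteriorSums G
  open ListSums +-commutativeMonoid

  graphLaplacian-cong : ∀ {f g} → (∀ v → f v ≈ g v) → ∀ v → graphLaplacian K G f v ≈ graphLaplacian K G g v
  graphLaplacian-cong h v = sum-cong-≋ (λ u → *-congˡ (+-cong (h v) (-‿cong (h u))))

  extend : (V₀ G → Carrier) → Fin n → Carrier
  extend f v = select f 0# v (interior? G v)

  extend-at : ∀ f (v : V₀ G) → extend f (proj₁ v) ≡ f v
  extend-at f (v , i) = at (interior? G v)
    where
    at : (d : Dec (Interior G v)) → select f 0# v d ≡ f (v , i)
    -- Elements of `V₀` carry a proof of interiority; uniqueness of that proof identifies the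
    -- decided element with the given one.
    at (yes i′) = ≡.cong (λ i → f (v , i)) (ℕ.≤-irrelevant i′ i)
    at (no ¬i)  = contradiction i ¬i

  extend-vanish : ∀ f v → ¬ Interior G v → extend f v ≈ 0#
  extend-vanish f v ¬i = at (interior? G v)
    where
    at : (d : Dec (Interior G v)) → select f 0# v d ≈ 0#
    at (yes i) = contradiction i ¬i
    at (no _)  = refl

  extend-restrict : ∀ f → (∀ v → ¬ Interior G v → f v ≈ 0#) → ∀ v → extend (f ∘ proj₁) v ≈ f v
  extend-restrict f h v = at (interior? G v)
    where
    at : (d : Dec (Interior G v)) → select (f ∘ proj₁) 0# v d ≈ f v
    at (yes i) = refl
    at (no ¬i) = sym (h v ¬i)

  -- Extension by zero: the columns of boundary vertices contribute nothing, so at an interior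
  -- vertex the principal submatrix acts like the full Laplacian.
  interior-laplacian : ∀ (entry : V₀ G → Carrier) u →
    (∀ v → entry v ≈ ι (δ (toℕ u) (toℕ (proj₁ v)) ℕ.* degree G u) - ι (b2n (adj G u (proj₁ v)))) → ∀ f →
    List.foldr _+_ 0# (List.map (λ v → entry v * f v) (interiors G)) ≈ graphLaplacian K G (extend f) u
  interior-laplacian entry u entry≈ f = begin-equality
    List.foldr _+_ 0# (List.map (λ v → entry v * f v) (interiors G))
      ≈⟨ foldr-catMaybes {n = n} (λ v → entry v * f v) (λ v → Maybe.map (v ,_) (dec⇒maybe (interior? G v))) (λ v → v) ⟩
    sum (λ v → maybe′ (λ v → entry v * f v) 0# (Maybe.map (v ,_) (dec⇒maybe (interior? G v))))
      ≈⟨ sum-cong-≋ (λ v → trans (reflexive (maybe-select (λ v → entry v * f v) 0# v)) (at v (interior? G v))) ⟩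
    sum (λ v → (a v - b v) * g v)
      ≈⟨ sum-cong-≋ (λ v → solve 3 (λ a b x → (a :- b) :* x := a :* x :- b :* x) refl (a v) (b v) (g v)) ⟩
    sum (λ v → a v * g v - b v * g v)
      ≈⟨ sum-sub (λ v → a v * g v) (λ v → b v * g v) ⟩
    sum (λ v → a v * g v) - sum (λ v → b v * g v)
      ≈⟨ +-congʳ (∑-δ u (degree G u) g) ⟩
    ι (degree G u) * g u - sum (λ v → b v * g v)
      ≈⟨ laplacian-expand g u ⟨
    graphLaplacian K G g u ∎
    where
    g = extend f
    a b : Fin n → Carrier
    a v = ι (δ (toℕ u) (toℕ v) ℕ.* degree G u)
    b v = ι (b2n (adj G u v))
    at : ∀ v (d : Dec (Interior G v)) → select (λ v → entry v * f v) 0# v d ≈ (a v - b v) * select f 0# v d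
    at v (yes i) = *-congʳ (entry≈ (v , i))
    at v (no _)  = sym (zeroʳ _)

  module Eigenvalues (entry : V₀ G → V₀ G → Carrier)
    (entry≈ : LaplacianEntries K G entry) where

    apply : (V₀ G → Carrier) → V₀ G → Carrier
    apply f u = List.foldr _+_ 0# (List.map (λ v → entry u v * f v) (interiors G))

    Eigenvalue : Carrier → Set
    Eigenvalue ν = ∃[ f ] ((∃[ v ] ¬ (f v ≈ 0#)) × (∀ u → apply f u ≈ ν * f u))

    apply≈ : ∀ f u → apply f u ≈ graphLaplacian K G (extend f) (proj₁ u)
    apply≈ f u = interior-laplacian (entry u) (proj₁ u) (entry≈ u) f

    module _ (gs : GraphGroundState K G) where
      open GraphGroundState gs

      ground-eigenvalue : ∃ (Interior G) → Eigenvalue μ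
      ground-eigenvalue v₀ = f ∘ proj₁ , (v₀ , λ f≈0 → positive _ (proj₂ v₀) (≤-reflexive f≈0)) ,
        λ u → trans (apply≈ (f ∘ proj₁) u) (trans (graphLaplacian-cong (extend-restrict f vanish) (proj₁ u)) (eigen (proj₁ u) (proj₂ u)))

ground-least : (K : OrderedDomain) → let open OrderedDomainProperties K in ∀ {N} (G : Graph (suc N)) → Labelling G →
  (entry : V₀ G → V₀ G → Carrier) (entry≈ : LaplacianEntries K G entry) →
  (gs : GraphGroundState K G) → ∀ ν → InteriorLaplacian.Eigenvalues.Eigenvalue K G entry entry≈ ν → GraphGroundState.μ gs ≤ ν
ground-least K G lab entry entry≈ gs ν (g , (v , g≉0) , eig) = Coordinates.smallest K G lab gs (extend-vanish g)
  (λ u i → trans (sym (apply≈ g (u , i))) (trans (eig (u , i)) (*-congˡ (reflexive (≡.sym (extend-at g (u , i)))))))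
  (proj₁ v) (λ g≈0 → g≉0 (trans (reflexive (≡.sym (extend-at g v))) g≈0))
  where
  open OrderedDomainProperties K
  open InteriorLaplacian K G
  open Eigenvalues entry entry≈

+/1≡ι : ∀ a → (+ a) ℚ./ 1 ≡ ℚ-Domain.ι a
+/1≡ι a = ℚ.toℚᵘ-injective (ℚᵘ.≃-trans (ℚ.toℚᵘ-fromℚᵘ (ℚᵘ.mkℚᵘ (+ a) 0)) (ℚᵘ.≃-sym (toℚᵘ-ι a)))

fromℤ-Δ₀ : ∀ {n} (G : Graph n) → LaplacianEntries ℝ-orderedDomain G (λ u v → fromℤ (Δ₀ G u v))
fromℤ-Δ₀ G (u , i) (v , j) = ℝ-Lemmas.pointwise (fromℤ (Δ₀ G (u , i) (v , j))) (ι (δ (toℕ u) (toℕ v) ℕ.* degree G u) - ι (b2n (adj G u v)))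
  λ m → ≡.trans (entry (u Fin.≟ v) (adj G u v) ≡.refl)
    (≡.sym (≡.cong₂ (λ a b → a ℚ.+ (ℚ.- 1ℚ) ℚ.* b) (seq-ι (δ (toℕ u) (toℕ v) ℕ.* degree G u) m) (seq-ι (b2n (adj G u v)) m)))
  where
  open OrderedDomainProperties ℝ-orderedDomain
  value : Bool → Bool → ℤ.ℤ
  value same b = (if same then + degree G u else + 0) ℤ.- (if b then + 1 else + 0)
  entry : (d : Dec (u ≡ v)) → ∀ b → adj G u v ≡ b →
    value ⌊ d ⌋ b ℚ./ 1 ≡ ℚ-Domain.ι (δ (toℕ u) (toℕ v) ℕ.* degree G u) ℚ.+ (ℚ.- 1ℚ) ℚ.* ℚ-Domain.ι (b2n b)
  entry (yes ≡.refl) true  a with () ← ≡.trans (≡.sym a) (loopless G u)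
  entry (yes ≡.refl) false a = ≡.trans (≡.cong (ℚ._/ 1) (ℤ.+-identityʳ (+ degree G u))) (≡.trans (+/1≡ι (degree G u))
    (≡.trans (≡.cong ℚ-Domain.ι (≡.trans (≡.sym (ℕ.*-identityˡ (degree G u))) (≡.cong (ℕ._* degree G u) (≡.sym (δ-refl (toℕ u)))))) (≡.sym (ℚ.+-identityʳ _))))
  entry (no u≢v) b a = ≡.trans (off b) (≡.cong (λ k → ℚ-Domain.ι (k ℕ.* degree G u) ℚ.+ (ℚ.- 1ℚ) ℚ.* ℚ-Domain.ι (b2n b)) (≡.sym (δ-≢ (u≢v ∘ Fin.toℕ-injective))))
    where
    off : ∀ b → value false b ℚ./ 1 ≡ 0ℚ ℚ.+ (ℚ.- 1ℚ) ℚ.* ℚ-Domain.ι (b2n b)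
    off true  = ≡.refl
    off false = ≡.refl

module _ {N : ℕ} (G : Graph (suc N)) where
  open InteriorLaplacian.Eigenvalues ℝ-orderedDomain G (λ u v → fromℤ (Δ₀ G u v)) (fromℤ-Δ₀ G)

  toIsEigenvalue : ∀ ν → Eigenvalue ν → IsEigenvalue G ν
  toIsEigenvalue ν (f , nz , eq) = f , nz , λ u → eq u

  fromIsEigenvalue : ∀ ν → IsEigenvalue G ν → Eigenvalue ν
  fromIsEigenvalue ν (f , nz , eq) = f , nz , λ u → eq u

  tree-smallest : IsTreeWithBoundary G → (gs : GraphGroundState ℝ-orderedDomain G) → IsSmallestEigenvalue G (GraphGroundState.μ gs)
  tree-smallest twb gs =
      toIsEigenvalue (GraphGroundState.μ gs) (ground-eigenvalue gs V₀-nonempty)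
    , λ ν ev → ground-least ℝ-orderedDomain G (LabelRooting.labelling (TreeRooting.rootAt tree zero) Perm.id ≡.refl)
        (λ u v → fromℤ (Δ₀ G u v)) (fromℤ-Δ₀ G) gs ν (fromIsEigenvalue ν ev)
    where open IsTreeWithBoundary twb

-- Double negation commutes with finite conjunctions, so all comparisons between the values on a
-- graph may be assumed decided at once.
¬¬-all : ∀ {n} {P : Fin n → Set} → (∀ i → ¬ ¬ P i) → ¬ ¬ (∀ i → P i)
¬¬-all {zero}  h k = k λ ()
¬¬-all {suc n} h k = h zero λ p₀ → ¬¬-all (h ∘ suc) λ ps → k λ { zero → p₀ ; (suc i) → ps i }

module IsoSearch (κ e D : ℕ) (G : Graph (suc (Spiral.N κ e D))) where
  open Spiral κ e D

  IsIso : (Fin (suc N) → Fin (suc N)) → Set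
  IsIso f = (∀ i j → f i ≡ f j → i ≡ j) × (∀ i j → b2n (adj G (f i) (f j)) ≡ edges p* (toℕ i) (toℕ j))

  isIso? : ∀ f → Dec (IsIso f)
  isIso? f = Fin.all? (λ i → Fin.all? λ j → (f i Fin.≟ f j) →-dec (i Fin.≟ j))
    ×-dec Fin.all? (λ i → Fin.all? λ j → b2n (adj G (f i) (f j)) ℕ.≟ edges p* (toℕ i) (toℕ j))

  isIso-resp : ∀ {f g} → (∀ i → f i ≡ g i) → IsIso f → IsIso g
  isIso-resp eq (inj , spec) =
      (λ i j e → inj i j (≡.trans (eq i) (≡.trans e (≡.sym (eq j)))))
    , (λ i j → ≡.trans (≡.cong₂ (λ a b → b2n (adj G a b)) (≡.sym (eq i)) (≡.sym (eq j))) (spec i j))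

  -- The self-maps of the vertex set are enumerated by finitely many codes and `IsIso` is decidable,
  -- so an isomorphism that cannot fail to exist is found by search.
  spiralIso-stable : ¬ ¬ SpiralIso κ e D G → SpiralIso κ e D G
  spiralIso-stable ¬¬iso = found (decidable-stable (Fin.any? (λ c → isIso? (Fin.finToFun c))) (λ none → ¬¬iso (none ∘ encode)))
    where
    encode : SpiralIso κ e D G → ∃[ c ] IsIso (Fin.finToFun c)
    encode iso = Fin.funToFin (σ ⟨$⟩ʳ_) , isIso-resp (λ i → ≡.sym (Fin.finToFun-funToFin (σ ⟨$⟩ʳ_) i))
      ((λ i j eq → ≡.trans (≡.sym (Perm.inverseˡ σ)) (≡.trans (≡.cong (σ ⟨$⟩ˡ_) eq) (Perm.inverseˡ σ))) , spec)
      where open SpiralIso iso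
    found : ∃[ c ] IsIso (Fin.finToFun c) → SpiralIso κ e D G
    found (c , inj , spec) = record { σ = injective⇒permutation (Fin.finToFun c) (λ {i} {j} → inj i j) ; spec = spec }

spiralIso⇒≅ : ∀ {κ e D} {G H : Graph (suc (Spiral.N κ e D))} → SpiralIso κ e D G → SpiralIso κ e D H → G ≅ H
spiralIso⇒≅ {G = G} {H} isoG isoH = Perm._∘ₚ_ (Perm.flip σG) σH , λ u v → b2n-injective
  (≡.trans (≡.cong₂ (λ a b → b2n (adj G a b)) (≡.sym (Perm.inverseʳ σG)) (≡.sym (Perm.inverseʳ σG)))
    (≡.trans (SpiralIso.spec isoG (σG ⟨$⟩ˡ u) (σG ⟨$⟩ˡ v)) (≡.sym (SpiralIso.spec isoH (σG ⟨$⟩ˡ u) (σG ⟨$⟩ˡ v)))))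
  where
  σG = SpiralIso.σ isoG
  σH = SpiralIso.σ isoH

module FaberKrahnSpiral (κ e D : ℕ)
  (ground : ∀ {n} (G : Graph n) → IsTreeWithBoundary G → GraphGroundState ℝ-orderedDomain G) where
  open Spiral κ e D using (N)
  open SpiralGraph κ e D

  Class : Graph (suc N) → Set
  Class = 𝒯 (suc (suc e)) (suc N) (suc κ)

  state : ∀ {G} → Class G → GraphGroundState ℝ-orderedDomain G
  state {G} t = ground G (𝒯.isTreeWithBoundary t)

  μ : ∀ {G} → Class G → ℝ
  μ t = GraphGroundState.μ (state t)

  μ-smallest : ∀ {G} (t : Class G) → IsSmallestEigenvalue G (μ t)
  μ-smallest {G} t = tree-smallest G (𝒯.isTreeWithBoundary t) (state t)

  ¬¬-compare : ∀ {n} (f : Fin n → ℝ) → ¬ ¬ (∀ u v → Dec (f u ≤ᵣ f v))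
  ¬¬-compare f = ¬¬-all λ u → ¬¬-all λ v k → k (no λ le → k (yes le))

  module _ {G H : Graph (suc N)} (isoG : SpiralIso κ e D G) (tG : Class G) (tH : Class H)
    (f≤? : ∀ u v → Dec (GraphGroundState.f (state tH) u ≤ᵣ GraphGroundState.f (state tH) v)) where
    open Comparison ℝ-orderedDomain κ e D G isoG (state tG) H tH (state tH)
      (sort-tree ℝ-orderedDomain H (IsTreeWithBoundary.tree (𝒯.isTreeWithBoundary tH)) (GraphGroundState.f (state tH)) f≤?) f≤? public
      using (μ≤; rigidity)

  spiral-least : ∀ {G H} → SpiralIso κ e D G → (tG : Class G) (tH : Class H) → μ tG ≤ᵣ μ tH
  spiral-least isoG tG tH = ℝ-Lemmas.≤ᵣ-stable {μ tG} {μ tH} λ k → ¬¬-compare (GraphGroundState.f (state tH)) λ f≤? → k (μ≤ isoG tG tH f≤?)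

  -- The definition speaks of any smallest eigenvalues μ₁ and ν, whereas the constructed ones are
  -- compared. The minimality of μ₁ and that of `μ tH` link the two.
  spiral⇒FaberKrahn : ∀ {G} → Class G → SpiralIso κ e D G → FaberKrahn Class G
  spiral⇒FaberKrahn tG isoG = tG , λ H tH {μ₁} {ν} μ₁-least ν-least →
    ℝ-Lemmas.≤ᵣ-trans {μ₁} {μ tG} {ν} (proj₂ μ₁-least (μ tG) (proj₁ (μ-smallest tG)))
      (ℝ-Lemmas.≤ᵣ-trans {μ tG} {μ tH} {ν} (spiral-least isoG tG tH) (proj₂ (μ-smallest tH) ν (proj₁ ν-least)))

  -- The concrete `spiralGraph` is the competitor: optimality of H against it is the reverse
  -- inequality from which `rigidity` starts.
  FaberKrahn⇒spiral : ∀ {H} → FaberKrahn Class H → SpiralIso κ e D H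
  FaberKrahn⇒spiral {H} (tH , least) = IsoSearch.spiralIso-stable κ e D H λ ¬iso →
    ¬¬-compare (GraphGroundState.f (state tH)) λ f≤? →
      ¬iso (rigidity spiralGraph-iso spiralGraph∈𝒯 tH f≤? (least spiralGraph spiralGraph∈𝒯 {μ tH} {μ spiralGraph∈𝒯} (μ-smallest tH) (μ-smallest spiralGraph∈𝒯)))

  SLO*⇒spiral : ∀ {G} → Class G → IsSLO*Tree G × OneExceptionalDegree G (suc (suc e)) → SpiralIso κ e D G
  SLO*⇒spiral {G} t ((_ , _ , _ , slo) , exc) = SLO⇒Spiral.spiral κ e D G t slo exc

  characterisation : ∀ G → Class G → FaberKrahn Class G ⇔ (IsSLO*Tree G × OneExceptionalDegree G (suc (suc e)))
  characterisation G t = mk⇔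
    (λ fk → Spiral⇒SLO.spiral-SLO* κ e D G (FaberKrahn⇒spiral fk) t)
    (λ slo → spiral⇒FaberKrahn t (SLO*⇒spiral t slo))

open import Data.Nat.Base using (_+_; _≤_; _<_)

theorem2 : (n k d : ℕ) → 1 ≤ k → k < n → 2 ≤ d →
    ((G : Graph n) → 𝒯 d n k G → FaberKrahn (𝒯 d n k) G ⇔ (IsSLO*Tree G × OneExceptionalDegree G d))
    × ((G : Graph n) → 𝒯 d n k G → interiorDegreeSum G + 2 ≡ n + k)
    × ((G H : Graph n) → 𝒯 d n k G → 𝒯 d n k H → IsSLO*Tree G × OneExceptionalDegree G d → IsSLO*Tree H × OneExceptionalDegree H d → G ≅ H)
theorem2 (suc N) (suc κ) (suc (suc e)) (s≤s _) (s≤s _) (s≤s (s≤s _)) =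
    (λ G t → let D , eq = size-bound G t in optimal D eq G t)
  , degree-sum
  , (λ G H tG tH sloG sloH → let D , eq = size-bound G tG in unique D eq G H tG tH sloG sloH)
  where
  d = suc (suc e)
  -- Keeping N general allows the equation from `size-bound` to be eliminated, after which the
  -- vertex set is literally that of the spiral tree.
  optimal : ∀ {N} D → N ≡ Spiral.N κ e D → (G : Graph (suc N)) → 𝒯 d (suc N) (suc κ) G →
    FaberKrahn (𝒯 d (suc N) (suc κ)) G ⇔ (IsSLO*Tree G × OneExceptionalDegree G d)
  optimal D ≡.refl = FaberKrahnSpiral.characterisation κ e D tree-groundState
  unique : ∀ {N} D → N ≡ Spiral.N κ e D → (G H : Graph (suc N)) → 𝒯 d (suc N) (suc κ) G → 𝒯 d (suc N) (suc κ) H →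
    IsSLO*Tree G × OneExceptionalDegree G d → IsSLO*Tree H × OneExceptionalDegree H d → G ≅ H
  unique D ≡.refl G H tG tH sloG sloH = spiralIso⇒≅ (SLO⇒Spiral.spiral κ e D G tG (proj₂ (proj₂ (proj₂ (proj₁ sloG)))) (proj₂ sloG))
    (SLO⇒Spiral.spiral κ e D H tH (proj₂ (proj₂ (proj₂ (proj₁ sloH)))) (proj₂ sloH))
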